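{- Let $n$ be an odd positive integer. For $k=1,2,\ldots$ define the polynomial $$a_k(x)=\sum_{m=0}^{k} J(k-m,n)\,x^m,$$ where $J(a,n)$ denotes the Jacobi symbol, and let $$H_n(x)=\det\big[a_{i+j-1}(x)\big]_{1\le i,j\le n}.$$ Then $H_n(x)$ is identically zero unless $n=p$ is a prime. For $n=p$ an odd prime, $$H_p(x)=(-1)^{\frac{p-1}{2}}\,p^{\frac{p-3}{2}}\sum_{k=0}^{p-1} b_k x^k,\qquad\text{where } b_k=\sum_{i=1}^{p-k}\left(\frac{i}{p}\right)$$ and $\left(\frac{i}{p}\right)$ is the Legendre symbol. Furthermore, $H_p(x)$ is divisible in $\mathbb{Z}[x]$ by $x^2$ if $p\equiv 3\pmod 4$, and by $x^2(x^2-1)$ if $p\equiv 1\pmod 4$.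
   Context: For an odd integer $m$ with prime factorization $m=p_1^{e_1}\cdots p_k^{e_k}$, the Jacobi symbol is $J(a,m)=\prod_{i}\left(\frac{a}{p_i}\right)^{e_i}$, where for a prime $p$ the Legendre symbol $\left(\frac{a}{p}\right)$ is $0$ if $p\mid a$, $1$ if $a$ is a nonzero quadratic residue mod $p$, and $-1$ if $a$ is a quadratic nonresidue mod $p$. (For $n=1$ the empty product convention gives $J(a,1)=1$.)
   Formalization: The case n = 1 is excluded (n ≥ 3 is assumed), since with J(a,1) = 1 one has H_1(x) = 1 + x, which is not identically zero although 1 is not prime. -}

module Defs where

open import Data.Bool using (Bool; true; false; if_then_else_)
open import Data.Nat as ℕ using (ℕ; zero; suc; _%_; _/_; _∸_; NonZero)
open import Data.Nat.Primality.Factorisation using (factorise; factors)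
open import Data.Integer as ℤ using (ℤ; +_; -_; _+_; _*_; -[1+_])
open import Data.List as List using (List; []; _∷_; map; foldr; upTo)
open import Data.Bool.ListAction using (any)
open import Data.Fin using (Fin; punchIn; toℕ) renaming (zero to fzero; suc to fsuc)
open import Data.Product using (Σ; ∃; _,_)
open import Relation.Nullary.Decidable using (⌊_⌋)
open import Relation.Binary.PropositionalEquality using (_≡_)

isSquareMod : ℕ → (p : ℕ) → .{{NonZero p}} → Bool
isSquareMod a p = any (λ y → ⌊ (y ℕ.* y) % p ℕ.≟ a % p ⌋) (upTo p)

legendre : ℕ → (p : ℕ) → ℤ
legendre a zero = + 0   -- never used (p is a prime)
legendre a p@(suc _) with a % p
... | zero  = + 0
... | suc _ = if isSquareMod a p then + 1 else - (+ 1)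

-- Jacobi symbol J(a,m) = ∏_{p ∈ prime factors of m, with multiplicity} (a/p).
-- (The value at m = 0 is irrelevant; J(a,1) = 1 as the empty product.)
jacobi : ℕ → ℕ → ℤ
jacobi a zero = + 0
jacobi a m@(suc _) = foldr _*_ (+ 1) (map (legendre a) (factors (factorise m)))

-- Polynomials over ℤ as coefficient lists (constant term first)

Poly : Set
Poly = List ℤ

coeff : Poly → ℕ → ℤ
coeff []       _       = + 0
coeff (c ∷ cs) zero    = c
coeff (c ∷ cs) (suc k) = coeff cs k

_≈ₚ_ : Poly → Poly → Set
P ≈ₚ Q = ∀ k → coeff P k ≡ coeff Q k

infix 4 _≈ₚ_

_+ₚ_ : Poly → Poly → Poly
[]       +ₚ q        = q
(c ∷ cs) +ₚ []       = c ∷ cs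
(c ∷ cs) +ₚ (d ∷ ds) = (c + d) ∷ (cs +ₚ ds)

scaleₚ : ℤ → Poly → Poly
scaleₚ a = map (a *_)

_*ₚ_ : Poly → Poly → Poly
[]       *ₚ q = []
(c ∷ cs) *ₚ q = scaleₚ c q +ₚ (+ 0 ∷ (cs *ₚ q))

infixl 6 _+ₚ_
infixl 7 _*ₚ_

zeroₚ oneₚ X : Poly
zeroₚ = []
oneₚ  = + 1 ∷ []
X     = + 0 ∷ + 1 ∷ []

constₚ : ℤ → Poly
constₚ a = a ∷ []

_∣ₚ_ : Poly → Poly → Set
D ∣ₚ P = ∃ λ Q → P ≈ₚ D *ₚ Q

fromCoeffs : (d : ℕ) → (ℕ → ℤ) → Poly
fromCoeffs d f = map f (upTo (suc d))

sumFin : ∀ {n} → (Fin n → Poly) → Poly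
sumFin {zero}  f = zeroₚ
sumFin {suc n} f = f fzero +ₚ sumFin (λ j → f (fsuc j))

signℤ : ℕ → ℤ
signℤ zero = + 1
signℤ (suc k) = - signℤ k

det : ∀ n → (Fin n → Fin n → Poly) → Poly
det zero    M = oneₚ
det (suc n) M =
  sumFin (λ j → scaleₚ (signℤ (toℕ j)) (M fzero j *ₚ det n (λ i k → M (fsuc i) (punchIn j k))))

aPoly : (n k : ℕ) → Poly
aPoly n k = fromCoeffs k (λ m → jacobi (k ∸ m) n)

-- H_n(x) = det [ a_{i+j-1}(x) ]_{1 ≤ i,j ≤ n}; with 0-based i,j this is a_{i+j+1}
H : ℕ → Poly
H n = det n (λ i j → aPoly n (suc (toℕ i ℕ.+ toℕ j)))

bCoeff : (p k : ℕ) → ℤ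
bCoeff p k = foldr _+_ (+ 0) (map (λ i → legendre (suc i) p) (upTo (p ∸ k)))

{-# OPTIONS --safe #-}

-- Polynomials are evaluated at integers t. Since a_{k+1} = J(k+1) + t a_k, subtracting t times the
-- preceding row turns every row of H_n but the first into a constant row (J(i+j-1))_j.
-- If n = q c is composite with q prime, these rows are dependent: rows 2 and 2 + c coincide when
-- q divides c, and otherwise the rows 2 + s c with 0 ≤ s < q add up to zero, because Σ_s (s/q) = 0.
-- If n = p is prime, the determinant, as a linear form φ in the first row, kills every row of
-- M = (χ(i+j-1)), and M² = p I - 𝟙 with 𝟙 the all-ones matrix, so φ is a multiple of the sum of the
-- coordinates. The factor is det (χ(x+y)) with x, y in F_p^*, which is det A for A = (χ(x-y)) up to a
-- reversal of columns. With ε = χ(-1) one has A² = ε (p I - 𝟙 - χ χᵀ), and A is conjugate to -A by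
-- multiplication by a nonresidue, so
--   det (u I + v A)² = det (u² I - v² A²) = ((u² - ε p v²)^((p-3)/2) (u² - ε v²))²,
-- where the sign of the square root is found modulo 4.

module Submission where

-- All of this takes place in ℤ, so nothing is divided: formulas that call for an inverse carry an
-- extra factor `a` or `p`, cancelled once it is known to be nonzero. For the same reason the square
-- root is not extracted between polynomials in u and v, but at integers chosen so that a congruence
-- decides the sign. The factor of φ can be read off because applying φ to row i of M² = p I - 𝟙
-- gives p φ(e_i) = φ(𝟙) for every i: the minors φ(e_i) are all equal, and the last one, which is
-- accessible, gives them all. Both M² and A² rest on Σ χ(t) χ(t + d) = -1 for d nonzero modulo p.
-- The b_k arise by summing a_{j+1} = J(j+1) + t a_j along the first row. Here b_0 and b_1 are
-- complete sums of χ, hence the factor x²; for even χ also b_k = - b_{p+1-k}, hence the roots 1 and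
-- -1. Determinants are handled as alternating forms in rows of any length, so that fixing a row or
-- deleting a column leads to an object of the same kind.

open import Defs
open import Data.Nat as ℕ using (ℕ; zero; suc; _%_; _/_; _∸_; _≤_; z≤n; s≤s)
import Data.Nat.Properties as ℕ
open import Data.Nat.Primality using (Prime; ¬prime[1]; prime⇒nonZero; prime⇒nonTrivial)
open import Data.Nat.Primality.Factorisation using (PrimeFactorisation; factorise; factors; factorisationUnique; primeFactorisation[p])
open import Data.Nat.ListAction using (product)
open import Data.List.Relation.Unary.All using (All; []; _∷_)
open import Data.List.Relation.Binary.Permutation.Propositional.Properties using (↭-singleton-inv)
open PrimeFactorisation using (isFactorisation; factorsPrime)
open import Data.Integer as ℤ using (ℤ; +_; -_; _+_; _*_; _^_; _-_)
import Data.Integer.Properties as ℤ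
open import Data.Integer.Tactic.RingSolver using (solve-∀)
import Data.Nat.Tactic.RingSolver as ℕRing
open import Data.Fin as Fin using (Fin; toℕ; fromℕ; inject₁; opposite; punchIn) renaming (zero to fzero; suc to fsuc)
import Data.Fin.Properties as Fin
open import Data.Integer.Divisibility.Signed as Div using (divides)
open import Data.Product using (∃; _×_; _,_; proj₁; proj₂)
open import Data.Sum using (_⊎_; inj₁; inj₂)
open import Data.Bool using (true; false; T; if_then_else_)
open import Data.Bool.ListAction using (any)
open import Data.List using (List; []; _∷_; map; foldr; upTo; applyUpTo)
open import Data.List.Membership.Propositional using (lose; find)
open import Data.List.Membership.Propositional.Properties using (∈-upTo⁺)
open import Data.List.Relation.Unary.Any.Properties using (any⁺; any⁻)
import Data.Nat.Divisibility as ℕDiv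
open import Data.Nat.DivMod using (m%n<n; m≡m%n+[m/n]*n; m*n/n≡m)
open import Data.Nat.Coprimality using (prime⇒coprime; coprime-Bézout)
open import Data.Nat.GCD using (module Bézout)
open import Data.Integer using (_%ℕ_; _/ℕ_; ∣_∣)
open import Data.Integer.DivMod using (n%ℕd<d; a≡a%ℕn+[a/ℕn]*n)
open import Data.Fin.Permutation using (permutation; reverse)
open import Data.Unit using (⊤; tt)
open import Data.Empty using (⊥-elim)
open import Data.Vec.Functional using (Vector) renaming (_∷_ to _◂_)
open import Algebra.Properties.Semiring.Sum ℤ.+-*-semiring
  using (sum; sum-syntax; sum-cong-≗; ∑-distrib-+; ∑-comm; sum-permute; sum-init-last; *-distribˡ-sum; *-distribʳ-sum)
open import Function using (_∘_; Injective)
open import Relation.Nullary using (¬_; Dec; yes; no)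
open import Relation.Nullary.Decidable using (⌊_⌋; toWitness; fromWitness; map′)
open import Relation.Binary.PropositionalEquality using (_≡_; refl; sym; trans; cong; cong₂; subst; subst₂; _≗_; module ≡-Reasoning)

-- Alternating forms

∑-0 : ∀ n → ∑[ i < n ] (+ 0) ≡ + 0
∑-0 zero    = refl
∑-0 (suc n) = trans (ℤ.+-identityˡ _) (∑-0 n)

∑-zero : ∀ {n} {f : Fin n → ℤ} → (∀ i → f i ≡ + 0) → sum f ≡ + 0
∑-zero {n} eq = trans (sum-cong-≗ eq) (∑-0 n)

∑-neg : ∀ {n} (f : Fin n → ℤ) → ∑[ i < n ] (- f i) ≡ - sum f
∑-neg {zero}  f = refl
∑-neg {suc n} f = trans (cong (_+_ (- f fzero)) (∑-neg (f ∘ fsuc))) (sym (ℤ.neg-distrib-+ (f fzero) _))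

∑-lin : ∀ {n} (f g : Fin n → ℤ) c → ∑[ i < n ] (f i + c * g i) ≡ sum f + c * sum g
∑-lin f g c = trans (∑-distrib-+ f (λ i → c * g i)) (cong (_+_ (sum f)) (sym (*-distribˡ-sum c g)))

Matrix : ℕ → ℕ → Set
Matrix n m = Fin n → Fin m → ℤ

infix 4 _≐_
_≐_ : ∀ {n m} → Matrix n m → Matrix n m → Set
A ≐ B = ∀ i j → A i j ≡ B i j

◂-cong : ∀ {n m} {u v : Vector ℤ m} {R S : Matrix n m} → u ≗ v → R ≐ S → (u ◂ R) ≐ (v ◂ S)
◂-cong u≗v R≐S fzero    = u≗v
◂-cong u≗v R≐S (fsuc i) = R≐S i

◂-η : ∀ {n m} (R : Matrix (suc n) m) → R ≐ (R fzero ◂ R ∘ fsuc)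
◂-η R fzero    j = refl
◂-η R (fsuc i) j = refl

Extensional : ∀ {n m} → (Matrix n m → ℤ) → Set
Extensional D = ∀ {R S} → R ≐ S → D R ≡ D S

Swap : ∀ {m} n → (Matrix (suc n) m → ℤ) → Set
Swap zero    D = ⊤
Swap (suc n) D = ∀ u v R → D (u ◂ v ◂ R) ≡ - D (v ◂ u ◂ R)

-- Linearity in the first row and antisymmetry in the first two, imposed again on the form in the
-- remaining rows that is left when the first row is fixed.
mutual
  Alternating : ∀ {m} n → (Matrix n m → ℤ) → Set
  Alternating n D = Extensional D × Step n D

  Step : ∀ {m} n → (Matrix n m → ℤ) → Set
  Step zero    D = ⊤
  Step (suc n) D = (∀ u c v R → D ((λ j → u j + c * v j) ◂ R) ≡ D (u ◂ R) + c * D (v ◂ R))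
                 × (∀ v → Alternating n (λ R → D (v ◂ R)))
                 × Swap n D

module Alt {n m} {D : Matrix (suc n) m → ℤ} (alt : Alternating (suc n) D) where

  ext : Extensional D
  ext = proj₁ alt

  lin : ∀ u c v R → D ((λ j → u j + c * v j) ◂ R) ≡ D (u ◂ R) + c * D (v ◂ R)
  lin = proj₁ (proj₂ alt)

  rest : ∀ v → Alternating n (λ R → D (v ◂ R))
  rest = proj₁ (proj₂ (proj₂ alt))

  swap : Swap n D
  swap = proj₂ (proj₂ (proj₂ alt))

  ext-head : ∀ {u v} R → u ≗ v → D (u ◂ R) ≡ D (v ◂ R)
  ext-head R e = ext (◂-cong e (λ _ _ → refl))

  -- Linearity at two zero vectors with coefficient -1 gives the difference of a value with itself.
  zero-head : ∀ R → D ((λ _ → + 0) ◂ R) ≡ + 0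
  zero-head R = trans (lin (λ _ → + 0) (- + 1) (λ _ → + 0) R) (cancel (D ((λ _ → + 0) ◂ R)))
    where
    cancel : ∀ x → x + - + 1 * x ≡ + 0
    cancel = solve-∀

  scale-head : ∀ c v R → D ((λ j → c * v j) ◂ R) ≡ c * D (v ◂ R)
  scale-head c v R = begin
    D ((λ j → c * v j) ◂ R)              ≡⟨ ext-head R (λ j → ℤ.+-identityˡ _) ⟨
    D ((λ j → + 0 + c * v j) ◂ R)        ≡⟨ lin _ c v R ⟩
    D ((λ j → + 0) ◂ R) + c * D (v ◂ R)  ≡⟨ cong (_+ c * D (v ◂ R)) (zero-head R) ⟩
    + 0 + c * D (v ◂ R)                  ≡⟨ ℤ.+-identityˡ _ ⟩
    c * D (v ◂ R)                        ∎
    where open ≡-Reasoning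

  sum-head : ∀ {k} (c : Fin k → ℤ) (w : Matrix k m) R →
             D ((λ j → ∑[ t < k ] (c t * w t j)) ◂ R) ≡ ∑[ t < k ] (c t * D (w t ◂ R))
  sum-head {zero}  c w R = zero-head R
  sum-head {suc k} c w R = begin
    D ((λ j → c fzero * w fzero j + ∑[ t < k ] (c (fsuc t) * w (fsuc t) j)) ◂ R)
      ≡⟨ ext-head R (λ j → ℤ.+-comm (c fzero * w fzero j) _) ⟩
    D ((λ j → ∑[ t < k ] (c (fsuc t) * w (fsuc t) j) + c fzero * w fzero j) ◂ R)
      ≡⟨ lin _ (c fzero) (w fzero) R ⟩
    D ((λ j → ∑[ t < k ] (c (fsuc t) * w (fsuc t) j)) ◂ R) + c fzero * D (w fzero ◂ R)
      ≡⟨ cong (_+ c fzero * D (w fzero ◂ R)) (sum-head (c ∘ fsuc) (w ∘ fsuc) R) ⟩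
    ∑[ t < k ] (c (fsuc t) * D (w (fsuc t) ◂ R)) + c fzero * D (w fzero ◂ R)
      ≡⟨ ℤ.+-comm (∑[ t < k ] (c (fsuc t) * D (w (fsuc t) ◂ R))) _ ⟩
    c fzero * D (w fzero ◂ R) + ∑[ t < k ] (c (fsuc t) * D (w (fsuc t) ◂ R)) ∎
    where open ≡-Reasoning

x≡-x⇒x≡0 : ∀ {x} → x ≡ - x → x ≡ + 0
-- For a nonzero x the two sides have different constructors.
x≡-x⇒x≡0 {+ zero}    eq = refl

alt-cong : ∀ {m} n {D E : Matrix n m → ℤ} → (∀ R → D R ≡ E R) → Alternating n D → Alternating n E
alt-cong zero    eq (ext , _) = (λ e → trans (sym (eq _)) (trans (ext e) (eq _))) , tt
alt-cong {m} (suc n) {D} {E} eq alt =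
  (λ e → trans (sym (eq _)) (trans (ext e) (eq _)))
  , (λ u c v R → trans (sym (eq _)) (trans (lin u c v R) (cong₂ (λ a b → a + c * b) (eq _) (eq _))))
  , (λ v → alt-cong n (λ R → eq (v ◂ R)) (rest v))
  , swap′ n eq swap
  where
  open Alt alt
  swap′ : ∀ n {D E : Matrix (suc n) m → ℤ} → (∀ R → D R ≡ E R) → Swap n D → Swap n E
  swap′ zero    eq _ = tt
  swap′ (suc n) eq s u v R = trans (sym (eq _)) (trans (s u v R) (cong -_ (eq _)))

-- Applied to the expansion of a determinant along its first row, which is a combination of minors.
alt-sum : ∀ {m k} n (c : Fin k → ℤ) (D : Fin k → Matrix n m → ℤ) → (∀ t → Alternating n (D t)) →
          Alternating n (λ R → ∑[ t < k ] (c t * D t R))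
alt-sum zero    c D alt = (λ e → sum-cong-≗ λ t → cong (c t *_) (proj₁ (alt t) e)) , tt
alt-sum {m} {k} (suc n) c D alt =
  (λ e → sum-cong-≗ λ t → cong (c t *_) (proj₁ (alt t) e))
  , (λ u x v R → trans
       (sum-cong-≗ λ t → trans (cong (c t *_) (Alt.lin (alt t) u x v R)) (distr (c t) (D t (u ◂ R)) x (D t (v ◂ R))))
       (∑-lin (λ t → c t * D t (u ◂ R)) (λ t → c t * D t (v ◂ R)) x))
  , (λ v → alt-sum n c (λ t R → D t (v ◂ R)) (λ t → Alt.rest (alt t) v))
  , swap′ n D (λ t → Alt.swap (alt t))
  where
  distr : ∀ c a x b → c * (a + x * b) ≡ c * a + x * (c * b)
  distr = solve-∀
  swap′ : ∀ n (D : Fin k → Matrix (suc n) m → ℤ) → (∀ t → Swap n (D t)) → Swap n (λ R → ∑[ t < k ] (c t * D t R))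
  swap′ zero    D _ = tt
  swap′ (suc n) D s u v R = trans
    (sum-cong-≗ λ t → trans (cong (c t *_) (s t u v R)) (sym (ℤ.neg-distribʳ-* (c t) _)))
    (∑-neg (λ t → c t * D t (v ◂ u ◂ R)))

record IsLinear {k m} (L : Vector ℤ k → Vector ℤ m) : Set where
  field
    L-cong : ∀ {u v} → u ≗ v → L u ≗ L v
    L-lin  : ∀ u c v i → L (λ j → u j + c * v j) i ≡ L u i + c * L v i

-- Serves three maps that act on each row separately: deletion of a coordinate, insertion of a zero,
-- and multiplication by a matrix on the right.
alt-precompose : ∀ {m k} n {D : Matrix n m → ℤ} {L : Vector ℤ k → Vector ℤ m} → IsLinear L →
                 Alternating n D → Alternating n (λ R → D (L ∘ R))
alt-precompose zero L (ext , _) = (λ e → ext (λ ())) , tt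
alt-precompose {m} {k} (suc n) {D} {L} isL alt =
  (λ e → ext (λ i → L-cong (e i)))
  , (λ u c v R → trans (ext (∘-◂ _ R))
       (trans (ext-head _ (L-lin u c v))
       (trans (lin (L u) c (L v) (L ∘ R))
       (cong₂ (λ a b → a + c * b) (sym (ext (∘-◂ u R))) (sym (ext (∘-◂ v R)))))))
  , (λ v → alt-cong n (λ R → sym (ext (∘-◂ v R))) (alt-precompose n isL (rest (L v))))
  , swap′ n ext swap
  where
  open Alt alt
  open IsLinear isL
  ∘-◂ : ∀ {n} v (R : Matrix n k) → (L ∘ (v ◂ R)) ≐ (L v ◂ L ∘ R)
  ∘-◂ v R fzero    j = refl
  ∘-◂ v R (fsuc i) j = refl
  ∘-◂◂ : ∀ {n} u v (R : Matrix n k) → (L ∘ (u ◂ v ◂ R)) ≐ (L u ◂ L v ◂ L ∘ R)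
  ∘-◂◂ u v R fzero           j = refl
  ∘-◂◂ u v R (fsuc fzero)    j = refl
  ∘-◂◂ u v R (fsuc (fsuc i)) j = refl
  swap′ : ∀ n {D : Matrix (suc n) m → ℤ} → Extensional D → Swap n D → Swap n (λ R → D (L ∘ R))
  swap′ zero    ext _ = tt
  swap′ (suc n) ext s u v R =
    trans (ext (∘-◂◂ u v R)) (trans (s (L u) (L v) (L ∘ R)) (cong -_ (sym (ext (∘-◂◂ v u R)))))

-- If the equal row stands second, antisymmetry gives `x ≡ - x`. Otherwise the second row is swapped
-- to the front and fixed there, which brings the two equal rows one place closer.
repeated-head : ∀ {m n} {D : Matrix (suc n) m → ℤ} → Alternating (suc n) D →
                ∀ v R k → R k ≗ v → D (v ◂ R) ≡ + 0
repeated-head {n = suc n} {D} alt v R fzero e =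
  trans (ext (◂-cong (λ _ → refl) (◂-η R)))
 (trans (ext (◂-cong (λ _ → refl) (◂-cong e (λ _ _ → refl))))
        (x≡-x⇒x≡0 (swap v v (R ∘ fsuc))))
  where open Alt alt
repeated-head {n = suc n} {D} alt v R (fsuc k) e =
  trans (ext (◂-cong (λ _ → refl) (◂-η R)))
 (trans (swap v (R fzero) (R ∘ fsuc))
        (cong -_ (repeated-head (rest (R fzero)) v (R ∘ fsuc) k e)))
  where open Alt alt

-- The typical `E` is `λ R → D (v ◂ R)`, which kills `v` by `repeated-head`. Row operations with a
-- row that is already fixed thus become statements about a form in the remaining rows.
Kills : ∀ {m n} → (Matrix n m → ℤ) → Vector ℤ m → Set
Kills {n = n} E y = ∀ R (k : Fin n) → R k ≗ y → E R ≡ + 0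

kills-rest : ∀ {m n} {E : Matrix (suc n) m → ℤ} {y} v → Kills E y → Kills (λ R → E (v ◂ R)) y
kills-rest v kills R k e = kills (v ◂ R) (fsuc k) e

-- Linearity removes the multiple of `y` from one row at a time; the form left after fixing that row
-- still kills `y`.
add-killed : ∀ {m} n {E : Matrix n m → ℤ} → Alternating n E → ∀ {y} → Kills E y →
             ∀ R (c : Fin n → ℤ) → E (λ i j → R i j + c i * y j) ≡ E R
add-killed zero    (ext , _) kills R c = ext (λ ())
add-killed (suc n) {E} alt {y} kills R c = begin
  E (λ i j → R i j + c i * y j)                     ≡⟨ ext (◂-η _) ⟩
  E ((λ j → R fzero j + c fzero * y j) ◂ R′)        ≡⟨ lin (R fzero) (c fzero) y R′ ⟩
  E (R fzero ◂ R′) + c fzero * E (y ◂ R′)           ≡⟨ cong (λ z → E (R fzero ◂ R′) + c fzero * z) (kills (y ◂ R′) fzero (λ _ → refl)) ⟩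
  E (R fzero ◂ R′) + c fzero * + 0                  ≡⟨ drop (E (R fzero ◂ R′)) (c fzero) ⟩
  E (R fzero ◂ R′)                                  ≡⟨ add-killed n (rest (R fzero)) (kills-rest (R fzero) kills) (R ∘ fsuc) (c ∘ fsuc) ⟩
  E (R fzero ◂ R ∘ fsuc)                            ≡⟨ ext (◂-η R) ⟨
  E R                                               ∎
  where
  open ≡-Reasoning
  open Alt alt
  R′ : Matrix n _
  R′ i j = R (fsuc i) j + c (fsuc i) * y j
  drop : ∀ x c → x + c * + 0 ≡ x
  drop = solve-∀

-- Row j passes over j rows, with one change of sign each: the origin of the signs in the cofactor
-- expansion.
move-to-front : ∀ {m} n {D : Matrix (suc n) m → ℤ} → Alternating (suc n) D → ∀ R j →
                D (R j ◂ R ∘ punchIn j) ≡ signℤ (toℕ j) * D R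
move-to-front n {D} alt R fzero = trans (ext (λ { fzero _ → refl ; (fsuc i) _ → refl })) (sym (ℤ.*-identityˡ _))
  where open Alt alt
move-to-front (suc n) {D} alt R (fsuc j) = begin
  D (R (fsuc j) ◂ R ∘ punchIn (fsuc j))                          ≡⟨ ext (◂-cong (λ _ → refl) (◂-η _)) ⟩
  D (R (fsuc j) ◂ R fzero ◂ R ∘ fsuc ∘ punchIn j)                ≡⟨ swap _ _ _ ⟩
  - D (R fzero ◂ R (fsuc j) ◂ R ∘ fsuc ∘ punchIn j)              ≡⟨ cong -_ (move-to-front n (rest (R fzero)) (R ∘ fsuc) j) ⟩
  - (signℤ (toℕ j) * D (R fzero ◂ R ∘ fsuc))                     ≡⟨ ℤ.neg-distribˡ-* (signℤ (toℕ j)) _ ⟩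
  - signℤ (toℕ j) * D (R fzero ◂ R ∘ fsuc)                       ≡⟨ cong (- signℤ (toℕ j) *_) (ext (◂-η R)) ⟨
  - signℤ (toℕ j) * D R                                          ∎
  where
  open ≡-Reasoning
  open Alt alt

-- Determinants

detℤ : ∀ n → Matrix n n → ℤ
detℤ zero    M = + 1
detℤ (suc n) M = ∑[ j < suc n ] (signℤ (toℕ j) * M fzero j * detℤ n (λ i k → M (fsuc i) (punchIn j k)))

det-cong : ∀ n {A B : Matrix n n} → A ≐ B → detℤ n A ≡ detℤ n B
det-cong zero    e = refl
det-cong (suc n) e = sum-cong-≗ λ j →
  cong₂ (λ a b → signℤ (toℕ j) * a * b) (e fzero j) (det-cong n (λ i k → e (fsuc i) (punchIn j k)))

linear-∘ : ∀ {m k} (f : Fin m → Fin k) → IsLinear {k} {m} (_∘ f)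
linear-∘ f = record { L-cong = λ e → e ∘ f ; L-lin = λ _ _ _ _ → refl }

-- The double Laplace expansion along two rows u and v, where h stands for the complementary minors.
module _ where
  private
    -- Where neither u nor v takes column 0, this column belongs to every complementary minor;
    -- `lift` puts it back when the expansion is carried out over the other columns.
    lift : ∀ {n} → (Fin n → Fin (2 ℕ.+ n)) → Fin (suc n) → Fin (3 ℕ.+ n)
    lift f fzero    = fzero
    lift f (fsuc x) = fsuc (f x)

    Laplace : ∀ {n} (u v : Fin (2 ℕ.+ n) → ℤ) (h : (Fin n → Fin (2 ℕ.+ n)) → ℤ) → ℤ
    Laplace {n} u v h = ∑[ j < 2 ℕ.+ n ] (signℤ (toℕ j) * u j *
      ∑[ k < suc n ] (signℤ (toℕ k) * v (punchIn j k) * h (λ x → punchIn j (punchIn k x))))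

    Tail : ∀ {n} (u v : Fin (2 ℕ.+ n) → ℤ) (h : (Fin n → Fin (2 ℕ.+ n)) → ℤ) → ℤ
    Tail {n} u v h = ∑[ j < suc n ] (signℤ (toℕ j) * u (fsuc j) *
      ∑[ k < n ] (signℤ (toℕ k) * v (fsuc (punchIn j k)) * h (λ x → punchIn (fsuc j) (punchIn (fsuc k) x))))

    Edge : ∀ {n} (u v : Fin (2 ℕ.+ n) → ℤ) (h : (Fin n → Fin (2 ℕ.+ n)) → ℤ) → ℤ
    Edge {n} u v h = ∑[ k < suc n ] (u fzero * (signℤ (toℕ k) * v (fsuc k) * h (λ x → fsuc (punchIn k x))))

    -- The terms are sorted by the row that takes column 0: u, v or neither. Exchanging u and v
    -- interchanges the first two groups, which have opposite signs, so antisymmetry is reduced to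
    -- `Tail`, an expansion with one column fewer.
    split : ∀ {n} u v (h : (Fin n → Fin (2 ℕ.+ n)) → ℤ) →
            Laplace u v h ≡ Edge u v h + (- + 1 * Edge v u h + Tail u v h)
    split {n} u v h = cong₂ _+_
      (trans (cong (_* ∑[ k < suc n ] P k) (ℤ.*-identityˡ (u fzero))) (*-distribˡ-sum (u fzero) P))
      (begin
        ∑[ j < suc n ] (- s j * u (fsuc j) * (+ 1 * v fzero * g j + ∑[ k < n ] (- s k * v (fsuc (punchIn j k)) * h₂ j k)))
          ≡⟨ sum-cong-≗ (λ j → cong (λ z → - s j * u (fsuc j) * (+ 1 * v fzero * g j + z))
               (trans (sum-cong-≗ (λ k → neg₃ (s k) (v (fsuc (punchIn j k))) (h₂ j k)))
                      (∑-neg (λ k → s k * v (fsuc (punchIn j k)) * h₂ j k)))) ⟩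
        ∑[ j < suc n ] (- s j * u (fsuc j) * (+ 1 * v fzero * g j + - I j))
          ≡⟨ sum-cong-≗ (λ j → rearr (s j) (u (fsuc j)) (v fzero) (g j) (I j)) ⟩
        ∑[ j < suc n ] (s j * u (fsuc j) * I j + - + 1 * (v fzero * (s j * u (fsuc j) * g j)))
          ≡⟨ ∑-lin (λ j → s j * u (fsuc j) * I j) (λ j → v fzero * (s j * u (fsuc j) * g j)) (- + 1) ⟩
        Tail u v h + - + 1 * Edge v u h
          ≡⟨ ℤ.+-comm (Tail u v h) _ ⟩
        - + 1 * Edge v u h + Tail u v h ∎)
      where
      open ≡-Reasoning
      s : ∀ {m} → Fin m → ℤ
      s j = signℤ (toℕ j)
      g : Fin (suc n) → ℤ
      g j = h (λ x → fsuc (punchIn j x))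
      P : Fin (suc n) → ℤ
      P k = s k * v (fsuc k) * g k
      h₂ : Fin (suc n) → Fin n → ℤ
      h₂ j k = h (λ x → punchIn (fsuc j) (punchIn (fsuc k) x))
      I : Fin (suc n) → ℤ
      I j = ∑[ k < n ] (s k * v (fsuc (punchIn j k)) * h₂ j k)
      neg₃ : ∀ a b c → - a * b * c ≡ - (a * b * c)
      neg₃ = solve-∀
      rearr : ∀ s u v g i → - s * u * (+ 1 * v * g + - i) ≡ s * u * i + - + 1 * (v * (s * u * g))
      rearr = solve-∀

  laplace-antisym : ∀ {n} u v (h : (Fin n → Fin (2 ℕ.+ n)) → ℤ) → (∀ {f g} → f ≗ g → h f ≡ h g) →
                    Laplace u v h ≡ - Laplace v u h
  laplace-antisym {n} u v h h-cong = begin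
    Laplace u v h                                            ≡⟨ split u v h ⟩
    Edge u v h + (- + 1 * Edge v u h + Tail u v h)           ≡⟨ cong (λ z → Edge u v h + (- + 1 * Edge v u h + z)) (tail n h h-cong u v) ⟩
    Edge u v h + (- + 1 * Edge v u h + - Tail v u h)         ≡⟨ rearr (Edge u v h) (Edge v u h) (Tail v u h) ⟩
    - (Edge v u h + (- + 1 * Edge u v h + Tail v u h))       ≡⟨ cong -_ (split v u h) ⟨
    - Laplace v u h                                          ∎
    where
    open ≡-Reasoning
    rearr : ∀ a b c → a + (- + 1 * b + - c) ≡ - (b + (- + 1 * a + c))
    rearr = solve-∀
    tail : ∀ n (h : (Fin n → Fin (2 ℕ.+ n)) → ℤ) → (∀ {f g} → f ≗ g → h f ≡ h g) → ∀ u v →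
           Tail u v h ≡ - Tail v u h
    tail zero    h h-cong u v = trans (tail-0 u v) (cong -_ (sym (tail-0 v u)))
      where
      tail-0 : ∀ u v → Tail u v h ≡ + 0
      tail-0 u v = trans (ℤ.+-identityʳ _) (ℤ.*-zeroʳ (+ 1 * u (fsuc fzero)))
    tail (suc n) h h-cong u v =
      trans (tail-suc u v) (trans (laplace-antisym (u ∘ fsuc) (v ∘ fsuc) (h ∘ lift) (λ e → h-cong (lift-cong e)))
                                  (cong -_ (sym (tail-suc v u))))
      where
      lift-cong : ∀ {f g : Fin n → Fin (2 ℕ.+ n)} → f ≗ g → lift f ≗ lift g
      lift-cong e fzero    = refl
      lift-cong e (fsuc x) = cong fsuc (e x)
      lift-punchIn : ∀ j k → (λ x → punchIn (fsuc j) (punchIn (fsuc k) x)) ≗ lift (λ x → punchIn j (punchIn k x))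
      lift-punchIn j k fzero    = refl
      lift-punchIn j k (fsuc x) = refl
      tail-suc : ∀ u v → Tail u v h ≡ Laplace (u ∘ fsuc) (v ∘ fsuc) (h ∘ lift)
      tail-suc u v = sum-cong-≗ λ j → cong (signℤ (toℕ j) * u (fsuc j) *_) (sum-cong-≗ λ k →
        cong (signℤ (toℕ k) * v (fsuc (punchIn j k)) *_) (h-cong (lift-punchIn j k)))

-- With the first row fixed, the expansion is a combination of smaller determinants precomposed with
-- the deletion of a column, so induction applies. Only the exchange of the first two rows needs two
-- expansions at once.
det-alternating : ∀ n → Alternating n (detℤ n)
det-alternating zero    = det-cong zero , tt
det-alternating (suc n) =
  det-cong (suc n)
  , (λ u c v R → trans
       (sum-cong-≗ λ j → distr (signℤ (toℕ j)) (u j) c (v j) (detℤ n (λ i k → R i (punchIn j k))))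
       (∑-lin (λ j → signℤ (toℕ j) * u j * detℤ n (λ i k → R i (punchIn j k)))
              (λ j → signℤ (toℕ j) * v j * detℤ n (λ i k → R i (punchIn j k))) c))
  , (λ v → alt-sum n (λ j → signℤ (toℕ j) * v j) (λ j R → detℤ n (λ i k → R i (punchIn j k)))
             (λ j → alt-precompose n (linear-∘ (punchIn j)) (det-alternating n)))
  , swap n
  where
  distr : ∀ s u c v d → s * (u + c * v) * d ≡ s * u * d + c * (s * v * d)
  distr = solve-∀
  swap : ∀ n → Swap n (detℤ (suc n))
  swap zero    = tt
  swap (suc n) u v R = laplace-antisym u v (λ f → detℤ n (λ i x → R i (f x)))
                         (λ e → det-cong n (λ i x → cong (R i) (e x)))

-- The identity matrix, by recursion and not by deciding equality, so that its rows and minors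
-- reduce by computation.
δ : ∀ {n} → Matrix n n
δ fzero    fzero    = + 1
δ fzero    (fsuc j) = + 0
δ (fsuc i) fzero    = + 0
δ (fsuc i) (fsuc j) = δ i j

δ-refl : ∀ {n} (i : Fin n) → δ i i ≡ + 1
δ-refl fzero    = refl
δ-refl (fsuc i) = δ-refl i

δ-≢ : ∀ {n} {i j : Fin n} → ¬ i ≡ j → δ i j ≡ + 0
δ-≢ {i = fzero}  {fzero}  ne = ⊥-elim (ne refl)
δ-≢ {i = fzero}  {fsuc j} ne = refl
δ-≢ {i = fsuc i} {fzero}  ne = refl
δ-≢ {i = fsuc i} {fsuc j} ne = δ-≢ (ne ∘ cong fsuc)

δ-sym : ∀ {n} (i j : Fin n) → δ i j ≡ δ j i
δ-sym fzero    fzero    = refl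
δ-sym fzero    (fsuc j) = refl
δ-sym (fsuc i) fzero    = refl
δ-sym (fsuc i) (fsuc j) = δ-sym i j

∑-δ : ∀ {n} (v : Fin n → ℤ) i → ∑[ j < n ] (v j * δ j i) ≡ v i
∑-δ v fzero    = trans (cong₂ _+_ (ℤ.*-identityʳ (v fzero)) (∑-zero λ j → ℤ.*-zeroʳ (v (fsuc j)))) (ℤ.+-identityʳ _)
∑-δ v (fsuc i) = trans (cong₂ _+_ (ℤ.*-zeroʳ (v fzero)) (∑-δ (v ∘ fsuc) i)) (ℤ.+-identityˡ _)

∑-δˡ : ∀ {n} i (v : Fin n → ℤ) → ∑[ j < n ] (δ i j * v j) ≡ v i
∑-δˡ i v = trans (sum-cong-≗ λ j → trans (ℤ.*-comm (δ i j) (v j)) (cong (v j *_) (δ-sym i j))) (∑-δ v i)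

det-δ : ∀ n → detℤ n δ ≡ + 1
det-δ zero    = refl
det-δ (suc n) = trans (cong₂ _+_ (trans (ℤ.*-identityˡ _) (det-δ n))
  (∑-zero λ j → trans (cong (_* detℤ n (λ i k → δ (fsuc i) (punchIn (fsuc j) k))) (ℤ.*-zeroʳ (signℤ (toℕ (fsuc j))))) (ℤ.*-zeroˡ (detℤ n (λ i k → δ (fsuc i) (punchIn (fsuc j) k))))))
  (ℤ.+-identityʳ (+ 1))

-- A right inverse to the deletion of coordinate j. It turns a form in rows of length n + 1 into one
-- in rows of length n, as the induction in `det-unique` requires.
insert-0 : ∀ {n} → Fin (suc n) → Vector ℤ n → Vector ℤ (suc n)
insert-0 fzero              w fzero    = + 0
insert-0 fzero              w (fsuc i) = w i
insert-0 {suc n} (fsuc j)   w fzero    = w fzero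
insert-0 {suc n} (fsuc j)   w (fsuc i) = insert-0 j (w ∘ fsuc) i

linear-insert-0 : ∀ {n} (j : Fin (suc n)) → IsLinear (insert-0 j)
linear-insert-0 j = record { L-cong = L-cong j ; L-lin = L-lin j }
  where
  L-cong : ∀ {n} (j : Fin (suc n)) {u v} → u ≗ v → insert-0 j u ≗ insert-0 j v
  L-cong fzero              e fzero    = refl
  L-cong fzero              e (fsuc i) = e i
  L-cong {suc n} (fsuc j)   e fzero    = e fzero
  L-cong {suc n} (fsuc j)   e (fsuc i) = L-cong j (e ∘ fsuc) i
  L-lin : ∀ {n} (j : Fin (suc n)) u c v i →
          insert-0 j (λ k → u k + c * v k) i ≡ insert-0 j u i + c * insert-0 j v i
  L-lin fzero            u c v fzero    = sym (trans (ℤ.+-identityˡ _) (ℤ.*-zeroʳ c))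
  L-lin fzero            u c v (fsuc i) = refl
  L-lin {suc n} (fsuc j) u c v fzero    = refl
  L-lin {suc n} (fsuc j) u c v (fsuc i) = L-lin j (u ∘ fsuc) c (v ∘ fsuc) i

-- Deleting a coordinate and putting 0 in its place amounts to adding a multiple of `δ j`, a row
-- operation that is free when `δ j` is the first row.
insert-0-punchIn : ∀ {n} j (v : Vector ℤ (suc n)) i → insert-0 j (v ∘ punchIn j) i ≡ v i + - v j * δ j i
insert-0-punchIn fzero            v fzero    = sym (trans (cong (_+_ (v fzero)) (ℤ.*-identityʳ (- v fzero))) (ℤ.+-inverseʳ (v fzero)))
insert-0-punchIn fzero            v (fsuc i) = sym (trans (cong (_+_ (v (fsuc i))) (ℤ.*-zeroʳ (- v fzero))) (ℤ.+-identityʳ _))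
insert-0-punchIn {suc n} (fsuc j) v fzero    = sym (trans (cong (_+_ (v fzero)) (ℤ.*-zeroʳ (- v (fsuc j)))) (ℤ.+-identityʳ _))
insert-0-punchIn {suc n} (fsuc j) v (fsuc i) = insert-0-punchIn j (v ∘ fsuc) i

insert-0-δ : ∀ {n} (j : Fin (suc n)) k → insert-0 j (δ k) ≗ δ (punchIn j k)
insert-0-δ fzero            k        fzero    = refl
insert-0-δ fzero            k        (fsuc i) = refl
insert-0-δ {suc n} (fsuc j) fzero    fzero    = refl
insert-0-δ {suc n} (fsuc j) (fsuc k) fzero    = refl
insert-0-δ {suc n} (fsuc j) fzero    (fsuc i) = insert-0-zero j i
  where
  insert-0-zero : ∀ {n} (j : Fin (suc n)) → insert-0 j (λ _ → + 0) ≗ (λ _ → + 0)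
  insert-0-zero fzero            fzero    = refl
  insert-0-zero fzero            (fsuc i) = refl
  insert-0-zero {suc n} (fsuc j) fzero    = refl
  insert-0-zero {suc n} (fsuc j) (fsuc i) = insert-0-zero j i
insert-0-δ {suc n} (fsuc j) (fsuc k) (fsuc i) = insert-0-δ j k i

-- The first row is expanded in the basis `δ j`. Beneath a first row `δ j` column j can be cleared,
-- which leaves an alternating form in the n × n minor; induction evaluates it up to its value at
-- `δ`, and moving row j of `δ` back to its place yields the sign.
det-unique : ∀ n {D : Matrix n n → ℤ} → Alternating n D → ∀ M → D M ≡ detℤ n M * D δ
det-unique zero    {D} (ext , _) M = trans (ext (λ ())) (sym (ℤ.*-identityˡ (D δ)))
det-unique (suc n) {D} alt M = begin
  D M                                                     ≡⟨ ext (◂-η M) ⟩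
  D (M fzero ◂ R)                                         ≡⟨ ext-head R (λ i → sym (∑-δ (M fzero) i)) ⟩
  D ((λ i → ∑[ j < suc n ] (M fzero j * δ j i)) ◂ R)      ≡⟨ sum-head (M fzero) δ R ⟩
  ∑[ j < suc n ] (M fzero j * D (δ j ◂ R))                ≡⟨ sum-cong-≗ term ⟩
  ∑[ j < suc n ] (signℤ (toℕ j) * M fzero j * minor j * D δ) ≡⟨ *-distribʳ-sum (D δ) (λ j → signℤ (toℕ j) * M fzero j * minor j) ⟨
  detℤ (suc n) M * D δ                                    ∎
  where
  open ≡-Reasoning
  open Alt alt
  R : Matrix n (suc n)
  R = M ∘ fsuc
  minor : Fin (suc n) → ℤ
  minor j = detℤ n (λ i k → R i (punchIn j k))
  rearr : ∀ m d s e → m * (d * (s * e)) ≡ s * m * d * e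
  rearr = solve-∀
  D′ : Fin (suc n) → Matrix n n → ℤ
  D′ j N = D (δ j ◂ insert-0 j ∘ N)
  cofactor : ∀ j → D (δ j ◂ R) ≡ minor j * (signℤ (toℕ j) * D δ)
  cofactor j = begin
    D (δ j ◂ R)
      ≡⟨ add-killed n (rest (δ j)) (λ S k e → repeated-head alt (δ j) S k e) R (λ i → - R i j) ⟨
    D (δ j ◂ (λ i k → R i k + - R i j * δ j k))
      ≡⟨ ext (◂-cong (λ _ → refl) (λ i k → sym (insert-0-punchIn j (R i) k))) ⟩
    D′ j (λ i k → R i (punchIn j k))
      ≡⟨ det-unique n {D′ j} (alt-precompose n {λ S → D (δ j ◂ S)} (linear-insert-0 j) (rest (δ j))) (λ i k → R i (punchIn j k)) ⟩
    minor j * D′ j δ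
      ≡⟨ cong (minor j *_) (ext (◂-cong (λ _ → refl) (insert-0-δ j))) ⟩
    minor j * D (δ j ◂ δ ∘ punchIn j)
      ≡⟨ cong (minor j *_) (move-to-front n alt δ j) ⟩
    minor j * (signℤ (toℕ j) * D δ) ∎
  term : ∀ j → M fzero j * D (δ j ◂ R) ≡ signℤ (toℕ j) * M fzero j * minor j * D δ
  term j = trans (cong (M fzero j *_) (cofactor j)) (rearr (M fzero j) (minor j) (signℤ (toℕ j)) (D δ))

infixl 7 _⊗_
_⊗_ : ∀ {l m n} → Matrix l m → Matrix m n → Matrix l n
_⊗_ {m = m} A B i j = ∑[ k < m ] (A i k * B k j)

linear-⊗ : ∀ {m n} (B : Matrix m n) → IsLinear {m} {n} (λ v j → ∑[ k < m ] (v k * B k j))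
linear-⊗ B = record
  { L-cong = λ e j → sum-cong-≗ λ k → cong (_* B k j) (e k)
  ; L-lin  = λ u c v j → trans (sum-cong-≗ λ k → distr (u k) c (v k) (B k j))
                               (∑-lin (λ k → u k * B k j) (λ k → v k * B k j) c)
  }
  where
  distr : ∀ u c v b → (u + c * v) * b ≡ u * b + c * (v * b)
  distr = solve-∀

-- As a function of `A` the left side is an alternating form, and its value at the identity is
-- `detℤ n B`.
det-⊗ : ∀ n (A B : Matrix n n) → detℤ n (A ⊗ B) ≡ detℤ n A * detℤ n B
det-⊗ n A B = trans (det-unique n (alt-precompose n (linear-⊗ B) (det-alternating n)) A)
                    (cong (detℤ n A *_) (det-cong n (λ i j → ∑-δˡ i (λ k → B k j))))

-- Row operations and rank-one updates

scale-rows : ∀ {m} n {E : Matrix n m → ℤ} → Alternating n E → ∀ a R → E (λ i j → a * R i j) ≡ a ^ n * E R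
scale-rows zero    {E} (ext , _) a R = trans (ext (λ ())) (sym (ℤ.*-identityˡ (E R)))
scale-rows (suc n) {E} alt a R = begin
  E (λ i j → a * R i j)                                    ≡⟨ ext (◂-η _) ⟩
  E ((λ j → a * R fzero j) ◂ (λ i j → a * R (fsuc i) j))   ≡⟨ scale-head a (R fzero) _ ⟩
  a * E (R fzero ◂ (λ i j → a * R (fsuc i) j))             ≡⟨ cong (a *_) (scale-rows n (rest (R fzero)) a (R ∘ fsuc)) ⟩
  a * (a ^ n * E (R fzero ◂ R ∘ fsuc))                     ≡⟨ cong (λ z → a * (a ^ n * z)) (ext (◂-η R)) ⟨
  a * (a ^ n * E R)                                        ≡⟨ ℤ.*-assoc a (a ^ n) (E R) ⟨
  a * a ^ n * E R                                          ∎
  where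
  open ≡-Reasoning
  open Alt alt

kills-zero : ∀ {m} n {E : Matrix n m → ℤ} → Alternating n E → Kills E (λ _ → + 0)
kills-zero (suc n) alt R fzero    e = trans (Alt.ext alt (◂-η R)) (trans (Alt.ext-head alt _ e) (Alt.zero-head alt _))
kills-zero (suc n) alt R (fsuc k) e =
  trans (Alt.ext alt (◂-η R)) (kills-zero n (Alt.rest alt (R fzero)) (R ∘ fsuc) k e)

kills-+ : ∀ {m} n {E : Matrix n m → ℤ} → Alternating n E → ∀ {x y} c → Kills E x → Kills E y →
          Kills E (λ j → y j + c * x j)
kills-+ n {E} alt {x} {y} c kx ky R k e =
  -- The coefficients `- c * δ k i` alter row k alone and turn it into `y`.
  trans (sym (add-killed n alt kx R (λ i → - c * δ k i)))
        (ky _ k λ j → trans (cong₂ (λ a b → a + - c * b * x j) (e j) (δ-refl k)) (cancel (y j) c (x j)))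
  where
  cancel : ∀ y c x → y + c * x + - c * + 1 * x ≡ y
  cancel = solve-∀

dependent-rows : ∀ {m n k} {E : Matrix (suc n) m → ℤ} → Alternating (suc n) E →
                 ∀ R (c : Fin k → ℤ) (τ : Fin k → Fin n) →
                 (∀ j → R fzero j ≡ ∑[ t < k ] (c t * R (fsuc (τ t)) j)) → E R ≡ + 0
dependent-rows {k = k} {E} alt R c τ e = begin
  E R                                                               ≡⟨ ext (◂-η R) ⟩
  E (R fzero ◂ R ∘ fsuc)                                            ≡⟨ ext-head (R ∘ fsuc) e ⟩
  E ((λ j → ∑[ t < k ] (c t * R (fsuc (τ t)) j)) ◂ R ∘ fsuc)        ≡⟨ sum-head c (R ∘ fsuc ∘ τ) (R ∘ fsuc) ⟩
  ∑[ t < k ] (c t * E (R (fsuc (τ t)) ◂ R ∘ fsuc))                  ≡⟨ ∑-zero (λ t → trans (cong (c t *_) (repeated-head alt _ (R ∘ fsuc) (τ t) (λ _ → refl))) (ℤ.*-zeroʳ (c t))) ⟩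
  + 0                                                               ∎
  where
  open ≡-Reasoning
  open Alt alt

-- (y ◂ R) (inject₁ i) is the row preceding row i, with y standing before the first one.
subtract-preceding : ∀ {m} n {E : Matrix n m → ℤ} → Alternating n E → ∀ {y} → Kills E y → ∀ t R Q →
                     (∀ i j → R i j ≡ Q i j + t * (y ◂ R) (inject₁ i) j) → E R ≡ E Q
subtract-preceding zero    (ext , _) kills t R Q e = ext (λ ())
subtract-preceding (suc n) {E} alt {y} kills t R Q e = begin
  E R                                                 ≡⟨ ext (◂-η R) ⟩
  -- The later rows are reduced while the first row is still unchanged: fixed in front, it is the
  -- killed vector for them. The first row itself is reduced last, by means of `y`.
  E (R fzero ◂ R ∘ fsuc)                              ≡⟨ subtract-preceding n (rest (R fzero)) (λ S k → repeated-head alt (R fzero) S k) t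
                                                           (R ∘ fsuc) (Q ∘ fsuc) (λ i j → trans (e (fsuc i) j) (cong (λ z → Q (fsuc i) j + t * z) (◂-η R (inject₁ i) j))) ⟩
  E (R fzero ◂ Q ∘ fsuc)                              ≡⟨ ext-head (Q ∘ fsuc) (e fzero) ⟩
  E ((λ j → Q fzero j + t * y j) ◂ Q ∘ fsuc)          ≡⟨ lin (Q fzero) t y (Q ∘ fsuc) ⟩
  E (Q fzero ◂ Q ∘ fsuc) + t * E (y ◂ Q ∘ fsuc)       ≡⟨ cong₂ (λ a b → a + t * b) (ext (◂-η Q)) (sym (kills (y ◂ Q ∘ fsuc) fzero (λ _ → refl))) ⟨
  E Q + t * + 0                                       ≡⟨ drop (E Q) t ⟩
  E Q                                                 ∎
  where
  open ≡-Reasoning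
  open Alt alt
  drop : ∀ x c → x + c * + 0 ≡ x
  drop = solve-∀

-- The matrix determinant lemma for an alternating form. The factor `a` on the left avoids the
-- exponent n - 1. The killed vector `y` is there for the induction: once the first row x₀ of `x` is
-- fixed, its share in `z` joins the killed part, as `y + c₀ x₀`.
rank-one-update : ∀ {m} n {E : Matrix n m → ℤ} → Alternating n E → ∀ {y} → Kills E y →
                  ∀ (x : Matrix n m) a (w c : Fin n → ℤ) (z : Vector ℤ m) →
                  (∀ j → z j ≡ y j + ∑[ i < n ] (c i * x i j)) →
                  a * E (λ i j → a * x i j + w i * z j) ≡ a ^ n * (a + ∑[ i < n ] (w i * c i)) * E x
rank-one-update zero    {E} (ext , _) kills x a w c z e =
  trans (cong (a *_) (ext (λ ()))) (simp a (E x))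
  where
  simp : ∀ a e → a * e ≡ + 1 * (a + + 0) * e
  simp = solve-∀
rank-one-update (suc n) {E} alt {y} kills x a w c z e = begin
  a * E (λ i j → a * x i j + w i * z j)           ≡⟨ cong (a *_) (trans (ext (◂-η _)) (lin _ w₀ z R)) ⟩
  a * (E ((λ j → a * x₀ j) ◂ R) + w₀ * E (z ◂ R)) ≡⟨ cong₂ (λ s t → a * (s + w₀ * t)) (scale-head a x₀ R) E-z ⟩
  a * (a * E (x₀ ◂ R) + w₀ * (a ^ n * (c₀ * E x))) ≡⟨ rearr a (E (x₀ ◂ R)) w₀ (a ^ n * (c₀ * E x)) ⟩
  a * (a * E (x₀ ◂ R)) + a * (w₀ * (a ^ n * (c₀ * E x))) ≡⟨ cong (λ s → a * s + a * (w₀ * (a ^ n * (c₀ * E x)))) E-x₀ ⟩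
  a * (a ^ n * (a + S) * E x) + a * (w₀ * (a ^ n * (c₀ * E x))) ≡⟨ collect a (a ^ n) S (E x) w₀ c₀ ⟩
  a * a ^ n * (a + (w₀ * c₀ + S)) * E x           ∎
  where
  open ≡-Reasoning
  open Alt alt
  x₀ : Vector ℤ _
  x₀ = x fzero
  x′ : Matrix n _
  x′ = x ∘ fsuc
  w₀ = w fzero
  c₀ = c fzero
  R : Matrix n _
  R i j = a * x (fsuc i) j + w (fsuc i) * z j
  S = ∑[ i < n ] (w (fsuc i) * c (fsuc i))
  rearr : ∀ a p w q → a * (a * p + w * q) ≡ a * (a * p) + a * (w * q)
  rearr = solve-∀
  collect : ∀ a an s e w c → a * (an * (a + s) * e) + a * (w * (an * (c * e))) ≡ a * an * (a + (w * c + s)) * e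
  collect = solve-∀
  regroup : ∀ y p q → y + (p + q) ≡ y + p + q
  regroup = solve-∀
  e′ : ∀ j → z j ≡ (y j + c₀ * x₀ j) + ∑[ i < n ] (c (fsuc i) * x (fsuc i) j)
  e′ j = trans (e j) (regroup (y j) (c₀ * x₀ j) _)
  E-x₀ : a * E (x₀ ◂ R) ≡ a ^ n * (a + S) * E x
  E-x₀ = trans
    (rank-one-update n (rest x₀)
       (kills-+ n (rest x₀) c₀ (λ T k → repeated-head alt x₀ T k) (kills-rest x₀ kills))
       x′ a (w ∘ fsuc) (c ∘ fsuc) z e′)
    (cong (a ^ n * (a + S) *_) (sym (ext (◂-η x))))
  simp : ∀ c p → + 0 + c * p + + 1 * + 0 ≡ c * p
  simp = solve-∀
  -- With `z` in front the multiples of `z` in the other rows drop out, and then only the part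
  -- `c₀ * x₀` of `z` itself contributes.
  E-z : E (z ◂ R) ≡ a ^ n * (c₀ * E x)
  E-z = begin
    E (z ◂ R)                         ≡⟨ add-killed n (rest z) (λ T k → repeated-head alt z T k) (λ i j → a * x′ i j) (w ∘ fsuc) ⟩
    E (z ◂ (λ i j → a * x′ i j))      ≡⟨ scale-rows n (rest z) a x′ ⟩
    a ^ n * E (z ◂ x′)                ≡⟨ cong (a ^ n *_) (begin
      E (z ◂ x′)
        ≡⟨ ext-head x′ (λ j → trans (e′ j) (cong (_+_ (y j + c₀ * x₀ j)) (sym (ℤ.*-identityˡ _)))) ⟩
      E ((λ j → (y j + c₀ * x₀ j) + + 1 * ∑[ i < n ] (c (fsuc i) * x (fsuc i) j)) ◂ x′)
        ≡⟨ lin (λ j → y j + c₀ * x₀ j) (+ 1) (λ j → ∑[ i < n ] (c (fsuc i) * x (fsuc i) j)) x′ ⟩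
      E ((λ j → y j + c₀ * x₀ j) ◂ x′) + + 1 * E ((λ j → ∑[ i < n ] (c (fsuc i) * x (fsuc i) j)) ◂ x′)
        ≡⟨ cong₂ (λ p q → p + + 1 * q) (lin y c₀ x₀ x′) (dependent-rows alt (_ ◂ x′) (c ∘ fsuc) (λ i → i) (λ j → refl)) ⟩
      E (y ◂ x′) + c₀ * E (x₀ ◂ x′) + + 1 * + 0
        ≡⟨ cong₂ (λ p q → p + c₀ * q + + 1 * + 0) (kills (y ◂ x′) fzero (λ _ → refl)) (sym (ext (◂-η x))) ⟩
      + 0 + c₀ * E x + + 1 * + 0
        ≡⟨ simp c₀ (E x) ⟩
      c₀ * E x ∎) ⟩
    a ^ n * (c₀ * E x) ∎

det-rank-one : ∀ n a (w z : Fin n → ℤ) →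
               a * detℤ n (λ i j → a * δ i j + w i * z j) ≡ a ^ n * (a + ∑[ i < n ] (w i * z i))
det-rank-one n a w z = trans
  (rank-one-update n (det-alternating n) (kills-zero n (det-alternating n)) δ a w z z
     (λ j → sym (trans (ℤ.+-identityˡ _) (∑-δ z j))))
  (trans (cong (a ^ n * (a + ∑[ i < n ] (w i * z i)) *_) (det-δ n)) (ℤ.*-identityʳ _))

δ-injective : ∀ {n m} {σ : Fin n → Fin m} → Injective _≡_ _≡_ σ → ∀ i j → δ (σ i) (σ j) ≡ δ i j
δ-injective {σ = σ} inj i j with i Fin.≟ j
... | yes refl = trans (δ-refl (σ i)) (sym (δ-refl i))
... | no  i≢j  = trans (δ-≢ (i≢j ∘ inj)) (sym (δ-≢ i≢j))

-- With P the permutation matrix of σ, the product P Pᵀ is the identity, so the two outer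
-- determinants cancel and the sign of σ never has to be computed.
det-conjugate : ∀ n (A : Matrix n n) (σ : Fin n → Fin n) → Injective _≡_ _≡_ σ →
                detℤ n (λ i j → A (σ i) (σ j)) ≡ detℤ n A
det-conjugate n A σ inj = begin
  detℤ n (λ i j → A (σ i) (σ j))          ≡⟨ det-cong n (λ i j → sym (trans (sum-cong-≗ λ k → cong₂ _*_ (∑-δˡ (σ i) (λ l → A l k)) (δ-sym (σ j) k)) (∑-δ (A (σ i)) (σ j)))) ⟩
  detℤ n (P ⊗ A ⊗ Pᵀ)                     ≡⟨ det-⊗ n (P ⊗ A) Pᵀ ⟩
  detℤ n (P ⊗ A) * detℤ n Pᵀ              ≡⟨ cong (_* detℤ n Pᵀ) (det-⊗ n P A) ⟩
  detℤ n P * detℤ n A * detℤ n Pᵀ         ≡⟨ rearr (detℤ n P) (detℤ n A) (detℤ n Pᵀ) ⟩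
  detℤ n A * (detℤ n P * detℤ n Pᵀ)       ≡⟨ cong (detℤ n A *_) (det-⊗ n P Pᵀ) ⟨
  detℤ n A * detℤ n (P ⊗ Pᵀ)              ≡⟨ cong (detℤ n A *_) (det-cong n λ i j → trans (∑-δˡ (σ i) (δ (σ j))) (δ-injective inj j i)) ⟩
  detℤ n A * detℤ n (λ i j → δ j i)       ≡⟨ cong (detℤ n A *_) (trans (det-cong n (λ i j → δ-sym j i)) (det-δ n)) ⟩
  detℤ n A * + 1                          ≡⟨ ℤ.*-identityʳ (detℤ n A) ⟩
  detℤ n A                                ∎
  where
  open ≡-Reasoning
  P Pᵀ : Matrix n n
  P  i j = δ (σ i) j
  Pᵀ i j = δ (σ j) i
  rearr : ∀ p a q → p * a * q ≡ a * (p * q)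
  rearr = solve-∀

-- A first row supported in the last column; the reversal matrix

laplace-last : ∀ n (M : Matrix (suc n) (suc n)) → (∀ j → M fzero (inject₁ j) ≡ + 0) →
               detℤ (suc n) M ≡ signℤ n * M fzero (fromℕ n) * detℤ n (λ i k → M (fsuc i) (inject₁ k))
laplace-last n M zeros = begin
  sum f                                 ≡⟨ sum-init-last f ⟩
  sum (f ∘ inject₁) + f (fromℕ n)       ≡⟨ cong (_+ f (fromℕ n)) (∑-zero λ j → trans (cong (λ z → signℤ (toℕ (inject₁ j)) * z * minor (inject₁ j)) (zeros j)) (vanish (signℤ (toℕ (inject₁ j))) (minor (inject₁ j)))) ⟩
  + 0 + f (fromℕ n)                     ≡⟨ ℤ.+-identityˡ _ ⟩
  f (fromℕ n)                           ≡⟨ cong₂ (λ k d → signℤ k * M fzero (fromℕ n) * d) (Fin.toℕ-fromℕ n) (det-cong n λ i k → cong (M (fsuc i)) (punchIn-fromℕ n k)) ⟩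
  signℤ n * M fzero (fromℕ n) * detℤ n (λ i k → M (fsuc i) (inject₁ k)) ∎
  where
  open ≡-Reasoning
  minor : Fin (suc n) → ℤ
  minor j = detℤ n (λ i k → M (fsuc i) (punchIn j k))
  f : Fin (suc n) → ℤ
  f j = signℤ (toℕ j) * M fzero j * minor j
  vanish : ∀ s d → s * + 0 * d ≡ + 0
  vanish = solve-∀
  punchIn-fromℕ : ∀ n (k : Fin n) → punchIn (fromℕ n) k ≡ inject₁ k
  punchIn-fromℕ (suc n) fzero    = refl
  punchIn-fromℕ (suc n) (fsuc k) = cong fsuc (punchIn-fromℕ n k)

signℤ-even : ∀ m → signℤ (m ℕ.* 2) ≡ + 1
signℤ-even zero    = refl
signℤ-even (suc m) = trans (ℤ.neg-involutive _) (signℤ-even m)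

antidiagonal : ∀ {n} → Matrix n n
antidiagonal i j = δ i (opposite j)

det-antidiagonal : ∀ m → detℤ (m ℕ.* 2) antidiagonal ≡ signℤ m
det-antidiagonal zero    = refl
det-antidiagonal (suc m) = begin
  detℤ (2 ℕ.+ m ℕ.* 2) antidiagonal                                             ≡⟨ step (suc (m ℕ.* 2)) ⟩
  - signℤ (m ℕ.* 2) * detℤ (suc (m ℕ.* 2)) antidiagonal                         ≡⟨ cong (- signℤ (m ℕ.* 2) *_) (step (m ℕ.* 2)) ⟩
  - signℤ (m ℕ.* 2) * (signℤ (m ℕ.* 2) * detℤ (m ℕ.* 2) antidiagonal)           ≡⟨ cong₂ (λ s d → - s * (s * d)) (signℤ-even m) (det-antidiagonal m) ⟩
  - + 1 * (+ 1 * signℤ m)                                                       ≡⟨ simp (signℤ m) ⟩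
  - signℤ m                                                                     ∎
  where
  open ≡-Reasoning
  simp : ∀ s → - + 1 * (+ 1 * s) ≡ - s
  simp = solve-∀
  opposite-inject₁ : ∀ {n} (k : Fin n) → opposite (inject₁ k) ≡ fsuc (opposite k)
  opposite-inject₁ fzero    = refl
  opposite-inject₁ (fsuc k) = cong inject₁ (opposite-inject₁ k)
  opposite-fromℕ : ∀ n → opposite (fromℕ n) ≡ fzero
  opposite-fromℕ zero    = refl
  opposite-fromℕ (suc n) = cong inject₁ (opposite-fromℕ n)
  step : ∀ n → detℤ (suc n) antidiagonal ≡ signℤ n * detℤ n antidiagonal
  step n = trans (laplace-last n antidiagonal (λ j → cong (δ fzero) (opposite-inject₁ j)))
    (cong₂ _*_ (trans (cong (λ k → signℤ n * δ fzero k) (opposite-fromℕ n)) (ℤ.*-identityʳ (signℤ n)))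
               (det-cong n λ i k → cong (δ (fsuc i)) (opposite-inject₁ k)))

-- Congruences of integers

infix 4 _≡_[mod_]
-- A record, so that `a` and `b` can be inferred from the type; the bare divisibility statement
-- would fix no more than the term `a - b`.
record _≡_[mod_] (a b N : ℤ) : Set where
  constructor modulo
  field ∣-difference : N Div.∣ a - b
open _≡_[mod_] public

mod-refl : ∀ {N a} → a ≡ a [mod N ]
mod-refl {a = a} = modulo (divides (+ 0) (ℤ.+-inverseʳ a))

mod-reflexive : ∀ {N a b} → a ≡ b → a ≡ b [mod N ]
mod-reflexive refl = mod-refl

mod-sym : ∀ {N a b} → a ≡ b [mod N ] → b ≡ a [mod N ]
mod-sym {N} {a} {b} (modulo (divides q e)) =
  modulo (divides (- q) (trans (flip a b) (trans (cong -_ e) (ℤ.neg-distribˡ-* q N))))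
  where
  flip : ∀ a b → b - a ≡ - (a - b)
  flip = solve-∀

mod-trans : ∀ {N a b c} → a ≡ b [mod N ] → b ≡ c [mod N ] → a ≡ c [mod N ]
mod-trans {N} {a} {b} {c} (modulo p) (modulo q) = modulo (subst (N Div.∣_) (telescope a b c) (Div.∣m∣n⇒∣m+n p q))
  where
  telescope : ∀ a b c → (a - b) + (b - c) ≡ a - c
  telescope = solve-∀

mod-+ : ∀ {N a b c d} → a ≡ b [mod N ] → c ≡ d [mod N ] → a + c ≡ b + d [mod N ]
mod-+ {N} {a} {b} {c} {d} (modulo p) (modulo q) = modulo (subst (N Div.∣_) (regroup a b c d) (Div.∣m∣n⇒∣m+n p q))
  where
  regroup : ∀ a b c d → (a - b) + (c - d) ≡ a + c - (b + d)
  regroup = solve-∀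

mod-* : ∀ {N a b c d} → a ≡ b [mod N ] → c ≡ d [mod N ] → a * c ≡ b * d [mod N ]
mod-* {N} {a} {b} {c} {d} (modulo p) (modulo q) =
  modulo (subst (N Div.∣_) (regroup a b c d) (Div.∣m∣n⇒∣m+n (Div.∣m⇒∣m*n c p) (Div.∣n⇒∣m*n b q)))
  where
  regroup : ∀ a b c d → (a - b) * c + b * (c - d) ≡ a * c - b * d
  regroup = solve-∀

mod-^ : ∀ {N a b} n → a ≡ b [mod N ] → a ^ n ≡ b ^ n [mod N ]
mod-^ zero    p = mod-refl
mod-^ (suc n) p = mod-* p (mod-^ n p)

mod-∑ : ∀ {N n} {f g : Fin n → ℤ} → (∀ i → f i ≡ g i [mod N ]) → sum f ≡ sum g [mod N ]
mod-∑ {n = zero}  e = mod-refl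
mod-∑ {n = suc n} e = mod-+ (e fzero) (mod-∑ (e ∘ fsuc))

mod-det : ∀ {N} n {A B : Matrix n n} → (∀ i j → A i j ≡ B i j [mod N ]) → detℤ n A ≡ detℤ n B [mod N ]
mod-det zero    e = mod-refl
mod-det (suc n) e = mod-∑ λ j →
  mod-* (mod-* (mod-refl {a = signℤ (toℕ j)}) (e fzero j)) (mod-det n (λ i k → e (fsuc i) (punchIn j k)))

-- The Legendre symbol

a+b≡0⇒a≡-1*b : ∀ a b → a + b ≡ + 0 → a ≡ - + 1 * b
a+b≡0⇒a≡-1*b a b e = trans (rearr a b) (trans (cong (_+ - + 1 * b) e) (ℤ.+-identityˡ (- + 1 * b)))
  where
  rearr : ∀ a b → a ≡ a + b + - + 1 * b
  rearr = solve-∀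

-- The passage from congruences to equalities, used for residues modulo p, for signs modulo 4, and
-- for integers modulo a number chosen larger than their difference.
mod-small : ∀ {a b N} → ∣ a - b ∣ ℕ.< ∣ N ∣ → a ≡ b [mod N ] → a ≡ b
mod-small {a} {b} {N} small (modulo N∣) with ∣ a - b ∣ in eq | Div.∣⇒∣ᵤ N∣
... | zero  | _  = ℤ.i-j≡0⇒i≡j a b (ℤ.∣i∣≡0⇒i≡0 eq)
... | suc k | d  = ⊥-elim (ℕ.<⇒≱ small (ℕDiv.∣⇒≤ d))

mod-% : ∀ z p .{{_ : ℕ.NonZero p}} → z ≡ + (z %ℕ p) [mod + p ]
mod-% z p = modulo (divides (z /ℕ p) (trans (cong (_- + (z %ℕ p)) (a≡a%ℕn+[a/ℕn]*n z p)) (cancel (+ (z %ℕ p)) ((z /ℕ p) * + p))))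
  where
  cancel : ∀ a b → a + b - a ≡ b
  cancel = solve-∀

∣+-+∣<  : ∀ {a b p} → a ℕ.< p → b ℕ.< p → ∣ + a - + b ∣ ℕ.< p
∣+-+∣< {a} {b} {p} a<p b<p = subst (ℕ._< p) (sym (cong ∣_∣ (ℤ.m-n≡m⊖n a b))) (ℕ.≤-<-trans (ℤ.∣m⊝n∣≤m⊔n a b) (ℕ.⊔-lub a<p b<p))

mod-unique : ∀ {a b p} → a ℕ.< p → b ℕ.< p → + a ≡ + b [mod + p ] → a ≡ b
mod-unique a<p b<p e = ℤ.+-injective (mod-small (∣+-+∣< a<p b<p) e)

mod⇒% : ∀ {a b} p .{{_ : ℕ.NonZero p}} → a ≡ b [mod + p ] → a %ℕ p ≡ b %ℕ p
mod⇒% {a} {b} p e = mod-unique (n%ℕd<d a p) (n%ℕd<d b p) (mod-trans (mod-sym (mod-% a p)) (mod-trans e (mod-% b p)))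

%⇒mod : ∀ {a b} p .{{_ : ℕ.NonZero p}} → a %ℕ p ≡ b %ℕ p → a ≡ b [mod + p ]
%⇒mod {a} {b} p e = mod-trans (mod-% a p) (mod-trans (mod-reflexive (cong +_ e)) (mod-sym (mod-% b p)))

mod? : ∀ a b p .{{_ : ℕ.NonZero p}} → Dec (a ≡ b [mod + p ])
mod? a b p = map′ (%⇒mod p) (mod⇒% p) (a %ℕ p ℕ.≟ b %ℕ p)

mod-weaken : ∀ {a b M} N → M Div.∣ N → a ≡ b [mod N ] → a ≡ b [mod M ]
mod-weaken N d (modulo e) = modulo (Div.∣-trans d e)

mod-neg : ∀ {N a b} → a ≡ b [mod N ] → - a ≡ - b [mod N ]
mod-neg {N} {a} {b} e = subst₂ (_≡_[mod N ]) (ℤ.-1*i≡-i a) (ℤ.-1*i≡-i b) (mod-* (mod-refl {a = - + 1}) e)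

mod-swap : ∀ {N} a b c → a + b ≡ c [mod N ] → a ≡ c - b [mod N ]
mod-swap {N} a b c e = subst (λ x → x ≡ c - b [mod N ]) (cancel a b) (mod-+ e (mod-refl {a = - b}))
  where
  cancel : ∀ a b → a + b - b ≡ a
  cancel = solve-∀

Periodic : ∀ {A : Set} → ℤ → (ℤ → A) → Set
Periodic N f = ∀ {a b} → a ≡ b [mod N ] → f a ≡ f b

∑-1 : ∀ n → ∑[ i < n ] (+ 1) ≡ + n
∑-1 zero    = refl
∑-1 (suc n) = cong (_+_ (+ 1)) (∑-1 n)

∑-nonneg : ∀ {n} (f : Fin n → ℤ) → (∀ i → + 0 ℤ.≤ f i) → + 0 ℤ.≤ sum f
∑-nonneg {zero}  f nn = ℤ.≤-refl
∑-nonneg {suc n} f nn = ℤ.+-mono-≤ (nn fzero) (∑-nonneg (f ∘ fsuc) (nn ∘ fsuc))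

∑≡0⇒≡0 : ∀ {n} (f : Fin n → ℤ) → (∀ i → + 0 ℤ.≤ f i) → sum f ≡ + 0 → ∀ i → f i ≡ + 0
∑≡0⇒≡0 {suc n} f nn e = λ
  { fzero    → head≡0
  ; (fsuc i) → ∑≡0⇒≡0 (f ∘ fsuc) (nn ∘ fsuc)
                 (trans (sym (ℤ.+-identityˡ _)) (trans (cong (_+ sum (f ∘ fsuc)) (sym head≡0)) e)) i }
  where
  head≡0 : f fzero ≡ + 0
  head≡0 = ℤ.≤-antisym (subst₂ ℤ._≤_ (ℤ.+-identityʳ _) e (ℤ.+-monoʳ-≤ (f fzero) (∑-nonneg (f ∘ fsuc) (nn ∘ fsuc)))) (nn fzero)

-- Prepares the pairing of s with -s in the computation of `ε`.
∑-centred : ∀ m (g : ℤ → ℤ) →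
            ∑[ t < suc (m ℕ.* 2) ] g (+ toℕ t - + m) ≡ g (+ 0) + ∑[ t < m ] (g (+ suc (toℕ t)) + g (- + suc (toℕ t)))
∑-centred zero    g = refl
∑-centred (suc m) g = begin
  g (+ 0 - + suc m) + sum h
    ≡⟨ cong (_+_ (g (+ 0 - + suc m))) (sum-init-last h) ⟩
  g (+ 0 - + suc m) + (sum (h ∘ inject₁) + h (fromℕ (suc (m ℕ.* 2))))
    ≡⟨ cong₂ (λ a b → g a + b) (ℤ.+-identityˡ (- + suc m)) (cong₂ _+_ (sum-cong-≗ inner) last) ⟩
  g (- + suc m) + (∑[ t < suc (m ℕ.* 2) ] g (+ toℕ t - + m) + g (+ suc m))
    ≡⟨ cong (λ z → g (- + suc m) + (z + g (+ suc m))) (∑-centred m g) ⟩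
  g (- + suc m) + ((g (+ 0) + ∑[ t < m ] pair (toℕ t)) + g (+ suc m))
    ≡⟨ regroup (g (- + suc m)) (g (+ 0)) (∑[ t < m ] pair (toℕ t)) (g (+ suc m)) ⟩
  g (+ 0) + (∑[ t < m ] pair (toℕ t) + pair m)
    ≡⟨ cong₂ (λ a b → g (+ 0) + (a + b)) (sum-cong-≗ {m} (λ t → cong pair (Fin.toℕ-inject₁ t))) (cong pair (Fin.toℕ-fromℕ m)) ⟨
  g (+ 0) + (∑[ t < m ] pair (toℕ (inject₁ t)) + pair (toℕ (fromℕ m)))
    ≡⟨ cong (_+_ (g (+ 0))) (sum-init-last {m} (pair ∘ toℕ)) ⟨
  g (+ 0) + ∑[ t < suc m ] pair (toℕ t) ∎
  where
  open ≡-Reasoning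
  pair : ℕ → ℤ
  pair t = g (+ suc t) + g (- + suc t)
  h : Fin (2 ℕ.+ m ℕ.* 2) → ℤ
  h t = g (+ suc (toℕ t) - + suc m)
  regroup : ∀ a b c d → a + ((b + c) + d) ≡ b + (c + (d + a))
  regroup = solve-∀
  shift : ∀ t → + suc t - + suc m ≡ + t - + m
  shift t = trans (cong₂ _-_ (ℤ.pos-+ 1 t) (ℤ.pos-+ 1 m)) (cancel (+ t) (+ m))
    where
    cancel : ∀ a b → (+ 1 + a) - (+ 1 + b) ≡ a - b
    cancel = solve-∀
  inner : ∀ t → h (inject₁ t) ≡ g (+ toℕ t - + m)
  inner t = cong g (trans (cong (λ k → + suc k - + suc m) (Fin.toℕ-inject₁ t)) (shift (toℕ t)))
  last : h (fromℕ (suc (m ℕ.* 2))) ≡ g (+ suc m)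
  last = cong g (trans (cong (λ k → + suc k - + suc m) (Fin.toℕ-fromℕ (suc (m ℕ.* 2))))
    (trans (cong (λ z → + 2 + z - + suc m) (ℤ.pos-* m 2)) (trans (cong (λ z → + 2 + + m * + 2 - z) (ℤ.pos-+ 1 m)) (cancel (+ m)))))
    where
    cancel : ∀ a → + 2 + a * + 2 - (+ 1 + a) ≡ + 1 + a
    cancel = solve-∀

legendreOf : (p : ℕ) .{{_ : ℕ.NonZero p}} → ℕ → ℤ
legendreOf p zero      = + 0
legendreOf p r@(suc _) = if any (λ y → ⌊ (y ℕ.* y) % p ℕ.≟ r ⌋) (upTo p) then + 1 else - + 1

legendre-% : ∀ a p .{{_ : ℕ.NonZero p}} → legendre a p ≡ legendreOf p (a % p)
legendre-% a (suc k) with a % suc k in eq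
... | zero  = refl
... | suc r = cong (λ s → if any (λ y → ⌊ (y ℕ.* y) % suc k ℕ.≟ s ⌋) (upTo (suc k)) then + 1 else - + 1) eq

-- Replaces the Boolean search by the defining property of each value; the theory of χ is developed
-- from this view.
data LegendreView (p : ℕ) (z : ℤ) : ℤ → Set where
  null       : z ≡ + 0 [mod + p ] → LegendreView p z (+ 0)
  residue    : ¬ z ≡ + 0 [mod + p ] → ∀ y → z ≡ y * y [mod + p ] → LegendreView p z (+ 1)
  nonresidue : ¬ z ≡ + 0 [mod + p ] → (∀ y → ¬ z ≡ y * y [mod + p ]) → LegendreView p z (- + 1)

legendre-view : ∀ p .{{_ : ℕ.NonZero p}} z → LegendreView p z (legendreOf p (z %ℕ p))
legendre-view p z with z %ℕ p in eq
... | zero = null (mod-trans (mod-% z p) (mod-reflexive (cong +_ eq)))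
... | suc r with any (λ y → ⌊ (y ℕ.* y) % p ℕ.≟ suc r ⌋) (upTo p) in found
...   | true  = residue nz (+ y) (mod-trans z≡r (mod-sym (mod-trans (mod-reflexive (sym (ℤ.pos-* y y)))
                  (mod-trans (mod-% (+ (y ℕ.* y)) p) (mod-reflexive (cong +_ y²≡r))))))
  where
  z≡r : z ≡ + suc r [mod + p ]
  z≡r = mod-trans (mod-% z p) (mod-reflexive (cong +_ eq))
  nz : ¬ z ≡ + 0 [mod + p ]
  nz z≡0 = ℕ.1+n≢0 (trans (sym eq) (mod-unique (n%ℕd<d z p) (ℕ.>-nonZero⁻¹ p) (mod-trans (mod-sym (mod-% z p)) z≡0)))
  witness = find (any⁻ (λ y → ⌊ (y ℕ.* y) % p ℕ.≟ suc r ⌋) (upTo p) (subst T (sym found) tt))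
  y = proj₁ witness
  y²≡r : (y ℕ.* y) % p ≡ suc r
  y²≡r = toWitness (proj₂ (proj₂ witness))
...   | false = nonresidue nz none
  where
  z≡r : z ≡ + suc r [mod + p ]
  z≡r = mod-trans (mod-% z p) (mod-reflexive (cong +_ eq))
  nz : ¬ z ≡ + 0 [mod + p ]
  nz z≡0 = ℕ.1+n≢0 (trans (sym eq) (mod-unique (n%ℕd<d z p) (ℕ.>-nonZero⁻¹ p) (mod-trans (mod-sym (mod-% z p)) z≡0)))
  none : ∀ Y → ¬ z ≡ Y * Y [mod + p ]
  none Y z≡Y² = subst T found (any⁺ _ (lose (∈-upTo⁺ (n%ℕd<d Y p)) (fromWitness (trans (mod⇒% p y²≡z) eq))))
    where
    y = Y %ℕ p
    y²≡z : + (y ℕ.* y) ≡ z [mod + p ]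
    y²≡z = mod-trans (mod-reflexive (ℤ.pos-* y y)) (mod-sym (mod-trans z≡Y² (mod-* (mod-% Y p) (mod-% Y p))))

x²≡1⇒±1 : ∀ x → x * x ≡ + 1 → x ≡ + 1 ⊎ x ≡ - + 1
x²≡1⇒±1 x e = from (ℤ.i*j≡0⇒i≡0∨j≡0 (x - + 1) (trans (factor x) (cong (_- + 1) e)))
  where
  factor : ∀ x → (x - + 1) * (x + + 1) ≡ x * x - + 1
  factor = solve-∀
  cancel : ∀ x → x ≡ x + + 1 - + 1
  cancel = solve-∀
  from : x - + 1 ≡ + 0 ⊎ x + + 1 ≡ + 0 → x ≡ + 1 ⊎ x ≡ - + 1
  from (inj₁ z) = inj₁ (ℤ.i-j≡0⇒i≡j x (+ 1) z)
  from (inj₂ z) = inj₂ (trans (cancel x) (cong (_- + 1) z))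

signℤ² : ∀ k → signℤ k * signℤ k ≡ + 1
signℤ² zero    = refl
signℤ² (suc k) = trans (neg-square (signℤ k)) (signℤ² k)
  where
  neg-square : ∀ s → - s * - s ≡ s * s
  neg-square = solve-∀

±1-unique-mod-4 : ∀ {a b} → a * a ≡ + 1 → b * b ≡ + 1 → a ≡ b [mod + 4 ] → a ≡ b
±1-unique-mod-4 {a} {b} ea eb e = mod-small (small (x²≡1⇒±1 a ea) (x²≡1⇒±1 b eb)) e
  where
  small : a ≡ + 1 ⊎ a ≡ - + 1 → b ≡ + 1 ⊎ b ≡ - + 1 → ∣ a - b ∣ ℕ.< 4
  small (inj₁ refl) (inj₁ refl) = s≤s z≤n
  small (inj₁ refl) (inj₂ refl) = s≤s (s≤s (s≤s z≤n))
  small (inj₂ refl) (inj₁ refl) = s≤s (s≤s (s≤s z≤n))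
  small (inj₂ refl) (inj₂ refl) = s≤s z≤n

2x≡2-mod-4 : ∀ {x} → x * x ≡ + 1 → x + x ≡ + 2 [mod + 4 ]
2x≡2-mod-4 {x} e = from (x²≡1⇒±1 x e)
  where
  from : x ≡ + 1 ⊎ x ≡ - + 1 → x + x ≡ + 2 [mod + 4 ]
  from (inj₁ refl) = mod-refl
  from (inj₂ refl) = modulo (divides (- + 1) refl)

-- The sum is congruent to 2k, which is 0 or 2 modulo 4 according to the parity of k.
∑-2-mod-4 : ∀ k (h : ℕ → ℤ) → (∀ t → t ℕ.< k → h t ≡ + 2 [mod + 4 ]) →
            ∑[ t < k ] h (toℕ t) ≡ + 1 - signℤ k [mod + 4 ]
∑-2-mod-4 zero    h e = mod-refl
∑-2-mod-4 (suc k) h e = mod-trans (mod-+ (e 0 ℕ.z<s) (∑-2-mod-4 k (h ∘ suc) (λ t t<k → e (suc t) (s≤s t<k)))) (flip (x²≡1⇒±1 (signℤ k) (signℤ² k)))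
  where
  flip : ∀ {s} → s ≡ + 1 ⊎ s ≡ - + 1 → + 2 + (+ 1 - s) ≡ + 1 - - s [mod + 4 ]
  flip (inj₁ refl) = mod-refl
  flip (inj₂ refl) = modulo (divides (+ 1) refl)

module LegendreSymbol (m : ℕ) (prime : Prime (suc (m ℕ.* 2))) where

  p : ℕ
  p = suc (m ℕ.* 2)

  χ : ℤ → ℤ
  χ z = legendreOf p (z %ℕ p)

  χ-periodic : Periodic (+ p) χ
  χ-periodic e = cong (legendreOf p) (mod⇒% p e)

  view : ∀ z → LegendreView p z (χ z)
  view = legendre-view p

  legendre≡χ : ∀ a → legendre a p ≡ χ (+ a)
  legendre≡χ a = legendre-% a p

  res : ℤ → Fin p
  res z = Fin.fromℕ< (n%ℕd<d z p)

  toℕ-res : ∀ z → + toℕ (res z) ≡ z [mod + p ]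
  toℕ-res z = mod-trans (mod-reflexive (cong +_ (Fin.toℕ-fromℕ< (n%ℕd<d z p)))) (mod-sym (mod-% z p))

  res-cong : ∀ {a b} → a ≡ b [mod + p ] → res a ≡ res b
  res-cong {a} {b} e = Fin.fromℕ<-cong _ _ (mod⇒% p e) (n%ℕd<d a p) (n%ℕd<d b p)

  res-toℕ : ∀ t → res (+ toℕ t) ≡ t
  res-toℕ t = Fin.toℕ-injective (mod-unique (Fin.toℕ<n (res (+ toℕ t))) (Fin.toℕ<n t) (toℕ-res (+ toℕ t)))

  ∑ₚ : (ℤ → ℤ) → ℤ
  ∑ₚ f = ∑[ t < p ] f (+ toℕ t)

  ∑ₚ-reindex : ∀ {f} → Periodic (+ p) f → (π π⁻¹ : ℤ → ℤ) →
               (∀ {a b} → a ≡ b [mod + p ] → π a ≡ π b [mod + p ]) →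
               (∀ {a b} → a ≡ b [mod + p ] → π⁻¹ a ≡ π⁻¹ b [mod + p ]) →
               (∀ a → π (π⁻¹ a) ≡ a [mod + p ]) → (∀ a → π⁻¹ (π a) ≡ a [mod + p ]) →
               ∑ₚ (f ∘ π) ≡ ∑ₚ f
  ∑ₚ-reindex {f} per π π⁻¹ π-cong π⁻¹-cong inv₁ inv₂ = sym (trans
    (sum-permute (f ∘ +_ ∘ toℕ) (permutation to from
      (λ t → inverse π π⁻¹ π-cong inv₁ t) (λ t → inverse π⁻¹ π π⁻¹-cong inv₂ t)))
    (sum-cong-≗ {p} λ t → per (toℕ-res (π (+ toℕ t)))))
    where
    to from : Fin p → Fin p
    to   t = res (π (+ toℕ t))
    from t = res (π⁻¹ (+ toℕ t))
    inverse : ∀ (π π⁻¹ : ℤ → ℤ) → (∀ {a b} → a ≡ b [mod + p ] → π a ≡ π b [mod + p ]) →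
              (∀ a → π (π⁻¹ a) ≡ a [mod + p ]) → ∀ t → res (π (+ toℕ (res (π⁻¹ (+ toℕ t))))) ≡ t
    inverse π π⁻¹ π-cong inv t =
      trans (res-cong (mod-trans (π-cong (toℕ-res (π⁻¹ (+ toℕ t)))) (inv (+ toℕ t)))) (res-toℕ t)

  ∑ₚ-shift : ∀ {f} → Periodic (+ p) f → ∀ c → ∑ₚ (λ t → f (t + c)) ≡ ∑ₚ f
  ∑ₚ-shift per c = ∑ₚ-reindex per (_+ c) (_- c)
    (λ e → mod-+ e mod-refl) (λ e → mod-+ e mod-refl)
    (λ a → mod-reflexive (cancel₁ a c)) (λ a → mod-reflexive (cancel₂ a c))
    where
    cancel₁ : ∀ a c → a - c + c ≡ a
    cancel₁ = solve-∀
    cancel₂ : ∀ a c → a + c - c ≡ a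
    cancel₂ = solve-∀

  inverse : ∀ a → ¬ a ≡ + 0 [mod + p ] → ∃ λ b → a * b ≡ + 1 [mod + p ]
  inverse a a≢0 with a %ℕ p in eq
  ... | zero  = ⊥-elim (a≢0 (mod-trans (mod-% a p) (mod-reflexive (cong +_ eq))))
  ... | suc r with coprime-Bézout (prime⇒coprime {n = suc r} prime (subst (ℕ._< p) eq (n%ℕd<d a p)))
  ...   | Bézout.+- x y e = - + y , mod-trans (mod-* a≡r mod-refl) (modulo (divides (- + x) (trans (rearr (+ suc r) (+ y))
            (trans (cong -_ (trans (cong (_+_ (+ 1)) (sym (ℤ.pos-* y (suc r)))) (trans (sym (ℤ.pos-+ 1 (y ℕ.* suc r))) (trans (cong +_ e) (ℤ.pos-* x p)))))
                   (ℤ.neg-distribˡ-* (+ x) (+ p))))))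
    where
    a≡r : a ≡ + suc r [mod + p ]
    a≡r = mod-trans (mod-% a p) (mod-reflexive (cong +_ eq))
    rearr : ∀ r y → r * - y - + 1 ≡ - (+ 1 + y * r)
    rearr = solve-∀
  ...   | Bézout.-+ x y e = + y , mod-trans (mod-* a≡r mod-refl) (modulo (divides (+ x) (trans (cong (_- + 1)
            (trans (ℤ.*-comm (+ suc r) (+ y)) (trans (sym (ℤ.pos-* y (suc r))) (trans (cong +_ (sym e)) (trans (ℤ.pos-+ 1 (x ℕ.* p)) (cong (_+_ (+ 1)) (ℤ.pos-* x p)))))))
            (cancel (+ x * + p)))))
    where
    a≡r : a ≡ + suc r [mod + p ]
    a≡r = mod-trans (mod-% a p) (mod-reflexive (cong +_ eq))
    cancel : ∀ x → + 1 + x - + 1 ≡ x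
    cancel = solve-∀

  cancelˡ : ∀ a {b c} → ¬ a ≡ + 0 [mod + p ] → a * b ≡ a * c [mod + p ] → b ≡ c [mod + p ]
  cancelˡ a {b} {c} a≢0 e with inverse a a≢0
  ... | a⁻¹ , inv = mod-trans (mod-sym (unit b)) (mod-trans (mod-* (mod-refl {a = a⁻¹}) e) (unit c))
    where
    rearr : ∀ a b x → b * (a * x) ≡ a * b * x
    rearr = solve-∀
    unit : ∀ x → a⁻¹ * (a * x) ≡ x [mod + p ]
    unit x = mod-trans (mod-reflexive (rearr a a⁻¹ x)) (mod-trans (mod-* inv mod-refl) (mod-reflexive (ℤ.*-identityˡ x)))

  product-≢0 : ∀ {a b} → ¬ a ≡ + 0 [mod + p ] → ¬ b ≡ + 0 [mod + p ] → ¬ a * b ≡ + 0 [mod + p ]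
  product-≢0 {a} a≢0 b≢0 e = b≢0 (cancelˡ a a≢0 (mod-trans e (mod-reflexive (sym (ℤ.*-zeroʳ a)))))

  ∑ₚ-scale : ∀ {f} → Periodic (+ p) f → ∀ a → ¬ a ≡ + 0 [mod + p ] → ∑ₚ (λ t → f (a * t)) ≡ ∑ₚ f
  ∑ₚ-scale per a a≢0 with inverse a a≢0
  ... | a⁻¹ , inv = ∑ₚ-reindex per (a *_) (a⁻¹ *_) (mod-* (mod-refl {a = a})) (mod-* (mod-refl {a = a⁻¹}))
    (λ x → mod-trans (mod-reflexive (sym (ℤ.*-assoc a a⁻¹ x))) (unit x))
    (λ x → mod-trans (mod-reflexive (rearr a a⁻¹ x)) (unit x))
    where
    rearr : ∀ a b x → b * (a * x) ≡ a * b * x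
    rearr = solve-∀
    unit : ∀ x → a * a⁻¹ * x ≡ x [mod + p ]
    unit x = mod-trans (mod-* inv mod-refl) (mod-reflexive (ℤ.*-identityˡ x))

  p≢1 : ¬ p ≡ 1
  p≢1 e = ¬prime[1] (subst Prime e prime)

  m≢0 : ¬ m ≡ 0
  m≢0 e = p≢1 (cong (λ k → suc (k ℕ.* 2)) e)

  small-≢0 : ∀ {a} → a ℕ.< p → ¬ a ≡ 0 → ¬ + a ≡ + 0 [mod + p ]
  small-≢0 a<p a≢0 e = a≢0 (mod-unique a<p ℕ.z<s e)

  1<p : 1 ℕ.< p
  1<p = ℕ.≤∧≢⇒< ℕ.z<s (p≢1 ∘ sym)

  1≢0 : ¬ + 1 ≡ + 0 [mod + p ]
  1≢0 = small-≢0 1<p (λ ())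

  -- Here p being odd enters: 2 is invertible. As a consequence a nonzero residue has two distinct
  -- square roots w and -w or none.
  double-≢0 : ∀ {a} → ¬ a ≡ + 0 [mod + p ] → ¬ a ≡ - a [mod + p ]
  double-≢0 {a} a≢0 e = product-≢0 2≢0 a≢0 (mod-trans (mod-reflexive (double a)) (mod-trans (mod-+ e mod-refl) (mod-reflexive (ℤ.+-inverseˡ a))))
    where
    double : ∀ a → + 2 * a ≡ a + a
    double = solve-∀
    2≢0 : ¬ + 2 ≡ + 0 [mod + p ]
    2≢0 = small-≢0 2<p (λ ())
      where
      2<p : 2 ℕ.< p
      2<p = s≤s (ℕ.*-monoˡ-≤ 2 (ℕ.n≢0⇒n>0 m≢0))

  χ-0 : ∀ {a} → a ≡ + 0 [mod + p ] → χ a ≡ + 0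
  χ-0 {a} e with χ a | view a
  ... | _ | null _          = refl
  ... | _ | residue n _ _   = ⊥-elim (n e)
  ... | _ | nonresidue n _  = ⊥-elim (n e)

  χ-square : ∀ {a} y → ¬ a ≡ + 0 [mod + p ] → a ≡ y * y [mod + p ] → χ a ≡ + 1
  χ-square {a} y n e with χ a | view a
  ... | _ | null z           = ⊥-elim (n z)
  ... | _ | residue _ _ _    = refl
  ... | _ | nonresidue _ none = ⊥-elim (none y e)

  χ-nonsquare : ∀ {a} → ¬ a ≡ + 0 [mod + p ] → (∀ y → ¬ a ≡ y * y [mod + p ]) → χ a ≡ - + 1
  χ-nonsquare {a} n none with χ a | view a
  ... | _ | null z           = ⊥-elim (n z)
  ... | _ | residue _ y e    = ⊥-elim (none y e)
  ... | _ | nonresidue _ _   = refl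

  χ-1 : χ (+ 1) ≡ + 1
  χ-1 = χ-square (+ 1) 1≢0 mod-refl

  root-of-square-≢0 : ∀ {a} y → ¬ a ≡ + 0 [mod + p ] → a ≡ y * y [mod + p ] → ¬ y ≡ + 0 [mod + p ]
  root-of-square-≢0 y n e z = n (mod-trans e (mod-* z z))

  χ-square-* : ∀ y b → ¬ y ≡ + 0 [mod + p ] → χ (y * y * b) ≡ χ b
  χ-square-* y b y≢0 with χ b | view b
  ... | _ | null z = χ-0 (mod-trans (mod-* (mod-refl {a = y * y}) z) (mod-reflexive (ℤ.*-zeroʳ (y * y))))
  ... | _ | residue n w e = χ-square (y * w) (product-≢0 (product-≢0 y≢0 y≢0) n)
                              (mod-trans (mod-* (mod-refl {a = y * y}) e) (mod-reflexive (rearr y w)))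
    where
    rearr : ∀ y w → y * y * (w * w) ≡ (y * w) * (y * w)
    rearr = solve-∀
  ... | _ | nonresidue n none = χ-nonsquare (product-≢0 (product-≢0 y≢0 y≢0) n) none′
    where
    rearr : ∀ y z w → (y * z) * (y * z) * (w * w) ≡ y * y * ((z * w) * (z * w))
    rearr = solve-∀
    none′ : ∀ w → ¬ y * y * b ≡ w * w [mod + p ]
    none′ w e with inverse y y≢0
    -- If `y² b` is the square of w, then b is the square of `z w`, with z inverse to y.
    ... | z , inv = none (z * w) (cancelˡ (y * y) (product-≢0 y≢0 y≢0)
      (mod-trans e (mod-trans (mod-trans (mod-reflexive (sym (ℤ.*-identityˡ (w * w)))) (mod-* (mod-sym (mod-* inv inv)) mod-refl))
        (mod-reflexive (rearr y z w)))))

  square-roots : ∀ x y → x * x ≡ y * y [mod + p ] → x ≡ y [mod + p ] ⊎ x ≡ - y [mod + p ]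
  square-roots x y e = from (mod? (x - y) (+ 0) p)
    where
    cancel : ∀ x y → x - y + y ≡ x
    cancel = solve-∀
    factor : ∀ x y → x * x + - (y * y) ≡ (x - y) * (x + y)
    factor = solve-∀
    zeros : ∀ x y → y * y + - (y * y) ≡ (x - y) * + 0
    zeros = solve-∀
    from : Dec (x - y ≡ + 0 [mod + p ]) → x ≡ y [mod + p ] ⊎ x ≡ - y [mod + p ]
    from (yes z) = inj₁ (subst₂ (_≡_[mod + p ]) (cancel x y) (ℤ.+-identityˡ y) (mod-+ z (mod-refl {a = y})))
    from (no nz) = inj₂ (mod-trans (mod-swap x y (+ 0) (cancelˡ (x - y) nz (subst₂ (_≡_[mod + p ]) (factor x y) (zeros x y) (mod-+ e (mod-refl {a = - (y * y)})))))
                       (mod-reflexive (ℤ.+-identityˡ (- y))))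

  ∑-δ-1 : ∀ (s : Fin p) → ∑[ t < p ] δ s t ≡ + 1
  ∑-δ-1 s = trans (sum-cong-≗ {p} λ t → sym (ℤ.*-identityʳ (δ s t))) (∑-δˡ s (λ _ → + 1))

  δ-res : ∀ a b → a ≡ b [mod + p ] → δ (res a) (res b) ≡ + 1
  δ-res a b e = trans (cong (λ r → δ r (res b)) (res-cong e)) (δ-refl (res b))

  δ-res-≢ : ∀ a b → ¬ a ≡ b [mod + p ] → δ (res a) (res b) ≡ + 0
  δ-res-≢ a b ne = δ-≢ λ e → ne (mod-trans (mod-sym (toℕ-res a)) (mod-trans (mod-reflexive (cong (+_ ∘ toℕ) e)) (toℕ-res b)))

  δ-res-cong : ∀ a b c d → (a ≡ b [mod + p ] → c ≡ d [mod + p ]) → (c ≡ d [mod + p ] → a ≡ b [mod + p ]) →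
               δ (res a) (res b) ≡ δ (res c) (res d)
  δ-res-cong a b c d to from = cases (mod? a b p)
    where
    cases : Dec (a ≡ b [mod + p ]) → δ (res a) (res b) ≡ δ (res c) (res d)
    cases (yes e) = trans (δ-res a b e) (sym (δ-res c d (to e)))
    cases (no ne) = trans (δ-res-≢ a b ne) (sym (δ-res-≢ c d (ne ∘ from)))

  ∑ₚ-δ : ∀ a → ∑ₚ (λ t → δ (res a) (res t)) ≡ + 1
  ∑ₚ-δ a = trans (sum-cong-≗ {p} λ t → cong (δ (res a)) (res-toℕ t)) (∑-δ-1 (res a))

  -- `δ` composed with `res` is the indicator of congruence, so the sum counts the square roots of
  -- a: one, two or none in the three cases of the view.
  count-roots : ∀ a → ∑ₚ (λ y → δ (res (y * y)) (res a)) ≡ + 1 + χ a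
  count-roots a with χ a | view a
  ... | _ | null z = trans (sum-cong-≗ {p} λ t → δ-res-cong (+ toℕ t * + toℕ t) a (+ 0) (+ toℕ t) (to (+ toℕ t)) (from (+ toℕ t)))
                           (∑ₚ-δ (+ 0))
    where
    to : ∀ y → y * y ≡ a [mod + p ] → + 0 ≡ y [mod + p ]
    to y e = cases (mod? y (+ 0) p)
      where
      cases : Dec (y ≡ + 0 [mod + p ]) → + 0 ≡ y [mod + p ]
      cases (yes y≡0) = mod-sym y≡0
      cases (no y≢0)  = ⊥-elim (product-≢0 y≢0 y≢0 (mod-trans e z))
    from : ∀ y → + 0 ≡ y [mod + p ] → y * y ≡ a [mod + p ]
    from y e = mod-trans (mod-sym (mod-* e e)) (mod-sym z)
  ... | _ | nonresidue n none = ∑-zero {p} λ t → δ-res-≢ (+ toℕ t * + toℕ t) a (λ e → none (+ toℕ t) (mod-sym e))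
  ... | _ | residue n w e = trans (sum-cong-≗ {p} λ t → two-roots (+ toℕ t))
            (trans (∑-distrib-+ {p} (λ t → δ (res w) (res (+ toℕ t))) (λ t → δ (res (- w)) (res (+ toℕ t))))
                   (cong₂ _+_ (∑ₚ-δ w) (∑ₚ-δ (- w))))
    where
    w≢0 : ¬ w ≡ + 0 [mod + p ]
    w≢0 = root-of-square-≢0 w n e
    neg-square : ∀ w → - w * - w ≡ w * w
    neg-square = solve-∀
    two-roots : ∀ y → δ (res (y * y)) (res a) ≡ δ (res w) (res y) + δ (res (- w)) (res y)
    two-roots y = cases (mod? w y p) (mod? (- w) y p)
      where
      cases : Dec (w ≡ y [mod + p ]) → Dec (- w ≡ y [mod + p ]) → δ (res (y * y)) (res a) ≡ δ (res w) (res y) + δ (res (- w)) (res y)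
      cases (yes e₁) (yes e₂) = ⊥-elim (double-≢0 w≢0 (mod-trans e₁ (mod-sym e₂)))
      cases (yes e₁) (no n₂) = trans (δ-res (y * y) a (mod-trans (mod-sym (mod-* e₁ e₁)) (mod-sym e)))
                                  (sym (cong₂ _+_ (δ-res w y e₁) (δ-res-≢ (- w) y n₂)))
      cases (no n₁) (yes e₂) = trans (δ-res (y * y) a (mod-trans (mod-sym (mod-* e₂ e₂)) (mod-trans (mod-reflexive (neg-square w)) (mod-sym e))))
                                  (sym (cong₂ _+_ (δ-res-≢ w y n₁) (δ-res (- w) y e₂)))
      cases (no n₁) (no n₂) = trans (δ-res-≢ (y * y) a (λ e′ → neither (square-roots y w (mod-trans e′ e))))
                                  (sym (cong₂ _+_ (δ-res-≢ w y n₁) (δ-res-≢ (- w) y n₂)))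
        where
        neither : ¬ (y ≡ w [mod + p ] ⊎ y ≡ - w [mod + p ])
        neither (inj₁ x) = n₁ (mod-sym x)
        neither (inj₂ x) = n₂ (mod-sym x)

  -- The pairs (y, a) with y² = a are counted twice: each a has `1 + χ a` roots and each y has one
  -- square.
  ∑χ≡0 : ∑ₚ χ ≡ + 0
  ∑χ≡0 = begin
    ∑ₚ χ                                                ≡⟨ cancel (+ p) (∑ₚ χ) ⟩
    (+ p + ∑ₚ χ) - + p                                  ≡⟨ cong (_- + p) double-count ⟩
    + p - + p                                           ≡⟨ ℤ.+-inverseʳ (+ p) ⟩
    + 0                                                 ∎
    where
    open ≡-Reasoning
    cancel : ∀ a b → b ≡ (a + b) - a
    cancel = solve-∀
    double-count : + p + ∑ₚ χ ≡ + p
    double-count = begin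
      + p + ∑ₚ χ                                         ≡⟨ cong (_+ ∑ₚ χ) (∑-1 p) ⟨
      ∑[ a < p ] (+ 1) + ∑ₚ χ                            ≡⟨ ∑-distrib-+ {p} (λ _ → + 1) (χ ∘ +_ ∘ toℕ) ⟨
      ∑ₚ (λ a → + 1 + χ a)                               ≡⟨ sum-cong-≗ {p} (λ a → sym (count-roots (+ toℕ a))) ⟩
      ∑ₚ (λ a → ∑ₚ (λ y → δ (res (y * y)) (res a)))      ≡⟨ ∑-comm {p} {p} (λ a y → δ (res (+ toℕ y * + toℕ y)) (res (+ toℕ a))) ⟩
      ∑ₚ (λ y → ∑ₚ (λ a → δ (res (y * y)) (res a)))      ≡⟨ sum-cong-≗ {p} (λ y → ∑ₚ-δ (+ toℕ y * + toℕ y)) ⟩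
      ∑[ y < p ] (+ 1)                                   ≡⟨ ∑-1 p ⟩
      + p                                                ∎

  χ-periodic-at : ∀ b → χ b ≡ χ (+ toℕ (res b))
  χ-periodic-at b = χ-periodic (mod-sym (toℕ-res b))

  -- Σ (χ b + χ (a b)) vanishes, and no summand is positive.
  χ-nonresidue-* : ∀ a → ¬ a ≡ + 0 [mod + p ] → (∀ y → ¬ a ≡ y * y [mod + p ]) → ∀ b → χ (a * b) ≡ - χ b
  χ-nonresidue-* a a≢0 none b = begin
    χ (a * b)     ≡⟨ χ-periodic (mod-* (mod-refl {a = a}) (mod-sym (toℕ-res b))) ⟩
    χ (a * b₀)    ≡⟨ solve-for (χ b₀) (χ (a * b₀)) (∑≡0⇒≡0 (f ∘ +_ ∘ toℕ) (λ t → nonneg (+ toℕ t)) ∑f≡0 (res b)) ⟩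
    - χ b₀        ≡⟨ cong -_ (χ-periodic-at b) ⟨
    - χ b         ∎
    where
    open ≡-Reasoning
    b₀ = + toℕ (res b)
    f : ℤ → ℤ
    f t = - (χ t + χ (a * t))
    solve-for : ∀ x y → - (x + y) ≡ + 0 → y ≡ - x
    solve-for x y e = trans (rearr x y) (trans (cong (λ z → - x - z) e) (ℤ.+-identityʳ (- x)))
      where
      rearr : ∀ x y → y ≡ - x - - (x + y)
      rearr = solve-∀
    nonneg : ∀ t → + 0 ℤ.≤ f t
    nonneg t with χ t | view t
    ... | _ | null z          = ℤ.≤-reflexive (sym (cong (λ z → - (+ 0 + z)) (χ-0 (mod-trans (mod-* (mod-refl {a = a}) z) (mod-reflexive (ℤ.*-zeroʳ a))))))
    ... | _ | residue n y e   = ℤ.≤-reflexive (sym (cong (λ z → - (+ 1 + z)) (begin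
          χ (a * t)        ≡⟨ χ-periodic (mod-trans (mod-* (mod-refl {a = a}) e) (mod-reflexive (ℤ.*-comm a (y * y)))) ⟩
          χ (y * y * a)    ≡⟨ χ-square-* y a (root-of-square-≢0 y n e) ⟩
          χ a              ≡⟨ χ-nonsquare a≢0 none ⟩
          - + 1            ∎)))
    ... | _ | nonresidue _ _ with χ (a * t) | view (a * t)
    ...   | _ | null _         = ℤ.+≤+ z≤n
    ...   | _ | residue _ _ _  = ℤ.+≤+ z≤n
    ...   | _ | nonresidue _ _ = ℤ.+≤+ z≤n
    ∑f≡0 : ∑ₚ f ≡ + 0
    ∑f≡0 = begin
      ∑ₚ f                                          ≡⟨ ∑-neg {p} (λ t → χ (+ toℕ t) + χ (a * + toℕ t)) ⟩
      - ∑ₚ (λ t → χ t + χ (a * t))                  ≡⟨ cong -_ (∑-distrib-+ {p} (λ t → χ (+ toℕ t)) (λ t → χ (a * + toℕ t))) ⟩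
      - (∑ₚ χ + ∑ₚ (λ t → χ (a * t)))               ≡⟨ cong₂ (λ x y → - (x + y)) ∑χ≡0 (trans (∑ₚ-scale χ-periodic a a≢0) ∑χ≡0) ⟩
      + 0                                           ∎

  χ-* : ∀ a b → χ (a * b) ≡ χ a * χ b
  χ-* a b with χ a | view a
  ... | _ | null z            = trans (χ-0 (mod-trans (mod-* z (mod-refl {a = b})) (mod-reflexive (ℤ.*-zeroˡ b)))) (sym (ℤ.*-zeroˡ (χ b)))
  ... | _ | residue n y e     = trans (χ-periodic (mod-* e (mod-refl {a = b})))
                                      (trans (χ-square-* y b (root-of-square-≢0 y n e)) (sym (ℤ.*-identityˡ (χ b))))
  ... | _ | nonresidue n none = trans (χ-nonresidue-* a n none b) (sym (ℤ.-1*i≡-i (χ b)))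

  χ²≡1 : ∀ {a} → ¬ a ≡ + 0 [mod + p ] → χ a * χ a ≡ + 1
  χ²≡1 {a} n = trans (sym (χ-* a a)) (χ-square a (product-≢0 n n) mod-refl)

  -- Without nonresidues all values of χ would be nonnegative, and as their sum is 0 even `χ (+ 1)`
  -- would vanish.
  ∃-nonresidue : ∃ λ r → ¬ r ≡ + 0 [mod + p ] × χ r ≡ - + 1
  ∃-nonresidue with Fin.any? (λ (t : Fin p) → χ (+ toℕ t) ℤ.≟ - + 1)
  ... | yes (t , e) = + toℕ t , (λ z → contra (trans (sym e) (χ-0 z))) , e
    where
    contra : ¬ - + 1 ≡ + 0
    contra ()
  ... | no none = ⊥-elim (contra (trans (sym χ-1) (trans (χ-periodic-at (+ 1))
                    (∑≡0⇒≡0 (χ ∘ +_ ∘ toℕ) nonneg ∑χ≡0 (res (+ 1))))))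
    where
    contra : ¬ + 1 ≡ + 0
    contra ()
    from-view : ∀ {z v} → LegendreView p z v → ¬ v ≡ - + 1 → + 0 ℤ.≤ v
    from-view (null _)         _ = ℤ.+≤+ z≤n
    from-view (residue _ _ _)  _ = ℤ.+≤+ z≤n
    from-view (nonresidue _ _) n = ⊥-elim (n refl)
    nonneg : ∀ (t : Fin p) → + 0 ℤ.≤ χ (+ toℕ t)
    nonneg t = from-view (view (+ toℕ t)) (λ e → none (t , e))

  -- Autocorrelation of χ

  correlation : ℤ → ℤ
  correlation d = ∑ₚ (λ t → χ t * χ (t + d))

  χ-correland : ∀ d → Periodic (+ p) (λ t → χ t * χ (t + d))
  χ-correland d e = cong₂ _*_ (χ-periodic e) (χ-periodic (mod-+ e mod-refl))

  correlation-0 : ∀ {d} → d ≡ + 0 [mod + p ] → correlation d ≡ + (m ℕ.* 2)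
  correlation-0 {d} z = begin
    correlation d                                           ≡⟨ sum-cong-≗ {p} (λ t → term (+ toℕ t)) ⟩
    ∑ₚ (λ t → + 1 + - + 1 * δ (res (+ 0)) (res t))          ≡⟨ ∑-lin {p} (λ _ → + 1) (λ t → δ (res (+ 0)) (res (+ toℕ t))) (- + 1) ⟩
    ∑[ t < p ] (+ 1) + - + 1 * ∑ₚ (λ t → δ (res (+ 0)) (res t)) ≡⟨ cong₂ (λ x y → x + - + 1 * y) (∑-1 p) (∑ₚ-δ (+ 0)) ⟩
    + (m ℕ.* 2)                                             ∎
    where
    open ≡-Reasoning
    term : ∀ t → χ t * χ (t + d) ≡ + 1 + - + 1 * δ (res (+ 0)) (res t)
    term t = cases (mod? t (+ 0) p)
      where
      t+d≡t : t + d ≡ t [mod + p ]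
      t+d≡t = mod-trans (mod-+ (mod-refl {a = t}) z) (mod-reflexive (ℤ.+-identityʳ t))
      cases : Dec (t ≡ + 0 [mod + p ]) → χ t * χ (t + d) ≡ + 1 + - + 1 * δ (res (+ 0)) (res t)
      cases (yes t≡0) = trans (cong (_* χ (t + d)) (χ-0 t≡0)) (cong (λ x → + 1 + - + 1 * x) (sym (δ-res (+ 0) t (mod-sym t≡0))))
      cases (no t≢0)  = trans (trans (cong (χ t *_) (χ-periodic t+d≡t)) (χ²≡1 t≢0))
                              (cong (λ x → + 1 + - + 1 * x) (sym (δ-res-≢ (+ 0) t (t≢0 ∘ mod-sym))))

  -- The substitution of `d * t` for t brings out the factor χ(d)², which is 1.
  correlation-unit : ∀ {d} → ¬ d ≡ + 0 [mod + p ] → correlation d ≡ correlation (+ 1)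
  correlation-unit {d} d≢0 = trans (sym (∑ₚ-scale (χ-correland d) d d≢0)) (sum-cong-≗ {p} λ t → term (+ toℕ t))
    where
    factor : ∀ d t → d * t + d ≡ d * (t + + 1)
    factor = solve-∀
    rearr : ∀ a b c → a * b * (a * c) ≡ a * a * (b * c)
    rearr = solve-∀
    term : ∀ t → χ (d * t) * χ (d * t + d) ≡ χ t * χ (t + + 1)
    term t = begin
      χ (d * t) * χ (d * t + d)                    ≡⟨ cong (λ z → χ (d * t) * χ z) (factor d t) ⟩
      χ (d * t) * χ (d * (t + + 1))                ≡⟨ cong₂ _*_ (χ-* d t) (χ-* d (t + + 1)) ⟩
      χ d * χ t * (χ d * χ (t + + 1))              ≡⟨ rearr (χ d) (χ t) (χ (t + + 1)) ⟩
      χ d * χ d * (χ t * χ (t + + 1))              ≡⟨ cong (_* (χ t * χ (t + + 1))) (χ²≡1 d≢0) ⟩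
      + 1 * (χ t * χ (t + + 1))                    ≡⟨ ℤ.*-identityˡ (χ t * χ (t + + 1)) ⟩
      χ t * χ (t + + 1)                            ∎
      where open ≡-Reasoning

  ∑-correlation : ∑ₚ correlation ≡ + 0
  ∑-correlation = begin
    ∑ₚ (λ d → ∑ₚ (λ t → χ t * χ (t + d)))   ≡⟨ ∑-comm {p} {p} (λ d t → χ (+ toℕ t) * χ (+ toℕ t + + toℕ d)) ⟩
    ∑ₚ (λ t → ∑ₚ (λ d → χ t * χ (t + d)))   ≡⟨ ∑-zero {p} (λ t → inner (+ toℕ t)) ⟩
    + 0                                     ∎
    where
    open ≡-Reasoning
    inner : ∀ t → ∑ₚ (λ d → χ t * χ (t + d)) ≡ + 0
    inner t = begin
      ∑ₚ (λ d → χ t * χ (t + d))            ≡⟨ *-distribˡ-sum {p} (χ t) (λ d → χ (t + + toℕ d)) ⟨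
      χ t * ∑ₚ (λ d → χ (t + d))            ≡⟨ cong (χ t *_) (sum-cong-≗ {p} λ d → cong χ (ℤ.+-comm t (+ toℕ d))) ⟩
      χ t * ∑ₚ (λ d → χ (d + t))            ≡⟨ cong (χ t *_) (trans (∑ₚ-shift χ-periodic t) ∑χ≡0) ⟩
      χ t * + 0                             ≡⟨ ℤ.*-zeroʳ (χ t) ⟩
      + 0                                   ∎

  ∑-const : ∀ n c → ∑[ i < n ] c ≡ + n * c
  ∑-const n c = trans (sum-cong-≗ {n} λ _ → sym (ℤ.*-identityˡ c)) (trans (sym (*-distribʳ-sum {n} c (λ _ → + 1))) (cong (_* c) (∑-1 n)))

  -- The shift 0 contributes p - 1 and each of the p - 1 other shifts contributes the same c, while
  -- the total is 0: hence (p - 1)(1 + c) = 0.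
  correlation-1 : correlation (+ 1) ≡ - + 1
  correlation-1 = isolate (ℤ.i*j≡0⇒i≡0∨j≡0 (+ (m ℕ.* 2)) (begin
    + (m ℕ.* 2) * (+ 1 + c)                 ≡⟨ distr (+ (m ℕ.* 2)) c ⟩
    + (m ℕ.* 2) + + (m ℕ.* 2) * c           ≡⟨ cong₂ _+_ (correlation-0 mod-refl) tail ⟨
    ∑ₚ correlation                          ≡⟨ ∑-correlation ⟩
    + 0                                     ∎))
    where
    open ≡-Reasoning
    c = correlation (+ 1)
    distr : ∀ n c → n * (+ 1 + c) ≡ n + n * c
    distr = solve-∀
    tail : ∑[ d < m ℕ.* 2 ] correlation (+ suc (toℕ d)) ≡ + (m ℕ.* 2) * c
    tail = trans (sum-cong-≗ {m ℕ.* 2} λ d → correlation-unit (small-≢0 (s≤s (Fin.toℕ<n d)) (λ ()))) (∑-const (m ℕ.* 2) c)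
    isolate : + (m ℕ.* 2) ≡ + 0 ⊎ + 1 + c ≡ + 0 → c ≡ - + 1
    isolate (inj₁ e) = ⊥-elim (p≢1 (cong suc (ℤ.+-injective e)))
    isolate (inj₂ e) = trans (cancel c) (cong (_- + 1) e)
      where
      cancel : ∀ c → c ≡ + 1 + c - + 1
      cancel = solve-∀

  correlation-≢0 : ∀ {d} → ¬ d ≡ + 0 [mod + p ] → correlation d ≡ - + 1
  correlation-≢0 n = trans (correlation-unit n) correlation-1

  -- The value of χ at -1

  ε : ℤ
  ε = χ (- + 1)

  -1≢0 : ¬ - + 1 ≡ + 0 [mod + p ]
  -1≢0 e = 1≢0 (mod-neg e)

  ε²≡1 : ε * ε ≡ + 1
  ε²≡1 = χ²≡1 -1≢0

  χ-neg : ∀ a → χ (- a) ≡ ε * χ a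
  χ-neg a = trans (cong χ (sym (ℤ.-1*i≡-i a))) (χ-* (- + 1) a)

  -- Centring the sum Σ χ(t)χ(t+1) = -1 at the fixed point of t ↦ -1 - t leaves the central term ε
  -- and pairs of equal terms ±1, so that it determines ε modulo 4.
  ε≡signℤ : ε ≡ signℤ m
  ε≡signℤ = ±1-unique-mod-4 ε²≡1 (signℤ² m) (mod-trans (mod-reflexive solve-ε) (mod-trans (mod-+ (mod-refl {a = - + 1}) (mod-neg (pairs m m≢0 refl))) (final (x²≡1⇒±1 (signℤ m) (signℤ² m)))))
    where
    open ≡-Reasoning
    -- The summand at t = s + m. Since 2m + 1 ≡ 0, the reflection of t to -1 - t becomes that of s
    -- to -s.
    g : ℤ → ℤ
    g s = χ (s + + m) * χ (s + + m + + 1)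
    h : ℕ → ℤ
    h t = g (+ suc t) + g (- + suc t)
    +p : + p ≡ + m + (+ m + + 1)
    +p = trans (ℤ.pos-+ 1 (m ℕ.* 2)) (trans (cong (_+_ (+ 1)) (ℤ.pos-* m 2)) (double (+ m)))
      where
      double : ∀ a → + 1 + a * + 2 ≡ a + (a + + 1)
      double = solve-∀
    complement : ∀ a b → a + b ≡ + p → a ≡ - b [mod + p ]
    complement a b e = modulo (divides (+ 1) (trans (neg-neg a b) (trans e (sym (ℤ.*-identityˡ (+ p))))))
      where
      neg-neg : ∀ a b → a - - b ≡ a + b
      neg-neg = solve-∀
    m<p : m ℕ.< p
    m<p = s≤s (ℕ.m≤m*n m 2)
    g-0 : g (+ 0) ≡ ε
    g-0 = begin
      χ (+ 0 + + m) * χ (+ 0 + + m + + 1)   ≡⟨ cong (λ a → χ a * χ (a + + 1)) (ℤ.+-identityˡ (+ m)) ⟩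
      χ (+ m) * χ (+ m + + 1)               ≡⟨ cong (χ (+ m) *_) (trans (χ-periodic (complement (+ m + + 1) (+ m) (trans (ℤ.+-comm (+ m + + 1) (+ m)) (sym +p)))) (χ-neg (+ m))) ⟩
      χ (+ m) * (ε * χ (+ m))               ≡⟨ rearr (χ (+ m)) ε ⟩
      ε * (χ (+ m) * χ (+ m))               ≡⟨ cong (ε *_) (χ²≡1 (small-≢0 m<p m≢0)) ⟩
      ε * + 1                               ≡⟨ ℤ.*-identityʳ ε ⟩
      ε                                     ∎
      where
      rearr : ∀ a b → a * (b * a) ≡ b * (a * a)
      rearr = solve-∀
    g-even : ∀ s → g (- s) ≡ g s
    g-even s = begin
      χ (- s + + m) * χ (- s + + m + + 1)
        ≡⟨ cong₂ _*_ (trans (χ-periodic (complement (- s + + m) (s + + m + + 1) (trans (total₁ s (+ m)) (sym +p)))) (χ-neg (s + + m + + 1)))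
                     (trans (χ-periodic (complement (- s + + m + + 1) (s + + m) (trans (total₂ s (+ m)) (sym +p)))) (χ-neg (s + + m))) ⟩
      ε * χ (s + + m + + 1) * (ε * χ (s + + m))
        ≡⟨ rearr ε (χ (s + + m + + 1)) (χ (s + + m)) ⟩
      ε * ε * g s
        ≡⟨ trans (cong (_* g s) ε²≡1) (ℤ.*-identityˡ (g s)) ⟩
      g s ∎
      where
      total₁ : ∀ s m → - s + m + (s + m + + 1) ≡ m + (m + + 1)
      total₁ = solve-∀
      total₂ : ∀ s m → - s + m + + 1 + (s + m) ≡ m + (m + + 1)
      total₂ = solve-∀
      rearr : ∀ e a b → e * a * (e * b) ≡ e * e * (b * a)
      rearr = solve-∀
    h-double : ∀ t → h t ≡ g (+ suc t) + g (+ suc t)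
    h-double t = cong (_+_ (g (+ suc t))) (g-even (+ suc t))
    h-unit : ∀ t → suc t ℕ.< m → h t ≡ + 2 [mod + 4 ]
    h-unit t t<m = mod-trans (mod-reflexive (h-double t)) (2x≡2-mod-4 {g (+ suc t)} (trans (rearr (χ (+ suc t + + m)) (χ (+ suc t + + m + + 1)))
      (cong₂ _*_ (χ²≡1 {+ suc t + + m} (small-≢0 (ℕ.<-trans (ℕ.n<1+n _) bound) (λ ())))
                 (χ²≡1 {+ suc t + + m + + 1} (subst (λ k → ¬ + k ≡ + 0 [mod + p ]) (ℕ.+-comm 1 (suc t ℕ.+ m)) (small-≢0 bound (λ ())))))))
      where
      bound : suc (suc t ℕ.+ m) ℕ.< p
      bound = s≤s (subst (suc (suc t) ℕ.+ m ≤_) (trans (cong (m ℕ.+_) (sym (ℕ.+-identityʳ m))) (ℕ.*-comm 2 m)) (ℕ.+-monoˡ-≤ m t<m))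
      rearr : ∀ a b → a * b * (a * b) ≡ a * a * (b * b)
      rearr = solve-∀
    -- At s = m the second factor is χ(2m + 1) = χ(p) = 0, so the outermost pair is lost.
    h-last : ∀ t → suc t ≡ m → h t ≡ + 0
    h-last t e = trans (h-double t) (cong (λ x → x + x) (trans (cong (χ (+ suc t + + m) *_) (χ-0 z)) (ℤ.*-zeroʳ (χ (+ suc t + + m)))))
      where
      z : + suc t + + m + + 1 ≡ + 0 [mod + p ]
      z = complement (+ suc t + + m + + 1) (+ 0) (trans (ℤ.+-identityʳ (+ suc t + + m + + 1)) (trans (cong (λ k → + k + + m + + 1) e) (trans (ℤ.+-assoc (+ m) (+ m) (+ 1)) (sym +p))))
    -- There remain m - 1 pairs, each congruent to 2 modulo 4; the double negation comes from
    -- `signℤ (m - 1) = - signℤ m`.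
    pairs : ∀ k → ¬ k ≡ 0 → k ≡ m → ∑[ t < k ] h (toℕ t) ≡ + 1 - - signℤ k [mod + 4 ]
    pairs zero    ne _ = ⊥-elim (ne refl)
    pairs (suc k) _  e = mod-trans
      (mod-reflexive (trans (sum-init-last {k} (h ∘ toℕ))
        (trans (cong₂ _+_ (sum-cong-≗ {k} λ t → cong h (Fin.toℕ-inject₁ t)) (trans (cong h (Fin.toℕ-fromℕ k)) (h-last k e))) (ℤ.+-identityʳ _))))
      (mod-trans (∑-2-mod-4 k h (λ t t<k → h-unit t (subst (suc t ℕ.<_) e (s≤s t<k))))
        (mod-reflexive (cong (_-_ (+ 1)) (sym (ℤ.neg-involutive (signℤ k))))))
    solve-ε : ε ≡ - + 1 + - ∑[ t < m ] h (toℕ t)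
    solve-ε = begin
      ε                                         ≡⟨ cancel ε (∑[ t < m ] h (toℕ t)) ⟩
      ε + S - S                                 ≡⟨ cong (λ z → z + S - S) g-0 ⟨
      g (+ 0) + S - S                           ≡⟨ cong (_- S) (∑-centred m g) ⟨
      ∑ₚ (λ t → g (t - + m)) - S                ≡⟨ cong (_- S) (sum-cong-≗ {p} λ t → cong (λ a → χ a * χ (a + + 1)) (back (+ toℕ t) (+ m))) ⟩
      correlation (+ 1) - S                     ≡⟨ cong (_- S) correlation-1 ⟩
      - + 1 - S                                 ∎
      where
      S = ∑[ t < m ] h (toℕ t)
      cancel : ∀ a b → a ≡ a + b - b
      cancel = solve-∀
      back : ∀ a b → a - b + b ≡ a
      back = solve-∀
    -- The left side is -2 - s, congruent to s because 2s ≡ 2 modulo 4.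
    final : ∀ {s} → s ≡ + 1 ⊎ s ≡ - + 1 → - + 1 + - (+ 1 - - s) ≡ s [mod + 4 ]
    final (inj₁ refl) = modulo (divides (- + 1) refl)
    final (inj₂ refl) = mod-refl

-- The Paley matrix

^-double : ∀ x k → x ^ (k ℕ.* 2) ≡ x ^ k * x ^ k
^-double x zero    = refl
^-double x (suc k) = trans (cong (λ y → x * (x * y)) (^-double x k)) (rearr x (x ^ k))
  where
  rearr : ∀ x y → x * (x * (y * y)) ≡ x * y * (x * y)
  rearr = solve-∀

^-distrib-* : ∀ x y k → (x * y) ^ k ≡ x ^ k * y ^ k
^-distrib-* x y zero    = refl
^-distrib-* x y (suc k) = trans (cong (x * y *_) (^-distrib-* x y k)) (rearr x y (x ^ k) (y ^ k))
  where
  rearr : ∀ x y a b → x * y * (a * b) ≡ x * a * (y * b)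
  rearr = solve-∀

-1^ : ∀ k → (- + 1) ^ k ≡ signℤ k
-1^ zero    = refl
-1^ (suc k) = trans (ℤ.-1*i≡-i ((- + 1) ^ k)) (cong -_ (-1^ k))

-- The exponent of -1 is k (k + 1), an even number. This is why no sign is left in `det-A`.
signℤ^ : ∀ k → signℤ k ^ k * signℤ k ≡ + 1
signℤ^ k = from (x²≡1⇒±1 (signℤ k) (signℤ² k))
  where
  from : signℤ k ≡ + 1 ⊎ signℤ k ≡ - + 1 → signℤ k ^ k * signℤ k ≡ + 1
  from (inj₁ e) = trans (cong (λ s → s ^ k * s) e) (trans (ℤ.*-identityʳ ((+ 1) ^ k)) (ℤ.^-zeroˡ k))
  from (inj₂ e) = trans (cong (λ s → s ^ k * signℤ k) e) (trans (cong (_* signℤ k) (-1^ k)) (signℤ² k))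

-- Here p = 2k + 3, so that k = (p - 3)/2 is the exponent of p in the theorem, while n = p - 1 is
-- the number of nonzero residues.
module Paley (k : ℕ) (prime : Prime (suc (suc k ℕ.* 2))) where
  open LegendreSymbol (suc k) prime

  n : ℕ
  n = suc k ℕ.* 2

  x : Fin n → ℤ
  x i = + suc (toℕ i)

  x≢0 : ∀ i → ¬ x i ≡ + 0 [mod + p ]
  x≢0 i = small-≢0 (s≤s (Fin.toℕ<n i)) (λ ())

  x-injective : ∀ {i j} → x i ≡ x j [mod + p ] → i ≡ j
  x-injective {i} {j} e = Fin.toℕ-injective (ℕ.suc-injective (mod-unique (s≤s (Fin.toℕ<n i)) (s≤s (Fin.toℕ<n j)) e))

  x-surjective : ∀ z → ¬ z ≡ + 0 [mod + p ] → ∃ λ i → x i ≡ z [mod + p ]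
  x-surjective z z≢0 with res z | toℕ-res z
  ... | fzero  | e = ⊥-elim (z≢0 (mod-sym e))
  ... | fsuc i | e = i , e

  ∑χx≡0 : ∑[ i < n ] χ (x i) ≡ + 0
  ∑χx≡0 = trans (sym (ℤ.+-identityˡ _)) (trans (cong (_+ ∑[ i < n ] χ (x i)) (sym (χ-0 {+ 0} mod-refl))) ∑χ≡0)

  correlation-shift : ∀ a b → ∑ₚ (λ t → χ (t + a) * χ (t + b)) ≡ correlation (b - a)
  correlation-shift a b = trans
    (sum-cong-≗ {p} λ t → cong (λ c → χ (+ toℕ t + a) * χ c) (regroup (+ toℕ t) a b))
    (∑ₚ-shift (χ-correland (b - a)) a)
    where
    regroup : ∀ t a b → t + b ≡ t + a + (b - a)
    regroup = solve-∀

  -- Stated for all q up to p because it serves both M, with q = p, and A, with q = p - 1.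
  correlation-δ : ∀ {q} → q ≤ p → (i j : Fin q) → correlation (+ toℕ j - + toℕ i) ≡ + p * δ i j - + 1
  correlation-δ q≤p i j with i Fin.≟ j
  ... | yes refl = trans (correlation-0 (mod-reflexive (ℤ.+-inverseʳ (+ toℕ i))))
                         (cong (_- + 1) (sym (trans (cong (+ p *_) (δ-refl i)) (ℤ.*-identityʳ (+ p)))))
  ... | no i≢j   = trans (correlation-≢0 distinct) (cong (_- + 1) (sym (trans (cong (+ p *_) (δ-≢ i≢j)) (ℤ.*-zeroʳ (+ p)))))
    where
    distinct : ¬ + toℕ j - + toℕ i ≡ + 0 [mod + p ]
    distinct e = i≢j (sym (Fin.toℕ-injective (mod-unique (ℕ.<-≤-trans (Fin.toℕ<n j) q≤p) (ℕ.<-≤-trans (Fin.toℕ<n i) q≤p)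
      (subst₂ (_≡_[mod + p ]) (cancel (+ toℕ j) (+ toℕ i)) (ℤ.+-identityˡ (+ toℕ i)) (mod-+ e (mod-refl {a = + toℕ i}))))))
      where
      cancel : ∀ a b → a - b + b ≡ a
      cancel = solve-∀

  A : Matrix n n
  A i j = χ (x i - x j)

  -- The product sums over nonzero residues only. Including t = 0 completes it to a correlation, and
  -- the term added is what is subtracted at the end.
  A⊗A : ∀ i j → (A ⊗ A) i j ≡ ε * (+ p * δ i j - + 1 - χ (x i) * χ (x j))
  A⊗A i j = begin
    (A ⊗ A) i j                                        ≡⟨ cancel (F (+ 0)) ((A ⊗ A) i j) ⟩
    ∑ₚ F - F (+ 0)                                     ≡⟨ cong₂ _-_ total zeroth ⟩
    ε * (+ p * δ i j - + 1) - ε * (χ (x i) * χ (x j))  ≡⟨ factor ε (+ p * δ i j - + 1) (χ (x i) * χ (x j)) ⟩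
    ε * (+ p * δ i j - + 1 - χ (x i) * χ (x j))        ∎
    where
    open ≡-Reasoning
    F : ℤ → ℤ
    F t = χ (x i - t) * χ (t - x j)
    cancel : ∀ f s → s ≡ f + s - f
    cancel = solve-∀
    factor : ∀ e a b → e * a - e * b ≡ e * (a - b)
    factor = solve-∀
    flip : ∀ a b → a - b ≡ - (b - a)
    flip = solve-∀
    difference : ∀ a b → - b - - a ≡ a - b
    difference = solve-∀
    suc-difference : ∀ a b → (+ 1 + a) - (+ 1 + b) ≡ a - b
    suc-difference = solve-∀
    zeroth : F (+ 0) ≡ ε * (χ (x i) * χ (x j))
    zeroth = begin
      χ (x i - + 0) * χ (+ 0 - x j)   ≡⟨ cong₂ (λ a b → χ a * χ b) (ℤ.+-identityʳ (x i)) (ℤ.+-identityˡ (- x j)) ⟩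
      χ (x i) * χ (- x j)             ≡⟨ cong (χ (x i) *_) (χ-neg (x j)) ⟩
      χ (x i) * (ε * χ (x j))         ≡⟨ rearr (χ (x i)) ε (χ (x j)) ⟩
      ε * (χ (x i) * χ (x j))         ∎
      where
      rearr : ∀ a e b → a * (e * b) ≡ e * (a * b)
      rearr = solve-∀
    term : ∀ t → F t ≡ ε * (χ (t + - x i) * χ (t + - x j))
    term t = begin
      χ (x i - t) * χ (t - x j)              ≡⟨ cong (λ a → χ a * χ (t - x j)) (flip (x i) t) ⟩
      χ (- (t - x i)) * χ (t - x j)          ≡⟨ cong (_* χ (t - x j)) (χ-neg (t - x i)) ⟩
      ε * χ (t - x i) * χ (t - x j)          ≡⟨ ℤ.*-assoc ε (χ (t - x i)) (χ (t - x j)) ⟩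
      ε * (χ (t + - x i) * χ (t + - x j))    ∎
    total : ∑ₚ F ≡ ε * (+ p * δ i j - + 1)
    total = begin
      ∑ₚ F                                                  ≡⟨ sum-cong-≗ {p} (λ t → term (+ toℕ t)) ⟩
      ∑ₚ (λ t → ε * (χ (t + - x i) * χ (t + - x j)))        ≡⟨ *-distribˡ-sum {p} ε (λ t → χ (+ toℕ t + - x i) * χ (+ toℕ t + - x j)) ⟨
      ε * ∑ₚ (λ t → χ (t + - x i) * χ (t + - x j))          ≡⟨ cong (ε *_) (correlation-shift (- x i) (- x j)) ⟩
      ε * correlation (- x j - - x i)                       ≡⟨ cong (λ d → ε * correlation d) (trans (difference (x i) (x j)) (suc-difference (+ toℕ i) (+ toℕ j))) ⟩
      ε * correlation (+ toℕ i - + toℕ j)                   ≡⟨ cong (ε *_) (correlation-δ (ℕ.n≤1+n n) j i) ⟩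
      ε * (+ p * δ j i - + 1)                               ≡⟨ cong (λ d → ε * (+ p * d - + 1)) (δ-sym j i) ⟩
      ε * (+ p * δ i j - + 1)                               ∎

  -- The homogenised characteristic polynomial of -A, as a function of integers.
  f : ℤ → ℤ → ℤ
  f u v = detℤ n (λ i j → u * δ i j + v * A i j)

  -- Multiplication by a nonresidue r permutes the indices and turns A into -A.
  f-conjugate : ∀ u v r → ¬ r ≡ + 0 [mod + p ] → χ r ≡ - + 1 →
                (σ : Fin n → Fin n) → (∀ i → x (σ i) ≡ r * x i [mod + p ]) →
                detℤ n (λ i j → u * δ i j - v * A i j) ≡ f u v
  f-conjugate u v r r≢0 χr≡-1 σ σ-spec = trans (det-cong n entry) (det-conjugate n (λ i j → u * δ i j + v * A i j) σ σ-injective)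
    where
    σ-injective : Injective _≡_ _≡_ σ
    σ-injective {i} {j} e = x-injective (cancelˡ r r≢0 (mod-trans (mod-sym (σ-spec i)) (mod-trans (mod-reflexive (cong x e)) (σ-spec j))))
    factor : ∀ r a b → r * a - r * b ≡ r * (a - b)
    factor = solve-∀
    A-σ : ∀ i j → A (σ i) (σ j) ≡ - A i j
    A-σ i j = begin
      χ (x (σ i) - x (σ j))      ≡⟨ χ-periodic (mod-+ (σ-spec i) (mod-neg (σ-spec j))) ⟩
      χ (r * x i - r * x j)      ≡⟨ cong χ (factor r (x i) (x j)) ⟩
      χ (r * (x i - x j))        ≡⟨ χ-* r (x i - x j) ⟩
      χ r * A i j                ≡⟨ cong (_* A i j) χr≡-1 ⟩
      - + 1 * A i j              ≡⟨ ℤ.-1*i≡-i (A i j) ⟩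
      - A i j                    ∎
      where open ≡-Reasoning
    entry : ∀ i j → u * δ i j - v * A i j ≡ u * δ (σ i) (σ j) + v * A (σ i) (σ j)
    entry i j = sym (trans (cong₂ (λ d a → u * d + v * a) (δ-injective σ-injective i j) (A-σ i j)) (cong (_+_ (u * δ i j)) (sym (ℤ.neg-distribʳ-* v (A i j)))))

  f-even : ∀ u v → detℤ n (λ i j → u * δ i j - v * A i j) ≡ f u v
  f-even u v = from ∃-nonresidue
    where
    from : (∃ λ r → ¬ r ≡ + 0 [mod + p ] × χ r ≡ - + 1) → detℤ n (λ i j → u * δ i j - v * A i j) ≡ f u v
    from (r , r≢0 , χr≡-1) = f-conjugate u v r r≢0 χr≡-1 (proj₁ ∘ image) (proj₂ ∘ image)
      where
      image : ∀ i → ∃ λ j → x j ≡ r * x i [mod + p ]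
      image i = x-surjective (r * x i) (product-≢0 r≢0 (x≢0 i))

  module _ (u v : ℤ) where
    a b : ℤ
    a = u * u - ε * + p * (v * v)
    b = ε * (v * v)

    -- This is u² I - v² A², rewritten by `A⊗A`.
    K : Matrix n n
    K i j = a * δ i j + b * (+ 1 + χ (x i) * χ (x j))

    private
      U V : Matrix n n
      U i j = u * δ i j + v * A i j
      V i j = u * δ i j - v * A i j

    U⊗V : ∀ i j → (U ⊗ V) i j ≡ K i j
    U⊗V i j = begin
      ∑[ l < n ] ((u * δ i l + v * A i l) * V l j)
        ≡⟨ sum-cong-≗ {n} (λ l → distr u (δ i l) v (A i l) (V l j)) ⟩
      ∑[ l < n ] (u * (δ i l * V l j) + v * (A i l * V l j))
        ≡⟨ ∑-lin {n} (λ l → u * (δ i l * V l j)) (λ l → A i l * V l j) v ⟩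
      ∑[ l < n ] (u * (δ i l * V l j)) + v * ∑[ l < n ] (A i l * V l j)
        ≡⟨ cong₂ (λ s t → s + v * t) (trans (sym (*-distribˡ-sum {n} u (λ l → δ i l * V l j))) (cong (u *_) (∑-δˡ i (λ l → V l j)))) AV ⟩
      u * V i j + v * (u * A i j + - v * (A ⊗ A) i j)
        ≡⟨ cong (λ z → u * V i j + v * (u * A i j + - v * z)) (A⊗A i j) ⟩
      u * V i j + v * (u * A i j + - v * (ε * (+ p * δ i j - + 1 - χ (x i) * χ (x j))))
        ≡⟨ collect u v (δ i j) (A i j) ε (+ p) (χ (x i) * χ (x j)) ⟩
      K i j ∎
      where
      open ≡-Reasoning
      distr : ∀ u d v a w → (u * d + v * a) * w ≡ u * (d * w) + v * (a * w)
      distr = solve-∀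
      distr′ : ∀ a u d v c → a * (u * d - v * c) ≡ u * (a * d) + - v * (a * c)
      distr′ = solve-∀
      collect : ∀ u v d a e p c → u * (u * d - v * a) + v * (u * a + - v * (e * (p * d - + 1 - c))) ≡
                (u * u - e * p * (v * v)) * d + e * (v * v) * (+ 1 + c)
      collect = solve-∀
      AV : ∑[ l < n ] (A i l * V l j) ≡ u * A i j + - v * (A ⊗ A) i j
      AV = begin
        ∑[ l < n ] (A i l * V l j)
          ≡⟨ sum-cong-≗ {n} (λ l → distr′ (A i l) u (δ l j) v (A l j)) ⟩
        ∑[ l < n ] (u * (A i l * δ l j) + - v * (A i l * A l j))
          ≡⟨ ∑-lin {n} (λ l → u * (A i l * δ l j)) (λ l → A i l * A l j) (- v) ⟩
        ∑[ l < n ] (u * (A i l * δ l j)) + - v * (A ⊗ A) i j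
          ≡⟨ cong (_+ - v * (A ⊗ A) i j) (trans (sym (*-distribˡ-sum {n} u (λ l → A i l * δ l j))) (cong (u *_) (∑-δ (A i) j))) ⟩
        u * A i j + - v * (A ⊗ A) i j ∎

    f²≡det-K : f u v * f u v ≡ detℤ n K
    f²≡det-K = trans (cong (f u v *_) (sym (f-even u v))) (trans (sym (det-⊗ n U V)) (det-cong n U⊗V))

    private
      L R : Matrix n n
      L i j = a * δ i j + b * + 1
      R i j = a * δ i j + b * χ (x i) * χ (x j)

    -- The eigenvalue of K on the all-ones vector and on χ; on the orthogonal complement of both it
    -- is `a`.
    a+nb : ℤ
    a+nb = u * u - ε * (v * v)

    a+nb≡ : a + + n * b ≡ a+nb
    a+nb≡ = trans (cong (λ q → u * u - ε * q * (v * v) + + n * (ε * (v * v))) (ℤ.pos-+ 1 n)) (simp (u * u) ε (+ n) (v * v))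
      where
      simp : ∀ w e n y → w - e * (+ 1 + n) * y + n * (e * y) ≡ w - e * y
      simp = solve-∀

    -- The all-ones matrix and χ χᵀ annihilate each other.
    L⊗R : ∀ i j → (L ⊗ R) i j ≡ a * K i j
    L⊗R i j = begin
      ∑[ l < n ] ((a * δ i l + b * + 1) * R l j)
        ≡⟨ sum-cong-≗ {n} (λ l → distr a (δ i l) b (R l j)) ⟩
      ∑[ l < n ] (a * (δ i l * R l j) + b * R l j)
        ≡⟨ ∑-lin {n} (λ l → a * (δ i l * R l j)) (λ l → R l j) b ⟩
      ∑[ l < n ] (a * (δ i l * R l j)) + b * ∑[ l < n ] R l j
        ≡⟨ cong₂ (λ s t → s + b * t) (trans (sym (*-distribˡ-sum {n} a (λ l → δ i l * R l j))) (cong (a *_) (∑-δˡ i (λ l → R l j)))) column ⟩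
      a * R i j + b * a
        ≡⟨ collect a (δ i j) b (χ (x i)) (χ (x j)) ⟩
      a * K i j ∎
      where
      open ≡-Reasoning
      distr : ∀ a d b r → (a * d + b * + 1) * r ≡ a * (d * r) + b * r
      distr = solve-∀
      distr′ : ∀ a d b c e → a * d + b * c * e ≡ a * d + b * e * c
      distr′ = solve-∀
      collect : ∀ a d b c e → a * (a * d + b * c * e) + b * a ≡ a * (a * d + b * (+ 1 + c * e))
      collect = solve-∀
      column : ∑[ l < n ] R l j ≡ a
      column = begin
        ∑[ l < n ] (a * δ l j + b * χ (x l) * χ (x j))
          ≡⟨ sum-cong-≗ {n} (λ l → distr′ a (δ l j) b (χ (x l)) (χ (x j))) ⟩
        ∑[ l < n ] (a * δ l j + b * χ (x j) * χ (x l))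
          ≡⟨ ∑-lin {n} (λ l → a * δ l j) (λ l → χ (x l)) (b * χ (x j)) ⟩
        ∑[ l < n ] (a * δ l j) + b * χ (x j) * ∑[ l < n ] χ (x l)
          ≡⟨ cong₂ (λ s t → s + b * χ (x j) * t) (∑-δ (λ _ → a) j) ∑χx≡0 ⟩
        a + b * χ (x j) * + 0
          ≡⟨ trans (cong (_+_ a) (ℤ.*-zeroʳ (b * χ (x j)))) (ℤ.+-identityʳ a) ⟩
        a ∎

    det-L : a * detℤ n L ≡ a ^ n * a+nb
    det-L = trans (det-rank-one n a (λ _ → b) (λ _ → + 1))
      (cong (a ^ n *_) (trans (cong (_+_ a) (trans (∑-const n (b * + 1)) (cong (+ n *_) (ℤ.*-identityʳ b)))) a+nb≡))

    det-R : a * detℤ n R ≡ a ^ n * a+nb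
    det-R = trans (det-rank-one n a (λ i → b * χ (x i)) (λ i → χ (x i)))
      (cong (a ^ n *_) (trans (cong (_+_ a) (trans (sum-cong-≗ {n} squares) (∑-const n b))) a+nb≡))
      where
      squares : ∀ i → b * χ (x i) * χ (x i) ≡ b
      squares i = trans (ℤ.*-assoc b (χ (x i)) (χ (x i))) (trans (cong (b *_) (χ²≡1 (x≢0 i))) (ℤ.*-identityʳ b))

    -- The square root of det K: the eigenvalue `a` has multiplicity n - 2 = 2k, and `a+nb` has
    -- multiplicity 2.
    g : ℤ
    g = a ^ k * a+nb

    -- Comparing the determinants of `a K` and of `L ⊗ R` costs a factor `a ^ n`, and each of the
    -- two rank-one formulas costs one more `a`.
    det-K : ¬ a ≡ + 0 → detℤ n K ≡ g * g
    det-K a≢0 = ℤ.*-cancelˡ-≡ (a * a * a ^ n) (detℤ n K) (g * g) {{nz}} (begin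
      a * a * a ^ n * detℤ n K                     ≡⟨ ℤ.*-assoc (a * a) (a ^ n) (detℤ n K) ⟩
      a * a * (a ^ n * detℤ n K)                   ≡⟨ cong (a * a *_) (scale-rows n (det-alternating n) a K) ⟨
      a * a * detℤ n (λ i j → a * K i j)           ≡⟨ cong (a * a *_) (det-cong n L⊗R) ⟨
      a * a * detℤ n (L ⊗ R)                       ≡⟨ cong (a * a *_) (det-⊗ n L R) ⟩
      a * a * (detℤ n L * detℤ n R)                ≡⟨ rearr₁ a (detℤ n L) (detℤ n R) ⟩
      (a * detℤ n L) * (a * detℤ n R)              ≡⟨ cong₂ _*_ det-L det-R ⟩
      (a ^ n * a+nb) * (a ^ n * a+nb)              ≡⟨ cong (λ z → (a ^ n * a+nb) * (z * a+nb)) (^-double a (suc k)) ⟩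
      (a ^ n * a+nb) * (a * a ^ k * (a * a ^ k) * a+nb) ≡⟨ rearr₂ a (a ^ n) (a ^ k) a+nb ⟩
      a * a * a ^ n * (g * g)                      ∎)
      where
      open ≡-Reasoning
      rearr₁ : ∀ a l r → a * a * (l * r) ≡ (a * l) * (a * r)
      rearr₁ = solve-∀
      rearr₂ : ∀ a an ak c → (an * c) * (a * ak * (a * ak) * c) ≡ a * a * an * (ak * c * (ak * c))
      rearr₂ = solve-∀
      nz : ℤ.NonZero (a * a * a ^ n)
      nz = ℤ.≢-nonZero λ z → case-0 (ℤ.i*j≡0⇒i≡0∨j≡0 (a * a) z)
        where
        case-0 : ¬ (a * a ≡ + 0 ⊎ a ^ n ≡ + 0)
        case-0 (inj₁ z) with ℤ.i*j≡0⇒i≡0∨j≡0 a z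
        ... | inj₁ e = a≢0 e
        ... | inj₂ e = a≢0 e
        case-0 (inj₂ z) = a≢0 (ℤ.i^n≡0⇒i≡0 a n z)

  -- For u = N ≡ 1 and v = 4 both f and g are 1 modulo 4, which selects the sign in f = ± g;
  -- reducing modulo N then gives f = g at u = 0, N being arbitrarily large.
  f≡g-at-N : ∀ N → N ≡ + 1 [mod + 4 ] → f N (+ 4) ≡ g N (+ 4)
  f≡g-at-N N N≡1 = select (ℤ.i*j≡0⇒i≡0∨j≡0 (F - G) (trans (factor F G) (ℤ.i≡j⇒i-j≡0 squares)))
    where
    F = f N (+ 4)
    G = g N (+ 4)
    factor : ∀ a b → (a - b) * (a + b) ≡ a * a - b * b
    factor = solve-∀
    4*≡0 : ∀ z → + 4 * z ≡ + 0 [mod + 4 ]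
    4*≡0 z = modulo (divides z (trans (ℤ.+-identityʳ (+ 4 * z)) (ℤ.*-comm (+ 4) z)))
    16*≡0 : ∀ z → z * + 16 ≡ + 0 [mod + 4 ]
    16*≡0 z = mod-trans (mod-* (mod-refl {a = z}) (4*≡0 (+ 4))) (mod-reflexive (ℤ.*-zeroʳ z))
    N²≡1 : ∀ z → N * N - z * + 16 ≡ + 1 [mod + 4 ]
    N²≡1 z = mod-+ (mod-* N≡1 N≡1) (mod-neg (16*≡0 z))
    a≢0 : ¬ a N (+ 4) ≡ + 0
    a≢0 e = ℕ.1+n≢0 (mod-unique {1} {0} {4} (s≤s (s≤s z≤n)) (s≤s z≤n) (mod-trans (mod-sym (N²≡1 (ε * + p))) (mod-reflexive e)))
    squares : F * F ≡ G * G
    squares = trans (f²≡det-K N (+ 4)) (det-K N (+ 4) a≢0)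
    F≡1 : F ≡ + 1 [mod + 4 ]
    F≡1 = mod-trans (mod-det n {B = δ} λ i j → mod-trans (mod-+ (mod-* N≡1 (mod-refl {a = δ i j})) (4*≡0 (A i j)))
                       (mod-reflexive (trans (ℤ.+-identityʳ (+ 1 * δ i j)) (ℤ.*-identityˡ (δ i j)))))
                    (mod-reflexive (det-δ n))
    G≡1 : G ≡ + 1 [mod + 4 ]
    G≡1 = mod-trans (mod-* (mod-^ k (N²≡1 (ε * + p))) (N²≡1 ε)) (mod-reflexive (trans (ℤ.*-identityʳ ((+ 1) ^ k)) (ℤ.^-zeroˡ k)))
    select : F - G ≡ + 0 ⊎ F + G ≡ + 0 → F ≡ G
    select (inj₁ e) = ℤ.i-j≡0⇒i≡j F G e
    -- F + G is congruent to 2 modulo 4, so it cannot vanish.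
    select (inj₂ e) = ⊥-elim (ℕ.1+n≢0 (mod-unique {2} {0} {4} (s≤s (s≤s (s≤s z≤n))) (s≤s z≤n)
                        (mod-trans (mod-sym (mod-+ F≡1 G≡1)) (mod-reflexive e))))

  f-mod : ∀ {N u u′} v → u ≡ u′ [mod N ] → f u v ≡ f u′ v [mod N ]
  f-mod {N} {u} {u′} v e = mod-det n {λ i j → u * δ i j + v * A i j} {λ i j → u′ * δ i j + v * A i j}
    λ i j → mod-+ (mod-* e (mod-refl {a = δ i j})) (mod-refl {a = v * A i j})

  g-mod : ∀ {N u u′} v → u ≡ u′ [mod N ] → g u v ≡ g u′ v [mod N ]
  g-mod {N} {u} {u′} v e = mod-* (mod-^ k (factor (ε * + p * (v * v)))) (factor (ε * (v * v)))
    where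
    factor : ∀ c → u * u - c ≡ u′ * u′ - c [mod N ]
    factor c = mod-+ (mod-* e e) (mod-refl {a = - c})

  f≡g-at-0 : f (+ 0) (+ 4) ≡ g (+ 0) (+ 4)
  f≡g-at-0 = mod-small {N = N} bound
    (mod-trans (mod-sym (f-mod (+ 4) N≡0)) (mod-trans (mod-reflexive (f≡g-at-N N N≡1)) (g-mod (+ 4) N≡0)))
    where
    D : ℕ
    D = ∣ f (+ 0) (+ 4) - g (+ 0) (+ 4) ∣
    N : ℤ
    -- Congruent to 1 modulo 4 and larger than the difference D of the two values to be identified.
    N = + suc (D ℕ.* 4)
    N≡0 : N ≡ + 0 [mod N ]
    N≡0 = modulo (divides (+ 1) (trans (ℤ.+-identityʳ N) (sym (ℤ.*-identityˡ N))))
    N≡1 : N ≡ + 1 [mod + 4 ]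
    N≡1 = modulo (divides (+ D) (trans (cong (_- + 1) (ℤ.pos-+ 1 (D ℕ.* 4))) (trans (cancel (+ (D ℕ.* 4))) (ℤ.pos-* D 4))))
      where
      cancel : ∀ z → + 1 + z - + 1 ≡ z
      cancel = solve-∀
    bound : D ℕ.< suc (D ℕ.* 4)
    bound = s≤s (ℕ.m≤m*n D 4)

  -- At u = 0, v = 4 the square root reads (-16 ε p)^k (-16 ε). The powers of 16 make up 4^n, and -ε
  -- = (-1)^k leaves the sign (-1)^(k (k + 1)).
  det-A : detℤ n A ≡ (+ p) ^ k
  det-A = ℤ.*-cancelˡ-≡ ((+ 4) ^ n) (detℤ n A) ((+ p) ^ k) {{ℤ.≢-nonZero (λ z → 4≢0 (ℤ.i^n≡0⇒i≡0 (+ 4) n z))}} (begin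
    (+ 4) ^ n * detℤ n A                                       ≡⟨ scale-rows n (det-alternating n) (+ 4) A ⟨
    detℤ n (λ i j → + 4 * A i j)                               ≡⟨ det-cong n (λ i j → trans (cong (_+ + 4 * A i j) (ℤ.*-zeroˡ (δ i j))) (ℤ.+-identityˡ (+ 4 * A i j))) ⟨
    f (+ 0) (+ 4)                                              ≡⟨ f≡g-at-0 ⟩
    (+ 0 - ε * + p * + 16) ^ k * (+ 0 - ε * + 16)              ≡⟨ cong₂ (λ y z → y ^ k * z) (simp₁ ε (+ p)) (simp₂ ε) ⟩
    (+ 16 * (- ε * + p)) ^ k * (+ 16 * - ε)                    ≡⟨ cong (_* (+ 16 * - ε)) (trans (^-distrib-* (+ 16) (- ε * + p) k) (cong ((+ 16) ^ k *_) (^-distrib-* (- ε) (+ p) k))) ⟩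
    (+ 16) ^ k * ((- ε) ^ k * (+ p) ^ k) * (+ 16 * - ε)        ≡⟨ rearr (+ 16) ((+ 16) ^ k) ((- ε) ^ k) ((+ p) ^ k) (- ε) ⟩
    (+ 16) ^ suc k * (((- ε) ^ k * - ε) * (+ p) ^ k)           ≡⟨ cong₂ (λ y z → y * (z * (+ p) ^ k)) (trans (^-distrib-* (+ 4) (+ 4) (suc k)) (sym (^-double (+ 4) (suc k)))) sign ⟩
    (+ 4) ^ n * (+ 1 * (+ p) ^ k)                              ≡⟨ cong ((+ 4) ^ n *_) (ℤ.*-identityˡ ((+ p) ^ k)) ⟩
    (+ 4) ^ n * (+ p) ^ k                                      ∎)
    where
    open ≡-Reasoning
    4≢0 : ¬ + 4 ≡ + 0
    4≢0 ()
    simp₁ : ∀ e p → + 0 - e * p * + 16 ≡ + 16 * (- e * p)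
    simp₁ = solve-∀
    simp₂ : ∀ e → + 0 - e * + 16 ≡ + 16 * - e
    simp₂ = solve-∀
    rearr : ∀ s sk ek pk e → sk * (ek * pk) * (s * e) ≡ s * sk * ((ek * e) * pk)
    rearr = solve-∀
    sign : (- ε) ^ k * - ε ≡ + 1
    sign = trans (cong (λ e → e ^ k * e) (trans (cong -_ ε≡signℤ) (ℤ.neg-involutive (signℤ k)))) (signℤ^ k)

  -- Reversing the columns replaces `x j` by p - `x j`. The determinant of this reversal is the sign
  -- (-1)^((p-1)/2) of the theorem.
  det-hankel-minor : detℤ n (λ i j → χ (x i + x j)) ≡ signℤ (suc k) * (+ p) ^ k
  det-hankel-minor = begin
    detℤ n (λ i j → χ (x i + x j))                ≡⟨ det-cong n (λ i j → sym (trans (∑-δ (A i) (opposite j)) (reflect i j))) ⟩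
    detℤ n (A ⊗ antidiagonal)                     ≡⟨ det-⊗ n A antidiagonal ⟩
    detℤ n A * detℤ n antidiagonal                ≡⟨ cong₂ _*_ det-A (det-antidiagonal (suc k)) ⟩
    (+ p) ^ k * signℤ (suc k)                     ≡⟨ ℤ.*-comm ((+ p) ^ k) (signℤ (suc k)) ⟩
    signℤ (suc k) * (+ p) ^ k                     ∎
    where
    open ≡-Reasoning
    minus-minus : ∀ a b → a - - b ≡ a + b
    minus-minus = solve-∀
    x-opposite : ∀ j → x (opposite j) ≡ - x j [mod + p ]
    x-opposite j = modulo (divides (+ 1) (begin
      x (opposite j) - - x j                         ≡⟨ minus-minus (x (opposite j)) (x j) ⟩
      + (suc (toℕ (opposite j)) ℕ.+ suc (toℕ j))     ≡⟨ cong (λ t → + (suc t ℕ.+ suc (toℕ j))) (Fin.opposite-prop j) ⟩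
      + suc (n ∸ suc (toℕ j) ℕ.+ suc (toℕ j))        ≡⟨ cong (+_ ∘ suc) (ℕ.m∸n+n≡m (Fin.toℕ<n j)) ⟩
      + p                                            ≡⟨ ℤ.*-identityˡ (+ p) ⟨
      + 1 * + p                                      ∎))
    reflect : ∀ i j → A i (opposite j) ≡ χ (x i + x j)
    reflect i j = trans (χ-periodic (mod-+ (mod-refl {a = x i}) (mod-neg (x-opposite j)))) (cong χ (minus-minus (x i) (x j)))

  -- From row 1 on these are the constant rows of the reduced matrix of H_p. Row 0 gives way to the
  -- argument of φ, but makes M a full matrix whose square is known.
  M : Fin p → Fin p → ℤ
  M i j = χ (+ toℕ i + + suc (toℕ j))

  φ : Vector ℤ p → ℤ
  φ v = detℤ p (v ◂ M ∘ fsuc)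

  private
    alternating : Alternating p (detℤ p)
    alternating = det-alternating p

  -- Rows from 1 on occur twice. Row 0 is minus the sum of the others, since every column of M is a
  -- complete sum of χ.
  φ-M : ∀ i → φ (M i) ≡ + 0
  φ-M (fsuc i) = repeated-head alternating (M (fsuc i)) (M ∘ fsuc) i (λ _ → refl)
  φ-M fzero    = dependent-rows alternating (M fzero ◂ M ∘ fsuc) (λ _ → - + 1) (λ i → i) (λ j →
    trans (a+b≡0⇒a≡-1*b (M fzero j) (∑[ i < n ] M (fsuc i) j) (trans (∑ₚ-shift χ-periodic (+ suc (toℕ j))) ∑χ≡0))
          (*-distribˡ-sum {n} (- + 1) (λ i → M (fsuc i) j)))

  -- M is symmetric, so this is M²; the left factor has t in front to fit `correlation-shift`.
  M⊗M : ∀ i j → ∑[ t < p ] (χ (+ toℕ t + + suc (toℕ i)) * M t j) ≡ + p * δ i j - + 1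
  M⊗M i j = begin
    ∑[ t < p ] (χ (+ toℕ t + + suc (toℕ i)) * M t j)      ≡⟨ correlation-shift (+ suc (toℕ i)) (+ suc (toℕ j)) ⟩
    correlation (+ suc (toℕ j) - + suc (toℕ i))           ≡⟨ cong correlation (cancel (+ toℕ j) (+ toℕ i)) ⟩
    correlation (+ toℕ j - + toℕ i)                       ≡⟨ correlation-δ ℕ.≤-refl i j ⟩
    + p * δ i j - + 1                                     ∎
    where
    open ≡-Reasoning
    cancel : ∀ a b → (+ 1 + a) - (+ 1 + b) ≡ a - b
    cancel = solve-∀

  -- Row i of M² is a combination of rows of M, so φ vanishes on it; it also equals p times `δ i`
  -- minus the all-ones vector.
  φ-δ : ∀ i → + p * φ (δ i) ≡ φ (λ _ → + 1)
  φ-δ i = ℤ.i-j≡0⇒i≡j (+ p * φ (δ i)) (φ (λ _ → + 1)) (begin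
    + p * φ (δ i) - φ (λ _ → + 1)                                   ≡⟨ cong₂ _+_ (sym (scale-head (+ p) (δ i) (M ∘ fsuc))) (sym (ℤ.-1*i≡-i (φ (λ _ → + 1)))) ⟩
    φ (λ j → + p * δ i j) + - + 1 * φ (λ _ → + 1)                   ≡⟨ lin (λ j → + p * δ i j) (- + 1) (λ _ → + 1) (M ∘ fsuc) ⟨
    φ (λ j → + p * δ i j + - + 1)                                   ≡⟨ ext-head (M ∘ fsuc) (M⊗M i) ⟨
    φ (λ j → ∑[ t < p ] (χ (+ toℕ t + + suc (toℕ i)) * M t j))      ≡⟨ sum-head (λ t → χ (+ toℕ t + + suc (toℕ i))) M (M ∘ fsuc) ⟩
    ∑[ t < p ] (χ (+ toℕ t + + suc (toℕ i)) * φ (M t))              ≡⟨ ∑-zero {p} (λ t → trans (cong (χ (+ toℕ t + + suc (toℕ i)) *_) (φ-M t)) (ℤ.*-zeroʳ (χ (+ toℕ t + + suc (toℕ i))))) ⟩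
    + 0                                                             ∎)
    where
    open ≡-Reasoning
    open Alt alternating

  -- The last column is the one with j + 1 ≡ 0 modulo p. Without it, and without row 0, both indices
  -- run through the nonzero residues.
  φ-δ-last : φ (δ (fromℕ n)) ≡ signℤ (suc k) * (+ p) ^ k
  φ-δ-last = begin
    φ (δ (fromℕ n))                                                ≡⟨ laplace-last n (δ (fromℕ n) ◂ M ∘ fsuc) (λ j → δ-≢ {i = fromℕ n} {inject₁ j} Fin.fromℕ≢inject₁) ⟩
    signℤ n * δ (fromℕ n) (fromℕ n) * detℤ n (λ i j → M (fsuc i) (inject₁ j))
      ≡⟨ cong₂ _*_ (cong₂ _*_ (signℤ-even (suc k)) (δ-refl (fromℕ n))) (det-cong n (λ i j → cong (λ t → χ (x i + + suc t)) (Fin.toℕ-inject₁ j))) ⟩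
    + 1 * detℤ n (λ i j → χ (x i + x j))                           ≡⟨ ℤ.*-identityˡ (detℤ n (λ i j → χ (x i + x j))) ⟩
    detℤ n (λ i j → χ (x i + x j))                                 ≡⟨ det-hankel-minor ⟩
    signℤ (suc k) * (+ p) ^ k                                      ∎
    where open ≡-Reasoning

  φ-sum : ∀ v → φ v ≡ signℤ (suc k) * (+ p) ^ k * sum v
  φ-sum v = begin
    φ v                                              ≡⟨ ext-head (M ∘ fsuc) (λ j → sym (∑-δ v j)) ⟩
    φ (λ j → ∑[ i < p ] (v i * δ i j))               ≡⟨ sum-head v δ (M ∘ fsuc) ⟩
    ∑[ i < p ] (v i * φ (δ i))                       ≡⟨ sum-cong-≗ {p} (λ i → cong (v i *_) (trans (same i) φ-δ-last)) ⟩
    ∑[ i < p ] (v i * c)                             ≡⟨ *-distribʳ-sum {p} c v ⟨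
    sum v * c                                        ≡⟨ ℤ.*-comm (sum v) c ⟩
    c * sum v                                        ∎
    where
    open ≡-Reasoning
    open Alt alternating
    c = signℤ (suc k) * (+ p) ^ k
    same : ∀ i → φ (δ i) ≡ φ (δ (fromℕ n))
    same i = ℤ.*-cancelˡ-≡ (+ p) (φ (δ i)) (φ (δ (fromℕ n))) (trans (φ-δ i) (sym (φ-δ (fromℕ n))))

-- Polynomials and their values

eval : Poly → ℤ → ℤ
eval []       t = + 0
eval (c ∷ cs) t = c + t * eval cs t

eval-+ₚ : ∀ P Q t → eval (P +ₚ Q) t ≡ eval P t + eval Q t
eval-+ₚ []       Q        t = sym (ℤ.+-identityˡ (eval Q t))
eval-+ₚ (c ∷ cs) []       t = sym (ℤ.+-identityʳ (c + t * eval cs t))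
eval-+ₚ (c ∷ cs) (d ∷ ds) t = trans (cong (λ z → c + d + t * z) (eval-+ₚ cs ds t)) (rearr c d t (eval cs t) (eval ds t))
  where
  rearr : ∀ c d t x y → c + d + t * (x + y) ≡ c + t * x + (d + t * y)
  rearr = solve-∀

eval-scaleₚ : ∀ a P t → eval (scaleₚ a P) t ≡ a * eval P t
eval-scaleₚ a []       t = sym (ℤ.*-zeroʳ a)
eval-scaleₚ a (c ∷ cs) t = trans (cong (λ z → a * c + t * z) (eval-scaleₚ a cs t)) (rearr a c t (eval cs t))
  where
  rearr : ∀ a c t x → a * c + t * (a * x) ≡ a * (c + t * x)
  rearr = solve-∀

eval-*ₚ : ∀ P Q t → eval (P *ₚ Q) t ≡ eval P t * eval Q t
eval-*ₚ []       Q t = sym (ℤ.*-zeroˡ (eval Q t))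
eval-*ₚ (c ∷ cs) Q t = begin
  eval (scaleₚ c Q +ₚ (+ 0 ∷ (cs *ₚ Q))) t            ≡⟨ eval-+ₚ (scaleₚ c Q) (+ 0 ∷ (cs *ₚ Q)) t ⟩
  eval (scaleₚ c Q) t + (+ 0 + t * eval (cs *ₚ Q) t)  ≡⟨ cong₂ (λ x y → x + (+ 0 + t * y)) (eval-scaleₚ c Q t) (eval-*ₚ cs Q t) ⟩
  c * eval Q t + (+ 0 + t * (eval cs t * eval Q t))   ≡⟨ rearr c (eval Q t) t (eval cs t) ⟩
  (c + t * eval cs t) * eval Q t                      ∎
  where
  open ≡-Reasoning
  rearr : ∀ c q t x → c * q + (+ 0 + t * (x * q)) ≡ (c + t * x) * q
  rearr = solve-∀

eval-sumFin : ∀ {n} (F : Fin n → Poly) t → eval (sumFin F) t ≡ ∑[ j < n ] eval (F j) t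
eval-sumFin {zero}  F t = refl
eval-sumFin {suc n} F t = trans (eval-+ₚ (F fzero) (sumFin (F ∘ fsuc)) t) (cong (_+_ (eval (F fzero) t)) (eval-sumFin (F ∘ fsuc) t))

eval-det : ∀ n (M : Fin n → Fin n → Poly) t → eval (det n M) t ≡ detℤ n (λ i j → eval (M i j) t)
eval-det zero    M t = trans (cong (_+_ (+ 1)) (ℤ.*-zeroʳ t)) refl
eval-det (suc n) M t = trans (eval-sumFin (λ j → scaleₚ (signℤ (toℕ j)) (M fzero j *ₚ det n (minor j))) t) (sum-cong-≗ {suc n} λ j → begin
  eval (scaleₚ (signℤ (toℕ j)) (M fzero j *ₚ det n (minor j))) t     ≡⟨ eval-scaleₚ (signℤ (toℕ j)) (M fzero j *ₚ det n (minor j)) t ⟩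
  signℤ (toℕ j) * eval (M fzero j *ₚ det n (minor j)) t              ≡⟨ cong (signℤ (toℕ j) *_) (trans (eval-*ₚ (M fzero j) (det n (minor j)) t) (cong (eval (M fzero j) t *_) (eval-det n (minor j) t))) ⟩
  signℤ (toℕ j) * (eval (M fzero j) t * detℤ n (λ i k → eval (minor j i k) t)) ≡⟨ ℤ.*-assoc (signℤ (toℕ j)) (eval (M fzero j) t) _ ⟨
  signℤ (toℕ j) * eval (M fzero j) t * detℤ n (λ i k → eval (minor j i k) t) ∎)
  where
  open ≡-Reasoning
  minor : Fin (suc n) → Fin n → Fin n → Poly
  minor j i k = M (fsuc i) (punchIn j k)

-- The case N = ∣ c - d ∣ gives c ≡ d modulo ∣ c - d ∣ + 1, hence c = d.
peel : ∀ c d (x y : ℕ → ℤ) → (∀ N → c + + suc N * x N ≡ d + + suc N * y N) → c ≡ d × (∀ N → x N ≡ y N)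
peel c d x y e = c≡d , λ N → ℤ.*-cancelˡ-≡ (+ suc N) (x N) (y N) (tails N)
  where
  N₀ = ∣ c - d ∣
  rearr : ∀ c d n x y → c - d ≡ n * (y - x) + ((c + n * x) - (d + n * y))
  rearr = solve-∀
  c≡d : c ≡ d
  c≡d = mod-small {N = + suc N₀} (ℕ.n<1+n N₀) (modulo (divides (y N₀ - x N₀)
    (trans (rearr c d (+ suc N₀) (x N₀) (y N₀)) (trans (cong (_+_ (+ suc N₀ * (y N₀ - x N₀))) (ℤ.i≡j⇒i-j≡0 (e N₀)))
      (trans (ℤ.+-identityʳ (+ suc N₀ * (y N₀ - x N₀))) (ℤ.*-comm (+ suc N₀) (y N₀ - x N₀)))))))
  drop : ∀ c u → u ≡ c + u - c
  drop = solve-∀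
  tails : ∀ N → + suc N * x N ≡ + suc N * y N
  tails N = trans (drop c (+ suc N * x N)) (trans (cong₂ _-_ (e N) c≡d) (sym (drop d (+ suc N * y N))))

-- Only positive arguments are passed on to the recursion: once the constant terms are known to
-- agree, the factor `suc N` in front of the tails can be cancelled.
≈ₚ-from-eval : ∀ P Q → (∀ t → eval P t ≡ eval Q t) → P ≈ₚ Q
≈ₚ-from-eval P Q e = from P Q (λ N → e (+ suc N))
  where
  zero-poly : ∀ t → + 0 ≡ + 0 + t * + 0
  zero-poly = solve-∀
  from : ∀ P Q → (∀ N → eval P (+ suc N) ≡ eval Q (+ suc N)) → P ≈ₚ Q
  from []       []       e k = refl
  from []       (d ∷ ds) e = at-head-and-tail (peel (+ 0) d (λ _ → + 0) (λ N → eval ds (+ suc N)) (λ N → trans (sym (zero-poly (+ suc N))) (e N)))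
    where
    at-head-and-tail : + 0 ≡ d × (∀ N → + 0 ≡ eval ds (+ suc N)) → [] ≈ₚ (d ∷ ds)
    at-head-and-tail (h , _) zero    = h
    at-head-and-tail (_ , t) (suc k) = from [] ds t k
  from (c ∷ cs) []       e = at-head-and-tail (peel c (+ 0) (λ N → eval cs (+ suc N)) (λ _ → + 0) (λ N → trans (e N) (zero-poly (+ suc N))))
    where
    at-head-and-tail : c ≡ + 0 × (∀ N → eval cs (+ suc N) ≡ + 0) → (c ∷ cs) ≈ₚ []
    at-head-and-tail (h , _) zero    = h
    at-head-and-tail (_ , t) (suc k) = from cs [] t k
  from (c ∷ cs) (d ∷ ds) e = at-head-and-tail (peel c d (λ N → eval cs (+ suc N)) (λ N → eval ds (+ suc N)) e)
    where
    at-head-and-tail : c ≡ d × (∀ N → eval cs (+ suc N) ≡ eval ds (+ suc N)) → (c ∷ cs) ≈ₚ (d ∷ ds)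
    at-head-and-tail (h , _) zero    = h
    at-head-and-tail (_ , t) (suc k) = from cs ds t k

-- Writing t = (t - a) + a in `c + t * eval cs t` shows that `cs + a Q` is the quotient, where Q is
-- that of `cs`.
synthetic-division : ∀ P a → ∃ λ Q → ∀ t → eval P t ≡ eval P a + (t - a) * eval Q t
synthetic-division []       a = [] , λ t → sym (trans (ℤ.+-identityˡ _) (ℤ.*-zeroʳ (t - a)))
synthetic-division (c ∷ cs) a with synthetic-division cs a
... | Q , e = cs +ₚ scaleₚ a Q , λ t → begin
  c + t * eval cs t                                                  ≡⟨ split c t a (eval cs t) ⟩
  c + (t - a) * eval cs t + a * eval cs t                            ≡⟨ cong (λ z → c + (t - a) * eval cs t + a * z) (e t) ⟩
  c + (t - a) * eval cs t + a * (eval cs a + (t - a) * eval Q t)     ≡⟨ collect c t a (eval cs t) (eval cs a) (eval Q t) ⟩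
  c + a * eval cs a + (t - a) * (eval cs t + a * eval Q t)           ≡⟨ cong (λ z → c + a * eval cs a + (t - a) * z) (trans (eval-+ₚ cs (scaleₚ a Q) t) (cong (_+_ (eval cs t)) (eval-scaleₚ a Q t))) ⟨
  c + a * eval cs a + (t - a) * eval (cs +ₚ scaleₚ a Q) t            ∎
  where
  open ≡-Reasoning
  split : ∀ c t a x → c + t * x ≡ c + (t - a) * x + a * x
  split = solve-∀
  collect : ∀ c t a x y q → c + (t - a) * x + a * (y + (t - a) * q) ≡ c + a * y + (t - a) * (x + a * q)
  collect = solve-∀

divide-by-X²-1 : ∀ P → eval P (+ 1) ≡ + 0 → eval P (- + 1) ≡ + 0 → ∃ λ Q → ∀ t → eval P t ≡ (t * t - + 1) * eval Q t
divide-by-X²-1 P P[1]≡0 P[-1]≡0 with synthetic-division P (+ 1)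
... | Q₁ , e₁ with synthetic-division Q₁ (- + 1)
...   | Q₂ , e₂ = Q₂ , λ t → begin
  eval P t                                                  ≡⟨ P≡ t ⟩
  (t - + 1) * eval Q₁ t                                     ≡⟨ cong ((t - + 1) *_) (trans (e₂ t) (cong (_+ (t - - + 1) * eval Q₂ t) Q₁[-1]≡0)) ⟩
  (t - + 1) * (+ 0 + (t - - + 1) * eval Q₂ t)               ≡⟨ expand t (eval Q₂ t) ⟩
  (t * t - + 1) * eval Q₂ t                                 ∎
  where
  open ≡-Reasoning
  expand : ∀ t q → (t - + 1) * (+ 0 + (t - - + 1) * q) ≡ (t * t - + 1) * q
  expand = solve-∀
  P≡ : ∀ t → eval P t ≡ (t - + 1) * eval Q₁ t
  P≡ t = trans (e₁ t) (trans (cong (_+ (t - + 1) * eval Q₁ t) P[1]≡0) (ℤ.+-identityˡ ((t - + 1) * eval Q₁ t)))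
  Q₁[-1]≡0 : eval Q₁ (- + 1) ≡ + 0
  -- At -1 the first linear factor takes the value -2, which can be cancelled.
  Q₁[-1]≡0 = ℤ.*-cancelˡ-≡ (- + 2) (eval Q₁ (- + 1)) (+ 0) (trans (sym (P≡ (- + 1))) P[-1]≡0)

horner : ℕ → (ℕ → ℤ) → ℤ → ℤ
horner zero    f t = + 0
horner (suc d) f t = f 0 + t * horner d (f ∘ suc) t

eval-map-applyUpTo : ∀ d (f : ℕ → ℤ) (g : ℕ → ℕ) t → eval (map f (applyUpTo g d)) t ≡ horner d (f ∘ g) t
eval-map-applyUpTo zero    f g t = refl
eval-map-applyUpTo (suc d) f g t = cong (λ z → f (g 0) + t * z) (eval-map-applyUpTo d f (g ∘ suc) t)

horner-cong : ∀ d {f g : ℕ → ℤ} t → (∀ m → f m ≡ g m) → horner d f t ≡ horner d g t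
horner-cong zero    t e = refl
horner-cong (suc d) t e = cong₂ (λ a b → a + t * b) (e 0) (horner-cong d t (e ∘ suc))

horner-∑ : ∀ d f t → horner d f t ≡ ∑[ i < d ] (f (toℕ i) * t ^ toℕ i)
horner-∑ zero    f t = refl
horner-∑ (suc d) f t = cong₂ _+_ (sym (ℤ.*-identityʳ (f 0)))
  (trans (cong (t *_) (horner-∑ d (f ∘ suc) t))
  (trans (*-distribˡ-sum {d} t (λ i → f (suc (toℕ i)) * t ^ toℕ i))
         (sum-cong-≗ {d} λ i → rearr t (f (suc (toℕ i))) (t ^ toℕ i))))
  where
  rearr : ∀ t a b → t * (a * b) ≡ a * (t * b)
  rearr = solve-∀

foldr-map-applyUpTo : ∀ d (f : ℕ → ℤ) (g : ℕ → ℕ) → foldr _+_ (+ 0) (map f (applyUpTo g d)) ≡ ∑[ i < d ] f (g (toℕ i))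
foldr-map-applyUpTo zero    f g = refl
foldr-map-applyUpTo (suc d) f g = cong (_+_ (f (g 0))) (foldr-map-applyUpTo d f (g ∘ suc))

-- Hankel matrices of the values of the a_k

module Hankel (J : ℕ → ℤ) (t : ℤ) where

  α : ℕ → ℤ
  α k = eval (fromCoeffs k (λ m → J (k ∸ m))) t

  α-horner : ∀ k → α k ≡ horner (suc k) (λ m → J (k ∸ m)) t
  α-horner k = eval-map-applyUpTo (suc k) (λ m → J (k ∸ m)) (λ m → m) t

  α-suc : ∀ k → α (suc k) ≡ J (suc k) + t * α k
  α-suc k = trans (α-horner (suc k)) (cong (λ z → J (suc k) + t * z) (sym (α-horner k)))

  J-row : ∀ {n} → Fin n → Vector ℤ (suc n)
  J-row i j = J (suc (suc (toℕ i ℕ.+ toℕ j)))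

  reduced : ∀ n → detℤ (suc n) (λ i j → α (suc (toℕ i ℕ.+ toℕ j))) ≡ detℤ (suc n) ((λ j → α (suc (toℕ j))) ◂ J-row)
  reduced n = trans (det-cong (suc n) (◂-η R))
    -- The first row is held fixed; being killed by the remaining form, it is the row that precedes
    -- the second.
    (subtract-preceding n (Alt.rest alternating (R fzero)) (λ S k → repeated-head alternating (R fzero) S k) t (R ∘ fsuc) J-row
      λ i j → trans (α-suc (suc (toℕ i ℕ.+ toℕ j)))
                    (cong (λ z → J (suc (suc (toℕ i ℕ.+ toℕ j))) + t * z)
                      (trans (cong (λ l → α (suc (l ℕ.+ toℕ j))) (sym (Fin.toℕ-inject₁ i))) (◂-η R (inject₁ i) j))))
    where
    alternating = det-alternating (suc n)
    R : Matrix (suc n) (suc n)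
    R i j = α (suc (toℕ i ℕ.+ toℕ j))

  -- Origin of the b_k. Summing the recursion gives S(q + 1) = Σ J + t (α 0 + S(q)) with `α 0` equal
  -- to 0, which is the Horner scheme with partial sums of J as coefficients.
  ∑-α : J 0 ≡ + 0 → ∀ q → ∑[ j < q ] α (suc (toℕ j)) ≡ horner q (λ m → ∑[ i < q ∸ m ] J (suc (toℕ i))) t
  ∑-α J0 zero    = refl
  ∑-α J0 (suc q) = begin
    ∑[ j < suc q ] α (suc (toℕ j))                                          ≡⟨ sum-cong-≗ {suc q} (λ j → α-suc (toℕ j)) ⟩
    ∑[ j < suc q ] (J (suc (toℕ j)) + t * α (toℕ j))                        ≡⟨ ∑-lin {suc q} (λ j → J (suc (toℕ j))) (λ j → α (toℕ j)) t ⟩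
    ∑[ j < suc q ] J (suc (toℕ j)) + t * (α 0 + ∑[ j < q ] α (suc (toℕ j))) ≡⟨ cong₂ (λ a b → ∑[ j < suc q ] J (suc (toℕ j)) + t * (a + b)) α0 (∑-α J0 q) ⟩
    ∑[ j < suc q ] J (suc (toℕ j)) + t * (+ 0 + horner q (λ m → ∑[ i < q ∸ m ] J (suc (toℕ i))) t)
      ≡⟨ cong (λ z → ∑[ j < suc q ] J (suc (toℕ j)) + t * z) (ℤ.+-identityˡ _) ⟩
    horner (suc q) (λ m → ∑[ i < suc q ∸ m ] J (suc (toℕ i))) t             ∎
    where
    open ≡-Reasoning
    α0 : α 0 ≡ + 0
    α0 = trans (cong₂ _+_ J0 (ℤ.*-zeroʳ t)) refl

-- Composite n

legendre-periodic : ∀ {a b} p .{{_ : ℕ.NonZero p}} → + a ≡ + b [mod + p ] → legendre a p ≡ legendre b p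
legendre-periodic {a} {b} p e = trans (legendre-% a p) (trans (cong (legendreOf p) (mod⇒% p e)) (sym (legendre-% b p)))

-- The Jacobi symbol for an explicit list of prime factors, so that one of them can be split off.
jacobiOf : List ℕ → ℕ → ℤ
jacobiOf qs a = foldr _*_ (+ 1) (map (legendre a) qs)

jacobiOf-periodic : ∀ {qs a b} → All Prime qs → + a ≡ + b [mod + product qs ] → jacobiOf qs a ≡ jacobiOf qs b
jacobiOf-periodic {[]}     []         e = refl
jacobiOf-periodic {q ∷ qs} (pr ∷ prs) e = cong₂ _*_
  (legendre-periodic q {{prime⇒nonZero pr}} (mod-weaken (+ product (q ∷ qs)) (divides (+ product qs) (trans (ℤ.pos-* q (product qs)) (ℤ.*-comm (+ q) (+ product qs)))) e))
  (jacobiOf-periodic prs (mod-weaken (+ product (q ∷ qs)) (divides (+ q) (ℤ.pos-* q (product qs))) e))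

odd-form : ∀ n → n % 2 ≡ 1 → n ≡ suc (n / 2 ℕ.* 2)
odd-form n e = trans (m≡m%n+[m/n]*n n 2) (cong (ℕ._+ n / 2 ℕ.* 2) e)

odd-divisor : ∀ {q n} → q ℕDiv.∣ n → n % 2 ≡ 1 → q % 2 ≡ 1
odd-divisor {q} {n} q∣n odd with q % 2 in eq | m%n<n q 2
... | 0 | _ = ⊥-elim (ℕ.1+n≢0 (trans (sym odd) (ℕDiv.n∣m⇒m%n≡0 n 2 (ℕDiv.∣-trans (ℕDiv.m%n≡0⇒n∣m q 2 eq) q∣n))))
... | 1 | _ = refl
... | suc (suc _) | s≤s (s≤s ())

-- A composite n is written as (1 + 2m)(1 + c) with 1 + 2m prime; the last rows, of entries J(2 + i + j), are dependent.
module CompositeRows (m c l : ℕ) (prime : Prime (suc (m ℕ.* 2))) (0<c : 0 ℕ.< c) (size : 2 ℕ.+ l ≡ suc (m ℕ.* 2) ℕ.* suc c)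
                     (qs : List ℕ) (primes : All Prime qs) (product≡ : product qs ≡ suc c) (t : ℤ) where
  open LegendreSymbol m prime

  J : ℕ → ℤ
  J = jacobiOf (p ∷ qs)

  open Hankel J t

  J-split : ∀ a → J a ≡ χ (+ a) * jacobiOf qs a
  J-split a = cong (_* jacobiOf qs a) (legendre≡χ a)

  shift : ℕ → ℕ
  shift s = suc s ℕ.* suc c

  +-shift : ∀ s a → + (shift s ℕ.+ a) ≡ + suc s * + suc c + + a
  +-shift s a = trans (ℤ.pos-+ (shift s) a) (cong (_+ + a) (ℤ.pos-* (suc s) (suc c)))

  rest-periodic : ∀ s a → jacobiOf qs (shift s ℕ.+ a) ≡ jacobiOf qs a
  rest-periodic s a = jacobiOf-periodic primes (modulo (divides (+ suc s) (begin
    + (shift s ℕ.+ a) - + a                   ≡⟨ cong (_- + a) (+-shift s a) ⟩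
    + suc s * + suc c + + a - + a             ≡⟨ cancel (+ suc s * + suc c) (+ a) ⟩
    + suc s * + suc c                         ≡⟨ cong (λ k → + suc s * + k) product≡ ⟨
    + suc s * + product qs                    ∎)))
    where
    open ≡-Reasoning
    cancel : ∀ a b → a + b - b ≡ a
    cancel = solve-∀

  -- There are only n - 1 constant rows, and the largest shift is 2m (c + 1) = n - (c + 1). It fits
  -- because c is positive; for c = 0, that is for n prime, the last row needed would be missing.
  τ-bound : ∀ s → s ℕ.< m ℕ.* 2 → c ℕ.+ s ℕ.* suc c ℕ.< l
  τ-bound s s<2m = ℕ.+-cancelˡ-≤ 2 (shift s) l (begin
    2 ℕ.+ shift s                        ≤⟨ ℕ.+-monoˡ-≤ (shift s) (s≤s 0<c) ⟩
    suc c ℕ.+ shift s                    ≤⟨ ℕ.*-monoˡ-≤ (suc c) (s≤s s<2m) ⟩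
    suc (m ℕ.* 2) ℕ.* suc c              ≡⟨ size ⟨
    2 ℕ.+ l                              ∎)
    where open ℕ.≤-Reasoning

  τ : Fin (m ℕ.* 2) → Fin l
  τ s = Fin.fromℕ< (τ-bound (toℕ s) (Fin.toℕ<n s))

  row-τ : ∀ s (j : Fin (2 ℕ.+ l)) → J-row (fsuc (τ s)) j ≡ J (shift (toℕ s) ℕ.+ (2 ℕ.+ toℕ j))
  row-τ s j = trans (cong (λ i → J (3 ℕ.+ (i ℕ.+ toℕ j))) (Fin.toℕ-fromℕ< (τ-bound (toℕ s) (Fin.toℕ<n s))))
                    (cong J (rearr (c ℕ.+ toℕ s ℕ.* suc c) (toℕ j)))
    where
    rearr : ∀ a b → 3 ℕ.+ (a ℕ.+ b) ≡ suc a ℕ.+ (2 ℕ.+ b)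
    rearr a b = cong suc (trans (cong suc (sym (ℕ.+-suc a b))) (sym (ℕ.+-suc a (suc b))))

  vanishes : ∀ v → detℤ (2 ℕ.+ l) (v ◂ J-row) ≡ + 0
  vanishes v = cases (mod? (+ suc c) (+ 0) p)
    where
    open ≡-Reasoning
    alternating = Alt.rest (det-alternating (2 ℕ.+ l)) v
    cases : Dec (+ suc c ≡ + 0 [mod + p ]) → detℤ (2 ℕ.+ l) (v ◂ J-row) ≡ + 0
    cases (yes c+1≡0) = dependent-rows alternating J-row (λ _ → + 1) (λ (_ : Fin 1) → τ first) λ j → begin
      J (2 ℕ.+ toℕ j)                                  ≡⟨ same (2 ℕ.+ toℕ j) ⟨
      J (shift 0 ℕ.+ (2 ℕ.+ toℕ j))                    ≡⟨ cong (λ s → J (shift s ℕ.+ (2 ℕ.+ toℕ j))) (Fin.toℕ-fromℕ< 0<2m) ⟨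
      J (shift (toℕ first) ℕ.+ (2 ℕ.+ toℕ j))          ≡⟨ row-τ first j ⟨
      J-row (fsuc (τ first)) j                         ≡⟨ ℤ.*-identityˡ (J-row (fsuc (τ first)) j) ⟨
      + 1 * J-row (fsuc (τ first)) j                   ≡⟨ ℤ.+-identityʳ (+ 1 * J-row (fsuc (τ first)) j) ⟨
      + 1 * J-row (fsuc (τ first)) j + + 0             ∎
      where
      0<2m : 0 ℕ.< m ℕ.* 2
      0<2m = ℕ.s≤s⁻¹ 1<p
      first : Fin (m ℕ.* 2)
      first = Fin.fromℕ< 0<2m
      same : ∀ a → J (shift 0 ℕ.+ a) ≡ J a
      same a = trans (J-split (shift 0 ℕ.+ a)) (trans (cong₂ _*_ (χ-periodic z) (rest-periodic 0 a)) (sym (J-split a)))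
        where
        z : + (shift 0 ℕ.+ a) ≡ + a [mod + p ]
        z = mod-trans (mod-reflexive (+-shift 0 a)) (mod-trans (mod-+ (mod-* (mod-refl {a = + 1}) c+1≡0) (mod-refl {a = + a})) (mod-reflexive (ℤ.+-identityˡ (+ a))))
    cases (no c+1≢0) = dependent-rows alternating J-row (λ _ → - + 1) τ λ j →
      let a = 2 ℕ.+ toℕ j in
      trans (a+b≡0⇒a≡-1*b (J a) (∑[ s < m ℕ.* 2 ] J-row (fsuc (τ s)) j) (begin
        J a + ∑[ s < m ℕ.* 2 ] J-row (fsuc (τ s)) j
          ≡⟨ cong₂ _+_ (J-split a) (sum-cong-≗ {m ℕ.* 2} λ s → trans (row-τ s j) (trans (J-split (shift (toℕ s) ℕ.+ a)) (cong₂ _*_ (cong χ (regroup (toℕ s) a)) (rest-periodic (toℕ s) a)))) ⟩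
        χ (+ a) * jacobiOf qs a + ∑[ s < m ℕ.* 2 ] (χ (+ suc c * + suc (toℕ s) + + a) * jacobiOf qs a)
          -- The leading row is the term s = 0, which completes the sum to all residues modulo p.
          ≡⟨ cong (λ z → χ z * jacobiOf qs a + ∑[ s < m ℕ.* 2 ] (χ (+ suc c * + suc (toℕ s) + + a) * jacobiOf qs a)) (trans (cong (_+ + a) (ℤ.*-zeroʳ (+ suc c))) (ℤ.+-identityˡ (+ a))) ⟨
        ∑[ s < p ] (χ (+ suc c * + toℕ s + + a) * jacobiOf qs a)
          ≡⟨ *-distribʳ-sum {p} (jacobiOf qs a) (λ s → χ (+ suc c * + toℕ s + + a)) ⟨
        ∑ₚ (λ s → χ (+ suc c * s + + a)) * jacobiOf qs a
          ≡⟨ cong (_* jacobiOf qs a) (trans (∑ₚ-scale {λ s → χ (s + + a)} (λ e → χ-periodic (mod-+ e mod-refl)) (+ suc c) c+1≢0) (trans (∑ₚ-shift χ-periodic (+ a)) ∑χ≡0)) ⟩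
        + 0 * jacobiOf qs a
          ≡⟨ ℤ.*-zeroˡ (jacobiOf qs a) ⟩
        + 0 ∎))
        (*-distribˡ-sum {m ℕ.* 2} (- + 1) (λ s → J-row (fsuc (τ s)) j))
      where
      regroup : ∀ s a → + (shift s ℕ.+ a) ≡ + suc c * + suc s + + a
      regroup s a = trans (+-shift s a) (cong (_+ + a) (ℤ.*-comm (+ suc s) (+ suc c)))

eval-H : ∀ n t → let open Hankel (λ a → jacobi a (suc n)) t in
         eval (H (suc n)) t ≡ detℤ (suc n) ((λ j → α (suc (toℕ j))) ◂ J-row)
eval-H n t = trans (eval-det (suc n) (λ i j → aPoly (suc n) (suc (toℕ i ℕ.+ toℕ j))) t) (Hankel.reduced (λ a → jacobi a (suc n)) t n)

factored-vanishes : ∀ l → suc (suc l) % 2 ≡ 1 → ¬ Prime (suc (suc l)) → ∀ fs → suc (suc l) ≡ product fs → All Prime fs →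
                    ∀ t v → detℤ (suc (suc l)) (v ◂ Hankel.J-row (jacobiOf fs) t) ≡ + 0
factored-vanishes l odd ¬prime []       e _         t v = ⊥-elim (ℕ.1+n≢0 (ℕ.suc-injective e))
factored-vanishes l odd ¬prime (q ∷ []) e (pr ∷ []) t v = ⊥-elim (¬prime (subst Prime (trans (sym (ℕ.*-identityʳ q)) (sym e)) pr))
factored-vanishes l odd ¬prime (q ∷ r ∷ rs) e (pr ∷ rp ∷ rps) t v = from (q / 2) q≡ pr (product (r ∷ rs)) refl e
  where
  q≡ : q ≡ suc (q / 2 ℕ.* 2)
  q≡ = odd-form q (odd-divisor (ℕDiv.divides (product (r ∷ rs)) (trans e (ℕ.*-comm q (product (r ∷ rs))))) odd)
  -- The prime and its cofactor are generalised to variables, so that they can be matched with the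
  -- forms 1 + 2m and 1 + c.
  from : ∀ {q} m → q ≡ suc (m ℕ.* 2) → Prime q → ∀ d → product (r ∷ rs) ≡ d → suc (suc l) ≡ q ℕ.* d →
         detℤ (suc (suc l)) (v ◂ Hankel.J-row (jacobiOf (q ∷ r ∷ rs)) t) ≡ + 0
  from {q} m _ _ zero    _  e = ⊥-elim (ℕ.1+n≢0 (trans e (ℕ.*-zeroʳ q)))
  from m refl pr (suc c) eq e = CompositeRows.vanishes m c l pr 0<c e (r ∷ rs) (rp ∷ rps) eq t v
    where
    0<c : 0 ℕ.< c
    0<c = ℕ.s≤s⁻¹ (ℕ.≤-trans (ℕ.nonTrivial⇒n>1 r {{prime⇒nonTrivial rp}})
                              (ℕDiv.∣⇒≤ (ℕDiv.divides (product rs) (trans (sym eq) (ℕ.*-comm r (product rs))))))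

composite-vanishes : ∀ l → suc (suc l) % 2 ≡ 1 → ¬ Prime (suc (suc l)) → ∀ t → eval (H (suc (suc l))) t ≡ + 0
composite-vanishes l odd ¬prime t = trans (eval-H (suc l) t)
  (factored-vanishes l odd ¬prime (factors (factorise (suc (suc l)))) (isFactorisation (factorise (suc (suc l)))) (factorsPrime (factorise (suc (suc l)))) t
    (λ j → Hankel.α (λ a → jacobi a (suc (suc l))) t (suc (toℕ j))))

-- Prime n

module PrimeCase (k : ℕ) (prime : Prime (suc (suc k ℕ.* 2))) where
  open LegendreSymbol (suc k) prime
  open Paley k prime

  c : ℤ
  c = signℤ (suc k) * (+ p) ^ k

  jacobi≡χ : ∀ a → jacobi a p ≡ χ (+ a)
  jacobi≡χ a = trans (cong (λ fs → jacobiOf fs a) (↭-singleton-inv (factorisationUnique (factorise p) (primeFactorisation[p] prime))))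
                     (trans (ℤ.*-identityʳ (legendre a p)) (legendre≡χ a))

  β : ℕ → ℤ
  β d = ∑[ i < d ] χ (+ suc (toℕ i))

  bCoeff≡β : ∀ m → bCoeff p m ≡ β (p ∸ m)
  bCoeff≡β m = trans (foldr-map-applyUpTo (p ∸ m) (λ i → legendre (suc i) p) (λ i → i))
                     (sum-cong-≗ {p ∸ m} λ i → legendre≡χ (suc (toℕ i)))

  eval-H-prime : ∀ t → eval (H p) t ≡ c * horner p (bCoeff p) t
  eval-H-prime t = begin
    eval (H p) t                            ≡⟨ eval-H n t ⟩
    detℤ p (first ◂ J-row)                  ≡⟨ det-cong p rows ⟩
    φ first                                 ≡⟨ φ-sum first ⟩
    c * sum first                           ≡⟨ cong (c *_) (∑-α (trans (jacobi≡χ 0) (χ-0 {+ 0} mod-refl)) p) ⟩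
    c * horner p (λ m → ∑[ i < p ∸ m ] jacobi (suc (toℕ i)) p) t
                                            ≡⟨ cong (c *_) (horner-cong p t λ m → trans (sum-cong-≗ {p ∸ m} λ i → jacobi≡χ (suc (toℕ i))) (sym (bCoeff≡β m))) ⟩
    c * horner p (bCoeff p) t               ∎
    where
    open ≡-Reasoning
    open Hankel (λ a → jacobi a p) t
    first : Vector ℤ p
    first j = α (suc (toℕ j))
    rows : (first ◂ J-row) ≐ (first ◂ M ∘ fsuc)
    rows fzero    j = refl
    rows (fsuc i) j = trans (jacobi≡χ (suc (suc (toℕ i ℕ.+ toℕ j)))) (cong (λ l → χ (+ suc l)) (sym (ℕ.+-suc (toℕ i) (toℕ j))))

  -- This is b_1 = 0, and `β-p≡0` is b_0 = 0: together they yield the factor x².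
  β-n≡0 : β n ≡ + 0
  β-n≡0 = ∑χx≡0

  β-p≡0 : β p ≡ + 0
  β-p≡0 = trans (sum-cong-≗ {p} λ i → cong χ (ℤ.+-comm (+ 1) (+ toℕ i))) (trans (∑ₚ-shift χ-periodic (+ 1)) ∑χ≡0)

  -- The sum of the b_k x^k with the factor x² removed.
  B : Poly
  B = map (λ m → bCoeff p (2 ℕ.+ m)) (upTo (suc (k ℕ.* 2)))

  eval-H-B : ∀ t → eval (H p) t ≡ t * t * (c * eval B t)
  eval-H-B t = begin
    eval (H p) t                                          ≡⟨ eval-H-prime t ⟩
    c * (bCoeff p 0 + t * (bCoeff p 1 + t * rest))        ≡⟨ cong₂ (λ x y → c * (x + t * (y + t * rest))) (trans (bCoeff≡β 0) β-p≡0) (trans (bCoeff≡β 1) β-n≡0) ⟩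
    c * (+ 0 + t * (+ 0 + t * rest))                      ≡⟨ rearr c t rest ⟩
    t * t * (c * rest)                                    ≡⟨ cong (λ z → t * t * (c * z)) (eval-map-applyUpTo (suc (k ℕ.* 2)) (λ m → bCoeff p (2 ℕ.+ m)) (λ m → m) t) ⟨
    t * t * (c * eval B t)                                ∎
    where
    open ≡-Reasoning
    rest = horner (suc (k ℕ.* 2)) (λ m → bCoeff p (2 ℕ.+ m)) t
    rearr : ∀ c t r → c * (+ 0 + t * (+ 0 + t * r)) ≡ t * t * (c * r)
    rearr = solve-∀

  β-suc : ∀ d → β (suc d) ≡ β d + χ (+ suc d)
  β-suc d = trans (sum-init-last {d} (λ i → χ (+ suc (toℕ i))))
    (cong₂ _+_ (sum-cong-≗ {d} λ i → cong (λ l → χ (+ suc l)) (Fin.toℕ-inject₁ i)) (cong (λ l → χ (+ suc l)) (Fin.toℕ-fromℕ d)))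

  module Even (ε≡1 : ε ≡ + 1) where

    χ-reflect : ∀ a b → a ℕ.+ b ≡ p → χ (+ a) ≡ χ (+ b)
    χ-reflect a b e = begin
      χ (+ a)        ≡⟨ χ-periodic {+ a} { - + b} (modulo (divides (+ 1) (trans (minus-minus (+ a) (+ b)) (trans (cong +_ e) (sym (ℤ.*-identityˡ (+ p))))))) ⟩
      χ (- + b)      ≡⟨ χ-neg (+ b) ⟩
      ε * χ (+ b)    ≡⟨ trans (cong (_* χ (+ b)) ε≡1) (ℤ.*-identityˡ (χ (+ b))) ⟩
      χ (+ b)        ∎
      where
      open ≡-Reasoning
      minus-minus : ∀ a b → a - - b ≡ a + b
      minus-minus = solve-∀

    -- The sum over all n nonzero residues is 0, and its last b terms mirror the first b because χ(p
    -- - i) = χ(i). The induction moves one term at a time across the cut.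
    β-reflect : ∀ b a → a ℕ.+ b ≡ n → β a ≡ - β b
    β-reflect zero    a e = trans (cong β (trans (sym (ℕ.+-identityʳ a)) e)) β-n≡0
    β-reflect (suc b) a e = begin
      β a                                  ≡⟨ cancel (β a) (χ (+ suc a)) ⟩
      (β a + χ (+ suc a)) - χ (+ suc a)    ≡⟨ cong₂ _-_ (trans (sym (β-suc a)) (β-reflect b (suc a) (trans (sym (ℕ.+-suc a b)) e)))
                                                        (χ-reflect (suc a) (suc b) (cong suc e)) ⟩
      - β b - χ (+ suc b)                  ≡⟨ ℤ.neg-distrib-+ (β b) (χ (+ suc b)) ⟨
      - (β b + χ (+ suc b))                ≡⟨ cong -_ (β-suc b) ⟨
      - β (suc b)                          ∎
      where
      open ≡-Reasoning
      cancel : ∀ a b → a ≡ (a + b) - b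
      cancel = solve-∀

    -- The coefficients of B are antisymmetric under reversal.
    B-root : ∀ t → t * t ≡ + 1 → eval B t ≡ + 0
    B-root t t²≡1 = trans (trans (eval-map-applyUpTo r (λ m → bCoeff p (2 ℕ.+ m)) (λ m → m) t) (horner-∑ r (λ m → bCoeff p (2 ℕ.+ m)) t))
      (x≡-x⇒x≡0 (trans (sum-permute h (reverse {r})) (trans (sum-cong-≗ {r} antisymmetric) (∑-neg h))))
      where
      open ≡-Reasoning
      r = suc (k ℕ.* 2)
      h : Fin r → ℤ
      h i = bCoeff p (2 ℕ.+ toℕ i) * t ^ toℕ i
      reversal : ∀ (i : Fin r) → toℕ (opposite i) ℕ.+ toℕ i ≡ k ℕ.* 2
      reversal i = trans (cong (ℕ._+ toℕ i) (Fin.opposite-prop i)) (ℕ.m∸n+n≡m (Fin.toℕ≤pred[n] i))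
      -- The two exponents add up to the even number 2k, so their powers agree at -1 as well as at
      -- 1.
      powers : ∀ (i : Fin r) → t ^ toℕ (opposite i) ≡ t ^ toℕ i
      powers i = begin
        t ^ o                            ≡⟨ ℤ.*-identityʳ (t ^ o) ⟨
        t ^ o * + 1                      ≡⟨ cong (t ^ o *_) (square (toℕ i)) ⟨
        t ^ o * (t ^ l * t ^ l)          ≡⟨ ℤ.*-assoc (t ^ o) (t ^ l) (t ^ l) ⟨
        t ^ o * t ^ l * t ^ l            ≡⟨ cong (_* t ^ l) (trans (sym (ℤ.^-distribˡ-+-* t o l)) (trans (cong (t ^_) (reversal i)) (trans (^-double t k) (square k)))) ⟩
        + 1 * t ^ l                      ≡⟨ ℤ.*-identityˡ (t ^ l) ⟩
        t ^ l                            ∎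
        where
        o = toℕ (opposite i)
        l = toℕ i
        square : ∀ j → t ^ j * t ^ j ≡ + 1
        square j = trans (sym (^-distrib-* t t j)) (trans (cong (_^ j) t²≡1) (ℤ.^-zeroˡ j))
      coefficients : ∀ (i : Fin r) → bCoeff p (2 ℕ.+ toℕ (opposite i)) ≡ - bCoeff p (2 ℕ.+ toℕ i)
      coefficients i = begin
        bCoeff p (2 ℕ.+ toℕ (opposite i))      ≡⟨ bCoeff≡β (2 ℕ.+ toℕ (opposite i)) ⟩
        β (r ∸ toℕ (opposite i))               ≡⟨ β-reflect (r ∸ toℕ i) (r ∸ toℕ (opposite i)) total ⟩
        - β (r ∸ toℕ i)                        ≡⟨ cong -_ (bCoeff≡β (2 ℕ.+ toℕ i)) ⟨
        - bCoeff p (2 ℕ.+ toℕ i)               ∎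
        where
        o = toℕ (opposite i)
        l = toℕ i
        -- Since o + l = 2k, the two lengths add up to 2(2k + 1) - 2k = 2k + 2 = n, as `β-reflect`
        -- demands.
        total : r ∸ o ℕ.+ (r ∸ l) ≡ n
        total = ℕ.+-cancelʳ-≡ (k ℕ.* 2) (r ∸ o ℕ.+ (r ∸ l)) n (begin
          r ∸ o ℕ.+ (r ∸ l) ℕ.+ k ℕ.* 2         ≡⟨ cong (r ∸ o ℕ.+ (r ∸ l) ℕ.+_) (reversal i) ⟨
          r ∸ o ℕ.+ (r ∸ l) ℕ.+ (o ℕ.+ l)       ≡⟨ interchange (r ∸ o) (r ∸ l) o l ⟩
          (r ∸ o ℕ.+ o) ℕ.+ (r ∸ l ℕ.+ l)       ≡⟨ cong₂ ℕ._+_ (ℕ.m∸n+n≡m (ℕ.<⇒≤ (Fin.toℕ<n (opposite i)))) (ℕ.m∸n+n≡m (ℕ.<⇒≤ (Fin.toℕ<n i))) ⟩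
          r ℕ.+ r                               ≡⟨ ℕ.+-suc r (k ℕ.* 2) ⟩
          n ℕ.+ k ℕ.* 2                         ∎)
          where
          interchange : ∀ a b c d → a ℕ.+ b ℕ.+ (c ℕ.+ d) ≡ (a ℕ.+ c) ℕ.+ (b ℕ.+ d)
          interchange = ℕRing.solve-∀
      antisymmetric : ∀ i → h (opposite i) ≡ - h i
      antisymmetric i = trans (cong₂ _*_ (coefficients i) (powers i)) (sym (ℤ.neg-distribˡ-* (bCoeff p (2 ℕ.+ toℕ i)) (t ^ toℕ i)))

    ∃-quotient : ∃ λ Q → ∀ t → eval B t ≡ (t * t - + 1) * eval Q t
    ∃-quotient = divide-by-X²-1 B (B-root (+ 1) refl) (B-root (- + 1) refl)

  formula : H p ≈ₚ constₚ (signℤ ((p ∸ 1) / 2) * (+ p) ^ ((p ∸ 3) / 2)) *ₚ fromCoeffs (p ∸ 1) (bCoeff p)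
  formula = ≈ₚ-from-eval (H p) (constₚ d *ₚ fromCoeffs n (bCoeff p)) λ t → begin
    eval (H p) t                                                ≡⟨ eval-H-prime t ⟩
    c * horner p (bCoeff p) t                                   ≡⟨ cong₂ _*_ (c≡ t) (eval-map-applyUpTo p (bCoeff p) (λ m → m) t) ⟨
    eval (constₚ d) t * eval (fromCoeffs n (bCoeff p)) t         ≡⟨ eval-*ₚ (constₚ d) (fromCoeffs n (bCoeff p)) t ⟨
    eval (constₚ d *ₚ fromCoeffs n (bCoeff p)) t                ∎
    where
    open ≡-Reasoning
    d = signℤ ((p ∸ 1) / 2) * (+ p) ^ ((p ∸ 3) / 2)
    c≡ : ∀ t → d + t * + 0 ≡ c
    c≡ t = trans (trans (cong (_+_ d) (ℤ.*-zeroʳ t)) (ℤ.+-identityʳ d)) (cong₂ (λ a b → signℤ a * (+ p) ^ b) (m*n/n≡m (suc k) 2) (m*n/n≡m k 2))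

  eval-const : ∀ a t → eval (constₚ a) t ≡ a
  eval-const a t = trans (cong (_+_ a) (ℤ.*-zeroʳ t)) (ℤ.+-identityʳ a)

  eval-X² : ∀ t → eval (X *ₚ X) t ≡ t * t
  eval-X² t = trans (eval-*ₚ X X t) (simp t)
    where
    simp : ∀ t → (+ 0 + t * (+ 1 + t * + 0)) * (+ 0 + t * (+ 1 + t * + 0)) ≡ t * t
    simp = solve-∀

  X²∣H : (X *ₚ X) ∣ₚ H p
  X²∣H = constₚ c *ₚ B , ≈ₚ-from-eval (H p) (X *ₚ X *ₚ (constₚ c *ₚ B)) λ t →
    trans (eval-H-B t) (sym (trans (eval-*ₚ (X *ₚ X) (constₚ c *ₚ B) t)
      (cong₂ _*_ (eval-X² t) (trans (eval-*ₚ (constₚ c) B t) (cong (_* eval B t) (eval-const c t))))))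

  X²[X²-1]∣H : ε ≡ + 1 → (X *ₚ X *ₚ (X *ₚ X +ₚ constₚ (- + 1))) ∣ₚ H p
  X²[X²-1]∣H ε≡1 = from (Even.∃-quotient ε≡1)
    where
    D = X *ₚ X *ₚ (X *ₚ X +ₚ constₚ (- + 1))
    eval-D : ∀ t → eval D t ≡ t * t * (t * t - + 1)
    eval-D t = trans (eval-*ₚ (X *ₚ X) (X *ₚ X +ₚ constₚ (- + 1)) t)
      (cong₂ _*_ (eval-X² t) (trans (eval-+ₚ (X *ₚ X) (constₚ (- + 1)) t) (cong₂ _+_ (eval-X² t) (eval-const (- + 1) t))))
    rearr : ∀ t u c q → t * (c * (u * q)) ≡ t * u * (c * q)
    rearr = solve-∀
    from : (∃ λ Q → ∀ t → eval B t ≡ (t * t - + 1) * eval Q t) → D ∣ₚ H p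
    from (Q , e) = constₚ c *ₚ Q , ≈ₚ-from-eval (H p) (D *ₚ (constₚ c *ₚ Q)) λ t →
      trans (eval-H-B t) (trans (cong (λ z → t * t * (c * z)) (e t)) (trans (rearr (t * t) (t * t - + 1) c (eval Q t))
        (sym (trans (eval-*ₚ D (constₚ c *ₚ Q) t)
          (cong₂ _*_ (eval-D t) (trans (eval-*ₚ (constₚ c) Q t) (cong (_* eval Q t) (eval-const c t))))))))

-- The hypothesis makes m even: the recursion goes in steps of two, and m = 1 is refuted by
-- computing 3 modulo 4.
signℤ≡1 : ∀ m → suc (m ℕ.* 2) % 4 ≡ 1 → signℤ m ≡ + 1
signℤ≡1 zero          e = refl
signℤ≡1 (suc (suc m)) e = trans (ℤ.neg-involutive (signℤ m)) (signℤ≡1 m e)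

theorem1 : (n : ℕ) → n % 2 ≡ 1 → 3 ≤ n →
    (¬ Prime n → H n ≈ₚ zeroₚ) ×
    (Prime n →
    (H n ≈ₚ constₚ (signℤ ((n ∸ 1) / 2) * (+ n) ^ ((n ∸ 3) / 2)) *ₚ fromCoeffs (n ∸ 1) (bCoeff n))
    × (n % 4 ≡ 3 → (X *ₚ X) ∣ₚ H n)
    × (n % 4 ≡ 1 → (X *ₚ X *ₚ (X *ₚ X +ₚ constₚ (- (+ 1)))) ∣ₚ H n))
theorem1 n@(suc (suc l)) odd 3≤n =
  (λ ¬prime → ≈ₚ-from-eval (H n) zeroₚ (composite-vanishes l odd ¬prime)) , prime-case n (n / 2) (odd-form n odd) 3≤n
  where
  prime-case : ∀ n m → n ≡ suc (m ℕ.* 2) → 3 ≤ n → Prime n →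
    (H n ≈ₚ constₚ (signℤ ((n ∸ 1) / 2) * (+ n) ^ ((n ∸ 3) / 2)) *ₚ fromCoeffs (n ∸ 1) (bCoeff n))
    × (n % 4 ≡ 3 → (X *ₚ X) ∣ₚ H n)
    × (n % 4 ≡ 1 → (X *ₚ X *ₚ (X *ₚ X +ₚ constₚ (- (+ 1)))) ∣ₚ H n)
  prime-case n zero    refl (s≤s ()) _
  prime-case n (suc k) refl _ pr =
    formula , (λ _ → X²∣H) , λ e → X²[X²-1]∣H (trans (LegendreSymbol.ε≡signℤ (suc k) pr) (signℤ≡1 (suc k) e))
    where open PrimeCase k pr
theorem1 (suc zero) _ (s≤s ())
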